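{- With a suitable choice of the set of landmarks (depending on the variant and on the desired error), the basic algorithm approximates the longest palindrome with additive error $E\in[1,n]$ using $\mathcal{O}\left(\frac{n}{E}\right)$ words of memory and $\mathcal{O}\left(\frac{n}{E}\right)$ time to process each character $T[h]$; and it approximates the longest palindrome with multiplicative error $(1+\varepsilon)$, for $\varepsilon\in[\frac{2}{n},n]$, using $\mathcal{O}\left(\frac{\log(n\varepsilon)}{\log(1+\varepsilon)}\right)$ words of memory and $\mathcal{O}\left(\frac{\log(n\varepsilon)}{\log(1+\varepsilon)}\right)$ time to process each character $T[h]$.
   Context: Streaming model: given $n$ and the error parameter, the characters $T[1],\dots,T[n]\in\Sigma$ (with $|\Sigma|\le \mathrm{poly}(n)$) arrive one by one and cannot be accessed again unless stored. Memory consists of words of $\Omega(\log\max\{n,|\Sigma|\})$ bits, with $\mathcal{O}(1)$-time basic operations. Only even-length palindromes are considered: the palindromic radius at $c$ is the largest $R(c)$ such that $T[c..(c+R(c)-1)]$ equals the reversal of $T[(c-R(c))..(c-1)]$, and a palindrome is measured by its radius. After reading each $T[h]$ a number $\ell$ must be output such that the largest palindromic radius $R$ in $T[1..h]$ satisfies $\ell\le R\le \ell+E$ (additive error $E$) or $\ell\le R\le(1+\varepsilon)\ell$ (multiplicative error $(1+\varepsilon)$). The algorithm is Monte Carlo: the answers are correct with probability at least $1-n^{ -c}$ for an arbitrarily large constant $c$. Basic algorithm: at every time $h$ (just after reading $T[h]$) there is a set of positions $t\in\{0,\dots,h\}$, called landmarks, for which the Karp-Rabin fingerprint of $T[1..t]$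 is stored; a landmark can only be created at time $h=t$ and may be discarded later. The fingerprint of $T[1..h]$ is always maintained. For every center $c$ there is a conceptual process $P(c)$; at time $h$ it can be run if $2c-h-2$ is a landmark, in which case it tests with the fingerprints whether $T[(2c-h-1)..h]$ is a palindrome (that is, whether $R(c)\ge h-c+1$) and if so updates the answer to the maximum of its current value and $h-c+1$. The basic algorithm, after reading each $T[h]$, runs all processes $P(c)$ for which $2c-h-2$ is a landmark, and reports the current answer.
   Formalization: The error parameters E and ε are rational numbers, given to the algorithm as a numerator and a denominator that each fit into one memory word; real parameters are covered only after rounding down, which costs constant factors. -}

module Defs where

open import Data.Bool using (Bool; true; false; if_then_else_; _∧_)
open import Data.Fin using (Fin; toℕ)
open import Data.Fin.Subset using (Subset; _∈_; ∁; ∣_∣)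
open import Data.Integer as ℤ using (ℤ)
open import Data.List using (List; []; _∷_; foldr; map; reverse; upTo)
open import Data.Nat
open import Data.Nat.Logarithm using (⌈log₂_⌉)
open import Data.Nat.Primality using (Prime)
open import Data.Nat.Properties using (m^n≢0)
open import Data.Product using (Σ-syntax; ∃-syntax; _×_)
open import Data.Rational.Unnormalised as ℚ using (ℚᵘ; ↥_; ↧ₙ_)
open import Algebra.Definitions.RawSemiring ℚ.+-*-rawSemiring using () renaming (_^_ to _^ℚ_)
open import Data.Sum using (_⊎_)
open import Relation.Binary.PropositionalEquality using (_≡_; _≢_)
open import Relation.Nullary using (does)

infixl 7 _div₀_ _mod₀_

-- Total division: dividing by 0 gives 0.
_div₀_ : ℕ → ℕ → ℕ
m div₀ zero  = 0
m div₀ suc n = m / suc n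

_mod₀_ : ℕ → ℕ → ℕ
m mod₀ zero  = 0
m mod₀ suc n = m % suc n

------------------------------------------------------------------------
-- Texts and palindromes

-- Positions are 1-based: T 1, T 2, … are the characters.  The value T 0 and
-- the values beyond the length of the text are never inspected.
Text : ℕ → Set
Text σ = ℕ → Fin σ

-- In T[1..h], the block T[c..c+r-1] is the reversal of T[c-r..c-1].
EvenPalindrome : ∀ {σ} → Text σ → (h c r : ℕ) → Set
EvenPalindrome T h c r =
  r < c × c + r ≤ suc h × (∀ i → i < r → T (c + i) ≡ T (c ∸ suc i))

IsRadius : ∀ {σ} → Text σ → (h c r : ℕ) → Set
IsRadius T h c r =
  EvenPalindrome T h c r × (∀ r′ → EvenPalindrome T h c r′ → r′ ≤ r)

IsLargestRadius : ∀ {σ} → Text σ → (h R : ℕ) → Set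
IsLargestRadius T h R =
  (∃[ c ] IsRadius T h c R) × (∀ c r → IsRadius T h c r → r ≤ R)

------------------------------------------------------------------------
-- Karp-Rabin fingerprints

-- T[t+1..h]
segment : ∀ {σ} → Text σ → (t h : ℕ) → List (Fin σ)
segment T t h = map (λ i → T (suc t + i)) (upTo (h ∸ t))

-- fingerprint p x (a₁ … aₘ) = (a₁ x + a₂ x² + … + aₘ xᵐ) mod p
fingerprint : ∀ {σ} → (p x : ℕ) → List (Fin σ) → ℕ
fingerprint p x u = foldr (λ a s → x * (toℕ a + s)) 0 u mod₀ p

-- The fingerprint of T[t+1..h] agrees with that of its reversal.
palindromeTest : ∀ {σ} → (p x : ℕ) → Text σ → (t h : ℕ) → Bool
palindromeTest p x T t h =
  does (fingerprint p x (segment T t h) ≟ fingerprint p x (reverse (segment T t h)))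

------------------------------------------------------------------------
-- The basic algorithm

-- 𝓛 h t ≡ true: position t is a landmark at time h.
Landmarks : Set
Landmarks = ℕ → ℕ → Bool

record Admissible (𝓛 : Landmarks) : Set where
  field
    inPast  : ∀ h t → 𝓛 h t ≡ true → t ≤ h
    created : ∀ h t → 𝓛 (suc h) t ≡ true → t ≡ suc h ⊎ 𝓛 h t ≡ true

-- The process P(c) at time h, acting on the current answer.
process : ∀ {σ} → (p x : ℕ) → Landmarks → Text σ → (h c : ℕ) → ℕ → ℕ
process p x 𝓛 T h c ℓ =
  if does (h + 2 ≤? 2 * c) ∧ 𝓛 h t ∧ palindromeTest p x T t h
  then ℓ ⊔ (suc h ∸ c)
  else ℓ
  where
  t = 2 * c ∸ h ∸ 2

-- The answer reported after reading T[h].  The order in which the processes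
-- are run is immaterial because each of them only takes a maximum.
answer : ∀ {σ} → (p x : ℕ) → Landmarks → Text σ → ℕ → ℕ
answer p x 𝓛 T zero    = 0
answer p x 𝓛 T (suc h) =
  foldr (process p x 𝓛 T (suc h)) (answer p x 𝓛 T h) (upTo (suc (suc h)))

------------------------------------------------------------------------
-- The word RAM: programs over one array of w-bit words

data Op : Set where
  add sub mul quo rem less equal : Op

data Exp : Set where
  lit  : ℕ → Exp
  load : Exp → Exp
  bin  : Op → Exp → Exp → Exp

data Cmd : Set where
  skip  : Cmd
  store : (address value : Exp) → Cmd
  _⨾_   : Cmd → Cmd → Cmd
  cond  : Exp → Cmd → Cmd → Cmd
  while : Exp → Cmd → Cmd

infixr 5 _⨾_

Memory : Set
Memory = ℕ → ℕ

infixl 9 _[_↦_]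

_[_↦_] : Memory → ℕ → ℕ → Memory
(m [ a ↦ v ]) i = if i ≡ᵇ a then v else m i

applyOp : Op → ℕ → ℕ → ℕ
applyOp add   a b = a + b
applyOp sub   a b = a ∸ b
applyOp mul   a b = a * b
applyOp quo   a b = a div₀ b
applyOp rem   a b = a mod₀ b
applyOp less  a b = if a <ᵇ b then 1 else 0
applyOp equal a b = if a ≡ᵇ b then 1 else 0

-- The low w bits of v.
word : (w v : ℕ) → ℕ
word w v = _%_ v (2 ^ w) {{m^n≢0 2 w}}

eval : (w : ℕ) → Memory → Exp → ℕ
eval w m (lit v)     = word w v
eval w m (load a)    = m (eval w m a)
eval w m (bin o a b) = word w (applyOp o (eval w m a) (eval w m b))

evalTime : Exp → ℕ
evalTime (lit _)     = 1
evalTime (load a)    = suc (evalTime a)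
evalTime (bin _ a b) = suc (evalTime a + evalTime b)

-- w , S ⊢⟨ C , m ⟩⇓[ τ ] m′: started in memory m, the command C halts after τ
-- elementary steps in memory m′.  Only cells below S can be written; the
-- cells from S on keep their initial value 0, so S words suffice.
data _,_⊢⟨_,_⟩⇓[_]_ (w S : ℕ) : Cmd → Memory → ℕ → Memory → Set where
  ⇓skip  : ∀ {m} → w , S ⊢⟨ skip , m ⟩⇓[ 1 ] m
  ⇓store : ∀ {m a e} → eval w m a < S →
           w , S ⊢⟨ store a e , m ⟩⇓[ suc (evalTime a + evalTime e) ]
             (m [ eval w m a ↦ eval w m e ])
  ⇓seq   : ∀ {m m′ m″ τ τ′ C D} →
           w , S ⊢⟨ C , m ⟩⇓[ τ ] m′ → w , S ⊢⟨ D , m′ ⟩⇓[ τ′ ] m″ →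
           w , S ⊢⟨ C ⨾ D , m ⟩⇓[ τ + τ′ ] m″
  ⇓then  : ∀ {m m′ τ e C D} → eval w m e ≢ 0 →
           w , S ⊢⟨ C , m ⟩⇓[ τ ] m′ →
           w , S ⊢⟨ cond e C D , m ⟩⇓[ suc (evalTime e + τ) ] m′
  ⇓else  : ∀ {m m′ τ e C D} → eval w m e ≡ 0 →
           w , S ⊢⟨ D , m ⟩⇓[ τ ] m′ →
           w , S ⊢⟨ cond e C D , m ⟩⇓[ suc (evalTime e + τ) ] m′
  ⇓exit  : ∀ {m e C} → eval w m e ≡ 0 →
           w , S ⊢⟨ while e C , m ⟩⇓[ suc (evalTime e) ] m
  ⇓loop  : ∀ {m m′ m″ τ τ′ e C} → eval w m e ≢ 0 →
           w , S ⊢⟨ C , m ⟩⇓[ τ ] m′ → w , S ⊢⟨ while e C , m′ ⟩⇓[ τ′ ] m″ →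
           w , S ⊢⟨ while e C , m ⟩⇓[ suc (evalTime e + (τ + τ′)) ] m″

------------------------------------------------------------------------
-- Streaming implementations

inputCell outputCell reservedCells : ℕ
inputCell     = 0
outputCell    = 1
reservedCells = 7

-- Before the stream starts, the memory holds n, the error parameter e (as a
-- fraction), the modulus p and the random base x.  There is no preprocessing:
-- any initialisation is paid for when the first character is processed.
initialMemory : (n : ℕ) (e : ℚᵘ) (p x : ℕ) → Memory
initialMemory n e p x 2 = n
initialMemory n e p x 3 = ℤ.∣ ↥ e ∣
initialMemory n e p x 4 = ↧ₙ e
initialMemory n e p x 5 = p
initialMemory n e p x 6 = x
initialMemory n e p x _ = 0

-- Reaches … h m: m is the memory after the program C has been run once on each
-- of T[1], …, T[h], every run having a number of steps that satisfies InTime.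
-- A character is available only through the input cell, and only in its turn.
data Reaches {σ : ℕ} (w S : ℕ) (C : Cmd) (InTime : ℕ → Set) (start : Memory)
             (T : Text σ) : ℕ → Memory → Set where
  begin : Reaches w S C InTime start T 0 start
  next  : ∀ {h m m′ τ} → Reaches w S C InTime start T h m →
          w , S ⊢⟨ C , m [ inputCell ↦ toℕ (T (suc h)) ] ⟩⇓[ τ ] m′ →
          InTime τ →
          Reaches w S C InTime start T (suc h) m′

-- Each landmark, as well as the current position h, has a cell of its own
-- that holds the fingerprint of the corresponding prefix.
FingerprintsStored : ∀ {σ} → (S p x : ℕ) → Landmarks → Text σ → (h : ℕ) → Memory → Set
FingerprintsStored S p x 𝓛 T h m =
  Σ[ cell ∈ (ℕ → ℕ) ]
    (∀ t → Stored t → cell t < S × m (cell t) ≡ fingerprint p x (segment T 0 t)) ×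
    (∀ t u → Stored t → Stored u → cell t ≡ cell u → t ≡ u)
  where
  Stored : ℕ → Set
  Stored t = 𝓛 h t ≡ true ⊎ t ≡ h

-- With w-bit words and S words of memory, C carries out the basic algorithm
-- with landmarks 𝓛 on the text T of length n.
Implements : ∀ {σ} → (w S : ℕ) → Cmd → (InTime : ℕ → Set) →
             (n : ℕ) (e : ℚᵘ) (p x : ℕ) → Landmarks → Text σ → Set
Implements w S C InTime n e p x 𝓛 T =
  ∀ h → 1 ≤ h → h ≤ n →
  Σ[ m ∈ Memory ]
    Reaches w S C InTime (initialMemory n e p x) T h m ×
    m outputCell ≡ answer p x 𝓛 T h ×
    FingerprintsStored S p x 𝓛 T h m

------------------------------------------------------------------------
-- Approximation and resource bounds

fromℕ : ℕ → ℚᵘ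
fromℕ k = ℤ.+ k ℚ./ 1

-- InRange n e     : e is an allowed error parameter for length n;
-- Approx e ℓ R    : ℓ is an acceptable answer if the largest radius is R;
-- Bound K n e s   : s is at most K times the resource bound.
record Variant : Set₁ where
  field
    InRange : (n : ℕ) .{{_ : NonZero n}} → ℚᵘ → Set
    Approx  : ℚᵘ → (ℓ R : ℕ) → Set
    Bound   : (K n : ℕ) → ℚᵘ → ℕ → Set

-- s ≤ K · n / E, with the division by E > 0 cleared.
additive : Variant
additive = record
  { InRange = λ n E → fromℕ 1 ℚ.≤ E × E ℚ.≤ fromℕ n
  ; Approx  = λ E ℓ R → ℓ ≤ R × fromℕ R ℚ.≤ fromℕ ℓ ℚ.+ E
  ; Bound   = λ K n E s → fromℕ s ℚ.* E ℚ.≤ fromℕ K ℚ.* fromℕ n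
  }

-- As log (1 + ε) > 0, the bound s ≤ K · log (n ε) / log (1 + ε) says that
-- log ((1 + ε)ˢ) ≤ log ((n ε)ᴷ), that is, (1 + ε)ˢ ≤ (n ε)ᴷ.
multiplicative : Variant
multiplicative = record
  { InRange = λ n ε → ℤ.+ 2 ℚ./ n ℚ.≤ ε × ε ℚ.≤ fromℕ n
  ; Approx  = λ ε ℓ R → ℓ ≤ R × fromℕ R ℚ.≤ (fromℕ 1 ℚ.+ ε) ℚ.* fromℕ ℓ
  ; Bound   = λ K n ε s → (fromℕ 1 ℚ.+ ε) ^ℚ s ℚ.≤ (fromℕ n ℚ.* ε) ^ℚ K
  }

-- For x uniform in {1,…,p-1}, the event has probability at least 1 - n⁻ᶜ:
-- it holds on a set G of outcomes whose complement has at most (p-1)/nᶜ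
-- elements.  (x ≠ 0 so that multiplication by x is invertible modulo p.)
HighProbability : (c n p : ℕ) → (ℕ → Set) → Set
HighProbability c n p Event =
  Σ[ G ∈ Subset (p ∸ 1) ]
    (∀ i → i ∈ G → Event (suc (toℕ i))) × n ^ c * ∣ ∁ G ∣ ≤ p ∸ 1

-- The landmarks are a function of n and the error parameter alone.  The
-- failure exponent c and the exponent d of the polynomial bound on the
-- alphabet are constants on which the program, the hidden constant K, the
-- exponent a that fixes the magnitude of the prime modulus, and the constant
-- k in the word length Ω(log max{n,σ}) may depend.  Since
-- k > a + 1, the numbers n and p and the characters fit into words; the error
-- parameter is required to.  The 2 in M makes M > 1, so that there
-- is always a prime between Mᵃ and Mᵃ⁺¹.
BasicAlgorithmAchieves : Variant → Set
BasicAlgorithmAchieves V =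
  Σ[ 𝓛 ∈ (ℕ → ℚᵘ → Landmarks) ]
    (∀ n e → Admissible (𝓛 n e)) ×
    (∀ (c d : ℕ) →
      Σ[ C ∈ Cmd ] Σ[ K ∈ ℕ ] Σ[ a ∈ ℕ ] Σ[ k ∈ ℕ ]
        suc a < k ×
        (∀ (n σ : ℕ) .{{_ : NonZero n}} (e : ℚᵘ) (p w : ℕ) →
          let M = n ⊔ σ ⊔ 2 in
          InRange n e →
          σ ≤ n ^ d + d →
          Prime p → M ^ a ≤ p → p ≤ M ^ suc a →
          k * ⌈log₂ M ⌉ ≤ w → ℤ.∣ ↥ e ∣ < 2 ^ w → ↧ₙ e < 2 ^ w →
          (∀ (T : Text σ) → HighProbability c n p λ x →
            ∀ h → 1 ≤ h → h ≤ n →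
            ∃[ R ] IsLargestRadius T h R × Approx e (answer p x (𝓛 n e) T h) R) ×
          (Σ[ S ∈ ℕ ]
            reservedCells ≤ S × Bound K n e S ×
            (∀ (T : Text σ) (x : ℕ) → 1 ≤ x → x < p →
              Implements w S C (Bound K n e) n e p x (𝓛 n e) T))))
  where open Variant V

-- Landmarks live on levels.  A level of spacing g keeps its Q most recent multiples of
-- g in a circular buffer.  For additive error E a single level of spacing ⌊E⌋ that keeps
-- everything suffices: the palindrome of radius R around u + 1 is verified from the
-- landmark u − r at time u + r for some r with R − g < r ≤ R.  For multiplicative error
-- 1 + ε the spacings are 1, b, b², … with b = 2 + ⌊ε⌋, and Q is proportional to
-- A = 2 + ⌊1/ε⌋.  The level with A g ≤ R < A g b verifies a radius r ≥ R / (1 + ε).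
-- Since (1 + ε)^Q is at most a fixed power of b and b^(number of levels) is at most a
-- fixed power of n ε, the resources are O(log (n ε) / log (1 + ε)).
--
-- With F and R the fingerprints of T[1..t] and of its reversal, T[t+1..h] passes the test
-- if and only if F h + xʰ R t ≡ F t + xᵗ R h (mod p), which needs no inverse of x.
--
-- A false positive for T[t+1..h] makes x a root modulo p of a nonzero polynomial of degree
-- less than n, so at most n³ of the p − 1 values of x are bad.
module Submission where

open import Defs renaming (begin to before-stream)
open import Data.Bool using (Bool; true; false; if_then_else_; _∧_; _∨_)
import Data.Bool as Bool
import Data.Bool.Properties as Bool
open import Data.Empty using (⊥-elim)
open import Data.Fin using (Fin; toℕ)
import Data.Fin as Fin
import Data.Fin.Properties as Fin
open import Data.Fin.Subset using (Subset)
import Data.Fin.Subset as Sub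
import Data.Fin.Subset.Properties as Sub
open import Data.Integer as ℤ using (ℤ)
import Data.Integer.Properties as ℤ
import Data.Integer.Divisibility as ℤ
import Data.Integer.Divisibility.Signed as ℤˢ
open import Data.Integer.Tactic.RingSolver using () renaming (solve-∀ to solveℤ-∀)
open import Data.List using (List; []; _∷_; foldr; map; reverse; upTo; length; applyUpTo; applyDownFrom; _++_; [_])
import Data.List.Properties as List
open import Data.List.Membership.Propositional using (_∈_)
open import Data.List.Membership.Propositional.Properties using (∈-upTo⁺; ∈-upTo⁻)
open import Data.List.Relation.Unary.Any using (here; there)
open import Data.Nat
open import Data.Nat.Divisibility
open import Data.Nat.DivMod
open import Data.Nat.Logarithm using (⌈log₂_⌉; ⌈log₂⌉-mono-≤; ⌈log₂⌈n/2⌉⌉≡⌈log₂n⌉∸1)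
open import Data.Nat.Induction using (<-rec)
open import Data.Nat.Primality using (Prime; euclidsLemma; prime⇒nonZero)
open import Data.Nat.Properties
open import Data.Nat.Tactic.RingSolver using (solve-∀)
open import Data.Product using (Σ-syntax; ∃-syntax; _×_; _,_; proj₁; proj₂)
open import Data.Rational.Unnormalised as ℚ using (ℚᵘ; mkℚᵘ; ↥_; ↧ₙ_)
open import Data.Sum using (_⊎_; inj₁; inj₂; [_,_]′)
open import Data.Unit using (⊤; tt)
open import Data.Vec using (tabulate; []; _∷_)
import Data.Vec.Properties as Vec
open import Function using (_∘_; id)
open import Algebra.Definitions.RawSemiring ℚ.+-*-rawSemiring using () renaming (_^_ to _^ℚ_)
open import Relation.Binary.PropositionalEquality hiding ([_])
open import Relation.Nullary using (¬_; Dec; yes; no; contradiction)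
open import Relation.Nullary.Decidable using (_×-dec_; map′)
open import Relation.Binary.Definitions using (tri<; tri≈; tri>)

-- Derived rules for the word RAM

-- Probability and implementation are kept apart. For every base 1 ≤ x < p the program reports
-- exactly `answer`, false positives included; only the comparison of `answer` with the true radius
-- restricts x. The program enumerates candidates by slots and the definition by centres, so the two
-- are compared as maxima.
--
-- The obstacle in the multiplicative case is to keep the constants uniform for ε from 2/n to n. A
-- buffer that serves every radius below A g b in full would need on the order of A b slots. Instead
-- a level aims at the radius m = min(R, (2A + 1) g); the landmark it uses is at most 2 m old, so
-- about 4 A slots suffice whatever b is. Aiming low is harmless: if R > (2A + 1) g, at least 2 A g
-- is verified, while R < A g b ≤ A g (2 + ε). A ratio b that grows with ε limits the number of
-- levels for large ε; spacings that stop near n / A limit it for small ε. Logarithms never occur: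
-- (1 + ε)^Q ≤ b^23 and b^levels ≤ (n ε)^4 are combined as inequalities between powers.

≡ᵇ-refl : ∀ a → (a ≡ᵇ a) ≡ true
≡ᵇ-refl zero    = refl
≡ᵇ-refl (suc a) = ≡ᵇ-refl a

≢⇒≡ᵇ : ∀ {a b} → a ≢ b → (a ≡ᵇ b) ≡ false
≢⇒≡ᵇ {zero}  {zero}  a≢b = contradiction refl a≢b
≢⇒≡ᵇ {zero}  {suc b} a≢b = refl
≢⇒≡ᵇ {suc a} {zero}  a≢b = refl
≢⇒≡ᵇ {suc a} {suc b} a≢b = ≢⇒≡ᵇ (a≢b ∘ cong suc)

≡ᵇ-sound : ∀ a b → (a ≡ᵇ b) ≡ true → a ≡ b
≡ᵇ-sound a b eq = ≡ᵇ⇒≡ a b (subst Bool.T (sym eq) tt)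

hit : ∀ (m : Memory) a v → (m [ a ↦ v ]) a ≡ v
hit m a v rewrite ≡ᵇ-refl a = refl

miss : ∀ (m : Memory) {a i} v → i ≢ a → (m [ a ↦ v ]) i ≡ m i
miss m v i≢a rewrite ≢⇒≡ᵇ i≢a = refl

reg : ℕ → Exp
reg i = load (lit i)

-- An upper bound on the number of steps; only meaningful for loop-free commands.
time : Cmd → ℕ
time skip         = 1
time (store a e)  = suc (evalTime a + evalTime e)
time (C ⨾ D)      = time C + time D
time (cond e C D) = suc (evalTime e + (time C ⊔ time D))
time (while e C)  = 0

module RAM (w S : ℕ) (32<2^w : 32 < 2 ^ w) where

  -- A total-correctness triple in which τ is only an upper bound on the steps, so that branches of
  -- different length can be charged alike.
  Run : Cmd → Memory → ℕ → (Memory → Set) → Set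
  Run C m τ Post =
    Σ[ m′ ∈ Memory ] Σ[ τ′ ∈ ℕ ] (w , S ⊢⟨ C , m ⟩⇓[ τ′ ] m′) × τ′ ≤ τ × Post m′

  word-small : ∀ {v} → v < 2 ^ w → word w v ≡ v
  word-small = m<n⇒m%n≡m {{m^n≢0 2 w}}

  -- The implicit check is settled by evaluation at each concrete literal. No constant or register
  -- number of the program exceeds 32, so none is changed by truncation to w bits.
  ev-lit : ∀ {m} v {_ : Bool.T (v ≤ᵇ 32)} → eval w m (lit v) ≡ v
  ev-lit v {v≤32} = word-small (≤-<-trans (≤ᵇ⇒≤ v 32 v≤32) 32<2^w)

  ev-load : ∀ {m a A V} → eval w m a ≡ A → m A ≡ V → eval w m (load a) ≡ V
  ev-load refl refl = refl

  ev-reg : ∀ {m} i {i≤32 : Bool.T (i ≤ᵇ 32)} {V} → m i ≡ V → eval w m (reg i) ≡ V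
  ev-reg {m} i {i≤32} = ev-load {m} {lit i} (ev-lit {m} i {i≤32})

  ev-bin : ∀ {m o a b A B} → eval w m a ≡ A → eval w m b ≡ B → applyOp o A B < 2 ^ w →
           eval w m (bin o a b) ≡ applyOp o A B
  ev-bin refl refl = word-small

  run-skip : ∀ {m Post} → Post m → Run skip m 1 Post
  run-skip post = _ , _ , ⇓skip , ≤-refl , post

  run-store : ∀ {m a e A V} {Post : Memory → Set} →
              eval w m a ≡ A → eval w m e ≡ V → A < S → Post (m [ A ↦ V ]) →
              Run (store a e) m (time (store a e)) Post
  run-store refl refl A<S post = _ , _ , ⇓store A<S , ≤-refl , post

  run-seq : ∀ {m C D τ τ′} {Mid Post : Memory → Set} →
            Run C m τ Mid → (∀ m′ → Mid m′ → Run D m′ τ′ Post) →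
            Run (C ⨾ D) m (τ + τ′) Post
  run-seq (m′ , _ , C⇓ , τ₁≤ , mid) rest with rest m′ mid
  ... | m″ , _ , D⇓ , τ₂≤ , post = m″ , _ , ⇓seq C⇓ D⇓ , +-mono-≤ τ₁≤ τ₂≤ , post

  -- The memory after the store is kept as an explicit update instead of an existential one; later
  -- reads of concrete registers then reduce by computation.
  run-store-seq : ∀ {m a e A V D τ} {Post : Memory → Set} →
                  eval w m a ≡ A → eval w m e ≡ V → A < S →
                  Run D (m [ A ↦ V ]) τ Post →
                  Run (store a e ⨾ D) m (time (store a e) + τ) Post
  run-store-seq {m} {A = A} {V} a≡ e≡ A<S rest =
    run-seq {Mid = λ m′ → m′ ≡ m [ A ↦ V ]} (run-store a≡ e≡ A<S refl) (λ { _ refl → rest })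

  run-cond : ∀ {m e V C D} {Post : Memory → Set} → eval w m e ≡ V →
             (V ≢ 0 → Run C m (time C) Post) → (V ≡ 0 → Run D m (time D) Post) →
             Run (cond e C D) m (time (cond e C D)) Post
  run-cond {e = e} {V} {C} {D} refl onTrue onFalse with V ≟ 0
  ... | yes V≡0 with onFalse V≡0
  ...   | m′ , _ , D⇓ , τ≤ , post =
    m′ , _ , ⇓else V≡0 D⇓ , s≤s (+-monoʳ-≤ (evalTime e) (≤-trans τ≤ (m≤n⊔m (time C) (time D)))) , post
  run-cond {e = e} {V} {C} {D} refl onTrue onFalse | no V≢0 with onTrue V≢0
  ...   | m′ , _ , C⇓ , τ≤ , post =
    m′ , _ , ⇓then V≢0 C⇓ , s≤s (+-monoʳ-≤ (evalTime e) (≤-trans τ≤ (m≤m⊔n (time C) (time D)))) , post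

  run-exit : ∀ {m e C} {Post : Memory → Set} → eval w m e ≡ 0 → Post m →
             Run (while e C) m (suc (evalTime e)) Post
  run-exit e≡0 post = _ , _ , ⇓exit e≡0 , ≤-refl , post

  run-loop : ∀ {m e C V τ τ′} {Mid Post : Memory → Set} → eval w m e ≡ V → V ≢ 0 →
             Run C m τ Mid → (∀ m′ → Mid m′ → Run (while e C) m′ τ′ Post) →
             Run (while e C) m (suc (evalTime e + (τ + τ′))) Post
  run-loop {e = e} refl V≢0 (m′ , _ , C⇓ , τ₁≤ , mid) rest with rest m′ mid
  ... | m″ , _ , D⇓ , τ₂≤ , post =
    m″ , _ , ⇓loop V≢0 C⇓ D⇓ , s≤s (+-monoʳ-≤ (evalTime e) (+-mono-≤ τ₁≤ τ₂≤)) , post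

  run-weaken : ∀ {C m τ τ′} {Post Post′ : Memory → Set} → τ ≤ τ′ → (∀ m → Post m → Post′ m) →
               Run C m τ Post → Run C m τ′ Post′
  run-weaken τ≤ imp (m′ , _ , C⇓ , le , post) = m′ , _ , C⇓ , ≤-trans le τ≤ , imp m′ post

-- The program

infixl 6 _∔_
infixl 7 _·_

_∔_ _·_ : Exp → Exp → Exp
_∔_ = bin add
_·_ = bin mul

-- Registers: 7 holds h; 8, 9 and 10 hold F h, R h and Y h; 11 holds the spacing g of
-- the current level; 12, 13 and 14 hold b, Q and L; 15 holds the address of the
-- current slot and 16 the number of slots of the level that are still to be visited.
-- The slots start at cell 17, and each consists of t, F t, R t and Y t.
halfExp testExp slotExp : Exp
halfExp = bin quo (bin sub (reg 7) (load (reg 15))) (lit 2)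
testExp =
  -- Conjunction is the product of 0/1 words. Parity is tested because only blocks of even length
  -- have a centre, and the comparison with the current answer turns the subsequent store into a
  -- maximum.
  bin equal (bin rem (bin sub (reg 7) (load (reg 15))) (lit 2)) (lit 0)
  · bin equal
      (bin rem (reg 8 ∔ (reg 10 ∔ lit 1) · load (reg 15 ∔ lit 2)) (reg 5))
      (bin rem (load (reg 15 ∔ lit 1) ∔ (load (reg 15 ∔ lit 3) ∔ lit 1) · reg 9) (reg 5))
  · bin less (reg 1) halfExp
slotExp = reg 15 ∔ bin rem (bin quo (reg 7) (reg 11)) (reg 13) · lit 4

visitSlot writeSlot scanLevel levelBody allLevels advance : Cmd
visitSlot =
  cond testExp (store (lit 1) halfExp) skip ⨾
  store (lit 15) (reg 15 ∔ lit 4) ⨾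
  store (lit 16) (bin sub (reg 16) (lit 1))
writeSlot =
  cond (bin equal (bin rem (reg 7) (reg 11)) (lit 0))
    (store slotExp (reg 7) ⨾
     store (slotExp ∔ lit 1) (reg 8) ⨾
     store (slotExp ∔ lit 2) (reg 9) ⨾
     store (slotExp ∔ lit 3) (reg 10))
    skip
scanLevel = while (reg 16) visitSlot
levelBody =
  writeSlot ⨾
  store (lit 16) (reg 13) ⨾
  scanLevel ⨾
  store (lit 11) (reg 11 · reg 12)
allLevels = while (bin less (reg 11) (reg 14 ∔ lit 1)) levelBody
advance =
  store (lit 7) (reg 7 ∔ lit 1) ⨾
  -- The power is advanced before the fingerprint, since the new character enters F with weight
  -- xʰ⁺¹. Adding p - 1 subtracts 1 modulo p.
  store (lit 10) (bin rem ((reg 10 ∔ lit 1) · reg 6 ∔ bin sub (reg 5) (lit 1)) (reg 5)) ⨾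
  store (lit 8) (bin rem (reg 8 ∔ (reg 10 ∔ lit 1) · reg 0) (reg 5)) ⨾
  store (lit 9) (bin rem ((reg 9 ∔ reg 0) · reg 6) (reg 5)) ⨾
  store (lit 15) (lit 17)

-- There is no special case for the first character: recomputing the parameters takes constant time,
-- and the spacing register has to be reset anyway, because the loop over the levels leaves it
-- beyond the last spacing.
streamProgram : Cmd → Cmd
streamProgram setup = setup ⨾ advance ⨾ allLevels

visitTime guardTime : ℕ
visitTime = 3 + time visitSlot
guardTime = suc (evalTime (bin less (reg 11) (reg 14 ∔ lit 1)))

levelTime : ℕ → ℕ
levelTime Q =
  time writeSlot + (time (store (lit 16) (reg 13)) + ((Q * visitTime + 3) + time (store (lit 11) (reg 11 · reg 12))))

-- Bounds for word operations and a pure model of the program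

mod₀-< : ∀ a {p} → 0 < p → a mod₀ p < p
mod₀-< a {suc p} _ = m%n<n a (suc p)

mod₀-≤ : ∀ a p → a mod₀ p ≤ a
mod₀-≤ a zero    = z≤n
mod₀-≤ a (suc p) = m%n≤m a (suc p)

div₀-≤ : ∀ a p → a div₀ p ≤ a
div₀-≤ a zero    = z≤n
div₀-≤ a (suc p) = m/n≤m a (suc p)

bit : Bool → ℕ
bit b = if b then 1 else 0

bit≤1 : ∀ b → bit b ≤ 1
bit≤1 true  = ≤-refl
bit≤1 false = z≤n

-- The most recent multiple i g ≤ h with i ≡ s (mod Q), or 0 if there is none.
latest : (g Q s h : ℕ) → ℕ
latest g Q s zero    = 0
latest g Q s (suc h) =
  if (suc h mod₀ g ≡ᵇ 0) ∧ ((suc h div₀ g) mod₀ Q ≡ᵇ s) then suc h else latest g Q s h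

-- f is fuel; it suffices that L < g + f.
levels : (b L f g : ℕ) → List ℕ
levels b L zero    g = []
levels b L (suc f) g = if g <ᵇ L + 1 then g ∷ levels b L f (g * b) else []

-- The loops as functions of numbers, without memory. The execution proof relates the machine to
-- this model, and the comparison with `answer` then deals with arithmetic alone. F, R and Y stay
-- abstract, so the machine part knows nothing about fingerprints.
module Scan (p : ℕ) (F R Y : ℕ → ℕ) where

  passes : (h t : ℕ) → Bool
  passes h t = ((h ∸ t) mod₀ 2 ≡ᵇ 0) ∧
    ((F h + (Y h + 1) * R t) mod₀ p ≡ᵇ (F t + (Y t + 1) * R h) mod₀ p)

  visit : (h t ℓ : ℕ) → ℕ
  visit h t ℓ = if passes h t ∧ (ℓ <ᵇ (h ∸ t) div₀ 2) then (h ∸ t) div₀ 2 else ℓ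

  scan : (h k : ℕ) → (ℕ → ℕ) → ℕ → ℕ
  scan h zero    val ℓ = ℓ
  scan h (suc k) val ℓ = scan h k (val ∘ suc) (visit h (val 0) ℓ)

  scanLevels : (h Q : ℕ) → List ℕ → ℕ → ℕ
  scanLevels h Q []       ℓ = ℓ
  scanLevels h Q (g ∷ gs) ℓ = scanLevels h Q gs (scan h Q (λ s → latest g Q s h) ℓ)

  reported : (Q : ℕ) → List ℕ → ℕ → ℕ
  reported Q gs zero    = 0
  reported Q gs (suc h) = scanLevels (suc h) Q gs (reported Q gs h)

-- Execution of the program

-- D bounds the operands of the modular arithmetic. The intermediate results there are a product of
-- two such numbers plus another one, or a sum of two times a third, hence at most 3 D²; therefore 4
-- D² ≤ 2ʷ excludes wrap-around. Addresses are covered by S < 2ʷ.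
module Machine
  (w S p x n D : ℕ) (F R Y : ℕ → ℕ)
  (0<p : 0 < p) (p≤D : p ≤ D) (x≤D : x ≤ D) (n≤D : n ≤ D) (32≤D : 32 ≤ D)
  (4D²≤2^w : 4 * (D * D) ≤ 2 ^ w) (S<2^w : S < 2 ^ w) (17≤S : 17 ≤ S)
  (F<p : ∀ t → F t < p) (R<p : ∀ t → R t < p) (Y<p : ∀ t → Y t < p)
  where

  D≤D² : D ≤ D * D
  D≤D² = m≤m*n D D {{>-nonZero (≤-trans (s≤s z≤n) 32≤D)}}

  fits : ∀ {v} → v ≤ 3 * (D * D) → v < 2 ^ w
  fits v≤ = <-≤-trans (≤-<-trans v≤ (*-monoˡ-< (D * D) {{>-nonZero (≤-trans (≤-trans (s≤s z≤n) 32≤D) D≤D²)}} (n<1+n 3))) 4D²≤2^w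

  D²-fits : ∀ {v} → v ≤ D * D → v < 2 ^ w
  D²-fits v≤ = fits (≤-trans v≤ (m≤m+n (D * D) _))

  D-fits : ∀ {v} → v ≤ D → v < 2 ^ w
  D-fits v≤ = D²-fits (≤-trans v≤ D≤D²)

  32<2^w : 32 < 2 ^ w
  32<2^w = D-fits 32≤D

  open RAM w S 32<2^w
  open Scan p F R Y

  bit-fits : ∀ b → bit b < 2 ^ w
  bit-fits b = D-fits (≤-trans (bit≤1 b) (≤-trans (s≤s z≤n) 32≤D))

  1+y≤D : ∀ {y} → y < p → y + 1 ≤ D
  1+y≤D {y} y<p = ≤-trans (subst (_≤ p) (+-comm 1 y) y<p) p≤D

  mul-fits : ∀ {u v} → u ≤ D → v ≤ D → u * v < 2 ^ w
  mul-fits u≤ v≤ = D²-fits (*-mono-≤ u≤ v≤)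

  add-mul-fits : ∀ {s u v} → s ≤ D → u ≤ D → v ≤ D → s + u * v < 2 ^ w
  add-mul-fits {s} {u} {v} s≤ u≤ v≤ =
    fits (+-mono-≤ (≤-trans s≤ D≤D²) (≤-trans (*-mono-≤ u≤ v≤) (m≤m+n (D * D) _)))

  SlotAt : Memory → (y t : ℕ) → Set
  SlotAt m y t =
    m (17 + y) ≡ t × m (17 + y + 1) ≡ F t × m (17 + y + 2) ≡ R t × m (17 + y + 3) ≡ Y t

  record Current (m : Memory) (h : ℕ) : Set where
    constructor current
    field
      r5  : m 5 ≡ p
      r7  : m 7 ≡ h
      r8  : m 8 ≡ F h
      r9  : m 9 ≡ R h
      r10 : m 10 ≡ Y h

  -- Write sets are Boolean functions so that, for a concrete register or an address of the form 17
  -- + y, lying outside the set is proved by `refl`.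
  scanned scratch : ℕ → Bool
  scanned i = (i ≡ᵇ 1) ∨ (i ≡ᵇ 15) ∨ (i ≡ᵇ 16)
  scratch i = (i ≡ᵇ 11) ∨ scanned i

  neither : ∀ {a b} → a ∨ b ≡ false → a ≡ false × b ≡ false
  neither {false} {false} refl = refl , refl

  _≈[_]_ : Memory → (ℕ → Bool) → Memory → Set
  m′ ≈[ f ] m = ∀ i → f i ≡ false → m′ i ≡ m i

  current-frame : ∀ {m m′ h} → m′ ≈[ scratch ] m → Current m h → Current m′ h
  current-frame fr (current a b c d e) =
    current (trans (fr 5 refl) a) (trans (fr 7 refl) b) (trans (fr 8 refl) c)
            (trans (fr 9 refl) d) (trans (fr 10 refl) e)

  conj-bits : ∀ a b c → bit a * bit b * bit c ≢ 0 → (a ∧ b) ∧ c ≡ true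
  conj-bits true  true  true  _ = refl
  conj-bits true  true  false ≢0 = contradiction refl ≢0
  conj-bits true  false c ≢0 = contradiction refl ≢0
  conj-bits false b     c ≢0 = contradiction refl ≢0

  conj-bits-zero : ∀ a b c → bit a * bit b * bit c ≡ 0 → (a ∧ b) ∧ c ≡ false
  conj-bits-zero true  true  false _ = refl
  conj-bits-zero true  false c _ = refl
  conj-bits-zero false b     c _ = refl

  bits-fit : ∀ a b → bit a * bit b < 2 ^ w
  bits-fit a b = mul-fits (≤-trans (bit≤1 a) (≤-trans (s≤s z≤n) 32≤D)) (≤-trans (bit≤1 b) (≤-trans (s≤s z≤n) 32≤D))

  bits-fit₃ : ∀ a b c → bit a * bit b * bit c < 2 ^ w
  bits-fit₃ true  true  true  = 1<2^w where 1<2^w = D-fits (≤-trans (s≤s z≤n) 32≤D)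
  bits-fit₃ true  true  false = D-fits z≤n
  bits-fit₃ true  false c     = D-fits z≤n
  bits-fit₃ false b     c     = D-fits z≤n

  add-lit : ∀ {m e z v} k {_ : Bool.T (k ≤ᵇ 32)} → eval w m e ≡ 17 + z → 17 + (z + k) ≤ v → v < 2 ^ w →
            eval w m (e ∔ lit k) ≡ 17 + (z + k)
  add-lit {m} {e} k {k≤} e≡ le v< = ev-bin {m = m} {o = add} {a = e} {b = lit k} e≡ (ev-lit {m} k {k≤}) (≤-<-trans le v<)

  visit-run : ∀ {h m z t ℓ k} → h ≤ n → Current m h → m 1 ≡ ℓ → m 15 ≡ 17 + z → m 16 ≡ suc k →
              SlotAt m z t → 17 + (z + 4) ≤ S → k < 2 ^ w →
              Run visitSlot m (time visitSlot) λ m′ →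
                m′ 1 ≡ visit h t ℓ × m′ 15 ≡ 17 + (z + 4) × m′ 16 ≡ k × m′ ≈[ scanned ] m
  visit-run {h} {m} {z} {t} {ℓ} {k} h≤n cur@(current r5 r7 r8 r9 r10) r1 r15 r16 (s₀ , s₁ , s₂ , s₃) z+4≤S k-fits =
    run-seq {Mid = λ m′ → m′ 1 ≡ visit h t ℓ × (∀ i → (i ≡ᵇ 1) ≡ false → m′ i ≡ m i)}
      (run-cond {e = testExp} test≡
        (λ V≢0 → run-store {a = lit 1} {e = halfExp} (ev-lit {m} 1) half≡ (≤-trans (s≤s (s≤s z≤n)) 17≤S)
          (sym (visit-true (conj-bits e₁ e₂ e₃ V≢0)) , λ i i≢1 → frame₁ i i≢1))
        (λ V≡0 → run-skip (trans r1 (sym (visit-false (conj-bits-zero e₁ e₂ e₃ V≡0))) , λ i _ → refl)))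
      (λ m₁ (o₁ , fr) →
        run-store-seq {a = lit 15} {e = reg 15 ∔ lit 4} (ev-lit {m₁} 15)
          (add-lit {m₁} {reg 15} 4 (ev-reg {m₁} 15 (trans (fr 15 refl) r15)) z+4≤S S<2^w)
          (≤-trans (m≤m+n 16 1) 17≤S)
        (run-store {a = lit 16} {e = bin sub (reg 16) (lit 1)} (ev-lit {m₁ [ 15 ↦ 17 + (z + 4) ]} 16)
          (ev-bin {m₁ [ 15 ↦ 17 + (z + 4) ]} {sub} {reg 16} {lit 1} (ev-reg {m₁ [ 15 ↦ 17 + (z + 4) ]} 16 (trans (fr 16 refl) r16)) (ev-lit {m₁ [ 15 ↦ 17 + (z + 4) ]} 1) k-fits) 17≤S
          (o₁ , refl , refl , frame₂ fr)))
    where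
    e₁ e₂ e₃ : Bool
    e₁ = (h ∸ t) mod₀ 2 ≡ᵇ 0
    e₂ = (F h + (Y h + 1) * R t) mod₀ p ≡ᵇ (F t + (Y t + 1) * R h) mod₀ p
    e₃ = ℓ <ᵇ (h ∸ t) div₀ 2
    h≤D = ≤-trans h≤n n≤D
    F≤D : ∀ u → F u ≤ D
    F≤D u = ≤-trans (<⇒≤ (F<p u)) p≤D
    R≤D : ∀ u → R u ≤ D
    R≤D u = ≤-trans (<⇒≤ (R<p u)) p≤D
    mod-fits : ∀ u → u mod₀ p < 2 ^ w
    mod-fits u = D-fits (≤-trans (<⇒≤ (mod₀-< u 0<p)) p≤D)
    ptr≡ : eval w m (reg 15) ≡ 17 + z
    ptr≡ = ev-reg {m} 15 r15
    below : ∀ {j} → j ≤ 4 → 17 + (z + j) ≤ S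
    below j≤4 = ≤-trans (+-monoʳ-≤ 17 (+-monoʳ-≤ z j≤4)) z+4≤S
    diff≡ : eval w m (bin sub (reg 7) (load (reg 15))) ≡ h ∸ t
    diff≡ = ev-bin {m} {sub} {reg 7} {load (reg 15)} (ev-reg {m} 7 r7) (ev-load {m} {reg 15} ptr≡ s₀) (D-fits (≤-trans (m∸n≤m h t) h≤D))
    half≡ : eval w m halfExp ≡ (h ∸ t) div₀ 2
    half≡ = ev-bin {m} {quo} {bin sub (reg 7) (load (reg 15))} {lit 2} diff≡ (ev-lit {m} 2)
              (D-fits (≤-trans (div₀-≤ (h ∸ t) 2) (≤-trans (m∸n≤m h t) h≤D)))
    rem≡ : eval w m (bin rem (bin sub (reg 7) (load (reg 15))) (lit 2)) ≡ (h ∸ t) mod₀ 2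
    rem≡ = ev-bin {m} {rem} {bin sub (reg 7) (load (reg 15))} {lit 2} diff≡ (ev-lit {m} 2)
              (D-fits (≤-trans (mod₀-≤ (h ∸ t) 2) (≤-trans (m∸n≤m h t) h≤D)))
    par≡ : eval w m (bin equal (bin rem (bin sub (reg 7) (load (reg 15))) (lit 2)) (lit 0)) ≡ bit e₁
    par≡ = ev-bin {m} {equal} {bin rem (bin sub (reg 7) (load (reg 15))) (lit 2)} {lit 0} rem≡ (ev-lit {m} 0) (bit-fits e₁)
    Y+1≡ : eval w m (reg 10 ∔ lit 1) ≡ Y h + 1
    Y+1≡ = ev-bin {m} {add} {reg 10} {lit 1} (ev-reg {m} 10 r10) (ev-lit {m} 1) (D-fits (1+y≤D (Y<p h)))
    Yt≡ : eval w m (load (reg 15 ∔ lit 3)) ≡ Y t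
    Yt≡ = ev-load {m} {reg 15 ∔ lit 3} (add-lit {m} {reg 15} 3 ptr≡ (below (m≤m+n 3 1)) S<2^w) s₃
    Yt+1≡ : eval w m (load (reg 15 ∔ lit 3) ∔ lit 1) ≡ Y t + 1
    Yt+1≡ = ev-bin {m} {add} {load (reg 15 ∔ lit 3)} {lit 1} Yt≡ (ev-lit {m} 1) (D-fits (1+y≤D (Y<p t)))
    lhs rhs : Exp
    lhs = bin rem (reg 8 ∔ (reg 10 ∔ lit 1) · load (reg 15 ∔ lit 2)) (reg 5)
    rhs = bin rem (load (reg 15 ∔ lit 1) ∔ (load (reg 15 ∔ lit 3) ∔ lit 1) · reg 9) (reg 5)
    lhs≡ : eval w m lhs ≡ (F h + (Y h + 1) * R t) mod₀ p
    lhs≡ = ev-bin {m} {rem} {reg 8 ∔ (reg 10 ∔ lit 1) · load (reg 15 ∔ lit 2)} {reg 5}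
      (ev-bin {m} {add} {reg 8} {(reg 10 ∔ lit 1) · load (reg 15 ∔ lit 2)} (ev-reg {m} 8 r8)
        (ev-bin {m} {mul} {reg 10 ∔ lit 1} {load (reg 15 ∔ lit 2)} Y+1≡
          (ev-load {m} {reg 15 ∔ lit 2} (add-lit {m} {reg 15} 2 ptr≡ (below (m≤m+n 2 2)) S<2^w) s₂)
          (mul-fits (1+y≤D (Y<p h)) (R≤D t)))
        (add-mul-fits (F≤D h) (1+y≤D (Y<p h)) (R≤D t)))
      (ev-reg {m} 5 r5) (mod-fits _)
    rhs≡ : eval w m rhs ≡ (F t + (Y t + 1) * R h) mod₀ p
    rhs≡ = ev-bin {m} {rem} {load (reg 15 ∔ lit 1) ∔ (load (reg 15 ∔ lit 3) ∔ lit 1) · reg 9} {reg 5}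
      (ev-bin {m} {add} {load (reg 15 ∔ lit 1)} {(load (reg 15 ∔ lit 3) ∔ lit 1) · reg 9}
        (ev-load {m} {reg 15 ∔ lit 1} (add-lit {m} {reg 15} 1 ptr≡ (below (m≤m+n 1 3)) S<2^w) s₁)
        (ev-bin {m} {mul} {load (reg 15 ∔ lit 3) ∔ lit 1} {reg 9} Yt+1≡ (ev-reg {m} 9 r9)
          (mul-fits (1+y≤D (Y<p t)) (R≤D h)))
        (add-mul-fits (F≤D t) (1+y≤D (Y<p t)) (R≤D h)))
      (ev-reg {m} 5 r5) (mod-fits _)
    test≡ : eval w m testExp ≡ bit e₁ * bit e₂ * bit e₃
    test≡ = ev-bin {m} {mul} {bin equal (bin rem (bin sub (reg 7) (load (reg 15))) (lit 2)) (lit 0) · bin equal lhs rhs} {bin less (reg 1) halfExp}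
      (ev-bin {m} {mul} {bin equal (bin rem (bin sub (reg 7) (load (reg 15))) (lit 2)) (lit 0)} {bin equal lhs rhs} par≡
        (ev-bin {m} {equal} {lhs} {rhs} lhs≡ rhs≡ (bit-fits e₂)) (bits-fit e₁ e₂))
      (ev-bin {m} {less} {reg 1} {halfExp} (ev-reg {m} 1 r1) half≡ (bit-fits e₃)) (bits-fit₃ e₁ e₂ e₃)
    visit-true : (e₁ ∧ e₂) ∧ e₃ ≡ true → visit h t ℓ ≡ (h ∸ t) div₀ 2
    visit-true eq rewrite eq = refl
    visit-false : (e₁ ∧ e₂) ∧ e₃ ≡ false → visit h t ℓ ≡ ℓ
    visit-false eq rewrite eq = refl
    frame₁ : ∀ {v} i → (i ≡ᵇ 1) ≡ false → (m [ 1 ↦ v ]) i ≡ m i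
    frame₁ i eq rewrite eq = refl
    frame₂ : ∀ {m₁ v v′} → (∀ i → (i ≡ᵇ 1) ≡ false → m₁ i ≡ m i) →
             (m₁ [ 15 ↦ v ] [ 16 ↦ v′ ]) ≈[ scanned ] m
    frame₂ fr i i∉ with neither {i ≡ᵇ 1} i∉
    ... | i≢1 , i∉′ with neither {i ≡ᵇ 15} i∉′
    ... | i≢15 , i≢16 rewrite i≢15 | i≢16 = fr i i≢1

  slot-frame : ∀ {m m′ y t} → m′ ≈[ scanned ] m → SlotAt m y t → SlotAt m′ y t
  slot-frame {y = y} fr (a , b , c , d) =
    trans (fr (17 + y) refl) a , trans (fr (17 + y + 1) refl) b ,
    trans (fr (17 + y + 2) refl) c , trans (fr (17 + y + 3) refl) d

  scanned-frame : ∀ {m m′} → m′ ≈[ scanned ] m → m′ ≈[ scratch ] m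
  scanned-frame fr i i∉ = fr i (proj₂ (neither {i ≡ᵇ 11} i∉))

  scan-run : ∀ k {h m z ℓ} (val : ℕ → ℕ) → h ≤ n → Current m h → m 1 ≡ ℓ → m 15 ≡ 17 + z → m 16 ≡ k →
             (∀ s → s < k → SlotAt m (z + s * 4) (val s)) → 17 + (z + k * 4) ≤ S →
             Run scanLevel m (k * visitTime + 3) λ m′ →
               m′ 1 ≡ scan h k val ℓ × m′ 15 ≡ 17 + (z + k * 4) × m′ ≈[ scanned ] m
  scan-run zero {m = m} {z} val h≤n cur r1 r15 r16 slots fit =
    run-exit {e = reg 16} (ev-reg {m} 16 r16) (r1 , trans r15 (cong (17 +_) (sym (+-identityʳ z))) , λ _ _ → refl)
  scan-run (suc k) {h} {m} {z} {ℓ} val h≤n cur r1 r15 r16 slots fit =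
    run-weaken {scanLevel} (≤-reflexive (cong (3 +_) (sym (+-assoc (time visitSlot) (k * visitTime) 3)))) (λ _ → id)
      (run-loop {e = reg 16} (ev-reg {m} 16 r16) (λ ())
        (visit-run h≤n cur r1 r15 r16
          (subst (λ y → SlotAt m y (val 0)) (+-identityʳ z) (slots 0 (s≤s z≤n)))
          (≤-trans (+-monoʳ-≤ 17 (+-monoʳ-≤ z (m≤m+n 4 (k * 4)))) fit) k-fits)
        λ m₁ (v1 , v15 , v16 , fr) →
          run-weaken {scanLevel} ≤-refl
            (λ m₂ (p1 , p15 , fr₂) → p1 , trans p15 (cong (17 +_) (+-assoc z 4 (k * 4))) , λ i i∉ → trans (fr₂ i i∉) (fr i i∉))
            (scan-run k (val ∘ suc) h≤n (current-frame (scanned-frame fr) cur) v1 v15 v16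
              (λ s s<k → slot-frame fr (subst (λ y → SlotAt m y (val (suc s))) (sym (+-assoc z 4 (s * 4))) (slots (suc s) (s≤s s<k))))
              (subst (λ y → 17 + y ≤ S) (sym (+-assoc z 4 (k * 4))) fit)))
    where
    k-fits : k < 2 ^ w
    k-fits = ≤-<-trans (≤-trans (≤-trans (m≤m*n k 4) (m≤n+m (k * 4) (17 + (z + 4))))
               (subst (_≤ S) (cong (17 +_) (sym (+-assoc z 4 (k * 4)))) fit)) S<2^w

  write₁ write₂ write₃ write₄ : Memory → (y t : ℕ) → Memory
  write₁ m y t = m [ 17 + y ↦ t ]
  write₂ m y t = write₁ m y t [ 17 + y + 1 ↦ F t ]
  write₃ m y t = write₂ m y t [ 17 + y + 2 ↦ R t ]
  write₄ m y t = write₃ m y t [ 17 + y + 3 ↦ Y t ]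

  write₄-hit : ∀ m y t → SlotAt (write₄ m y t) y t
  write₄-hit m y t =
    trans (miss m₃ (Y t) (at-0 2)) (trans (miss m₂ (R t) (at-0 1)) (trans (miss m₁ (F t) (at-0 0)) (hit m (17 + y) t))) ,
    trans (miss m₃ (Y t) (apart 1 3 λ ())) (trans (miss m₂ (R t) (apart 1 2 λ ())) (hit m₁ (17 + y + 1) (F t))) ,
    trans (miss m₃ (Y t) (apart 2 3 λ ())) (hit m₂ (17 + y + 2) (R t)) ,
    hit m₃ (17 + y + 3) (Y t)
    where
    m₁ = write₁ m y t
    m₂ = write₂ m y t
    m₃ = write₃ m y t
    apart : ∀ j k → j ≢ k → 17 + y + j ≢ 17 + y + k
    apart j k j≢k = j≢k ∘ +-cancelˡ-≡ (17 + y) j k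
    at-0 : ∀ k → 17 + y ≢ 17 + y + suc k
    at-0 k = ≢-sym (m+1+n≢m (17 + y))

  write₄-miss : ∀ m {y t i} → i < 17 + y ⊎ 17 + y + 4 ≤ i → write₄ m y t i ≡ m i
  write₄-miss m {y} {t} {i} outside =
    trans (miss (write₃ m y t) (Y t) (i≢ 3 ≤-refl)) (trans (miss (write₂ m y t) (R t) (i≢ 2 (m≤m+n 3 1)))
      (trans (miss (write₁ m y t) (F t) (i≢ 1 (m≤m+n 2 2)))
        (miss m t (subst (i ≢_) (+-identityʳ (17 + y)) (i≢ 0 (m≤m+n 1 3))))))
    where
    outside-≢ : i < 17 + y ⊎ 17 + y + 4 ≤ i → ∀ k → k < 4 → i ≢ 17 + y + k
    outside-≢ (inj₁ i<y)   k k<4 = <⇒≢ (<-≤-trans i<y (m≤m+n (17 + y) k))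
    outside-≢ (inj₂ y+4≤i) k k<4 = ≢-sym (<⇒≢ (<-≤-trans (+-monoʳ-< (17 + y) k<4) y+4≤i))
    i≢ : ∀ k → k < 4 → i ≢ 17 + y + k
    i≢ = outside-≢ outside

  Level : Memory → (z g Q h : ℕ) → Set
  Level m z g Q h = ∀ s → s < Q → SlotAt m (z + s * 4) (latest g Q s h)

  Outside : (z Q i : ℕ) → Set
  Outside z Q i = i < 17 + z ⊎ 17 + (z + Q * 4) ≤ i

  slot-disjoint : ∀ {z s i} j → j < 4 → s ≢ i →
                  17 + (z + s * 4) + j < 17 + (z + i * 4) ⊎ 17 + (z + i * 4) + 4 ≤ 17 + (z + s * 4) + j
  slot-disjoint {z} {s} {i} j j<4 s≢i with <-cmp s i
  ... | tri< s<i _ _ = inj₁ (begin-strict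
      17 + (z + s * 4) + j  <⟨ +-monoʳ-< (17 + (z + s * 4)) j<4 ⟩
      17 + (z + s * 4) + 4  ≡⟨ eq z s ⟩
      17 + (z + suc s * 4)  ≤⟨ +-monoʳ-≤ 17 (+-monoʳ-≤ z (*-monoˡ-≤ 4 s<i)) ⟩
      17 + (z + i * 4)      ∎)
    where
    open ≤-Reasoning
    eq : ∀ z s → 17 + (z + s * 4) + 4 ≡ 17 + (z + suc s * 4)
    eq = solve-∀
  ... | tri≈ _ s≡i _ = contradiction s≡i s≢i
  ... | tri> _ _ i<s = inj₂ (begin
      17 + (z + i * 4) + 4  ≡⟨ eq z i ⟩
      17 + (z + suc i * 4)  ≤⟨ +-monoʳ-≤ 17 (+-monoʳ-≤ z (*-monoˡ-≤ 4 i<s)) ⟩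
      17 + (z + s * 4)      ≤⟨ m≤m+n _ j ⟩
      17 + (z + s * 4) + j  ∎)
    where
    open ≤-Reasoning
    eq : ∀ z s → 17 + (z + s * 4) + 4 ≡ 17 + (z + suc s * 4)
    eq = solve-∀

  slot-same : ∀ {m m′ y t} → (∀ j → j < 4 → m′ (17 + y + j) ≡ m (17 + y + j)) → SlotAt m y t → SlotAt m′ y t
  slot-same {m} {m′} {y} same (a , b , c , d) =
    trans (subst (λ i → m′ i ≡ m i) (+-identityʳ (17 + y)) (same 0 (m≤m+n 1 3))) a ,
    trans (same 1 (m≤m+n 2 2)) b , trans (same 2 (m≤m+n 3 1)) c , trans (same 3 ≤-refl) d

  -- The two branches mirror the recursion of `latest`: if g does not divide h + 1 no slot changes,
  -- and otherwise only slot ((h + 1) / g) mod Q does, taking the value h + 1.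
  write-run : ∀ {h m z g Q} → suc h ≤ n → 0 < Q → Current m (suc h) → m 11 ≡ g → m 13 ≡ Q → m 15 ≡ 17 + z →
              Level m z g Q h → 17 + (z + Q * 4) ≤ S →
              Run writeSlot m (time writeSlot) λ m′ →
                Level m′ z g Q (suc h) × (∀ i → Outside z Q i → m′ i ≡ m i)
  write-run {h} {m} {z} {g} {Q} h<n 0<Q (current r5 r7 r8 r9 r10) r11 r13 r15 level fit =
    run-cond {e = bin equal (bin rem (reg 7) (reg 11)) (lit 0)}
      (ev-bin {m} {equal} {bin rem (reg 7) (reg 11)} {lit 0}
        (ev-bin {m} {rem} {reg 7} {reg 11} (ev-reg {m} 7 r7) (ev-reg {m} 11 r11) (D-fits (≤-trans (mod₀-≤ (suc h) g) h<D)))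
        (ev-lit {m} 0) (bit-fits divides?))
      (λ V≢0 →
        run-store-seq {m} {slotExp} {reg 7} (slot≡ {m} r7 r11 r13 r15) (ev-reg {m} 7 r7) (subst (_< S) (cong (17 +_) (+-identityʳ y)) (cell<S 0 (m≤m+n 1 3)))
        (run-store-seq {m₁} {slotExp ∔ lit 1} {reg 8} (cell≡ {m₁} 1 r7 r11 r13 r15) (ev-reg {m₁} 8 r8) (cell<S 1 (m≤m+n 2 2))
        (run-store-seq {m₂} {slotExp ∔ lit 2} {reg 9} (cell≡ {m₂} 2 r7 r11 r13 r15) (ev-reg {m₂} 9 r9) (cell<S 2 (m≤m+n 3 1))
        (run-store {m₃} {slotExp ∔ lit 3} {reg 10} (cell≡ {m₃} 3 r7 r11 r13 r15) (ev-reg {m₃} 10 r10) (cell<S 3 ≤-refl)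
          (written (bit-true V≢0) , λ i out → write₄-miss m (away i out))))))
      (λ V≡0 → run-skip ((λ s s<Q → subst (SlotAt m (z + s * 4)) (sym (skipped (bit-false V≡0) s)) (level s s<Q)) , λ _ _ → refl))
    where
    divides? : Bool
    divides? = suc h mod₀ g ≡ᵇ 0
    i y : ℕ
    i = (suc h div₀ g) mod₀ Q
    y = z + i * 4
    i<Q : i < Q
    i<Q = mod₀-< (suc h div₀ g) 0<Q
    h<D : suc h ≤ D
    h<D = ≤-trans h<n n≤D
    m₁ m₂ m₃ m₄ : Memory
    m₁ = write₁ m y (suc h)
    m₂ = write₂ m y (suc h)
    m₃ = write₃ m y (suc h)
    m₄ = write₄ m y (suc h)
    y+4≤S : 17 + (y + 4) ≤ S
    y+4≤S = ≤-trans (subst (_≤ 17 + (z + Q * 4)) (eq z i) (+-monoʳ-≤ 17 (+-monoʳ-≤ z (*-monoˡ-≤ 4 i<Q)))) fit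
      where
      eq : ∀ z i → 17 + (z + suc i * 4) ≡ 17 + (z + i * 4 + 4)
      eq = solve-∀
    cell<S : ∀ k → k < 4 → 17 + (y + k) < S
    cell<S k k<4 = <-≤-trans (+-monoʳ-< 17 (+-monoʳ-< y k<4)) y+4≤S
    slot≡ : ∀ {m} → m 7 ≡ suc h → m 11 ≡ g → m 13 ≡ Q → m 15 ≡ 17 + z → eval w m slotExp ≡ 17 + y
    slot≡ {m} r7 r11 r13 r15 =
      ev-bin {m} {add} {reg 15} {bin rem (bin quo (reg 7) (reg 11)) (reg 13) · lit 4} (ev-reg {m} 15 r15)
        (ev-bin {m} {mul} {bin rem (bin quo (reg 7) (reg 11)) (reg 13)} {lit 4}
          (ev-bin {m} {rem} {bin quo (reg 7) (reg 11)} {reg 13}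
            (ev-bin {m} {quo} {reg 7} {reg 11} (ev-reg {m} 7 r7) (ev-reg {m} 11 r11) (D-fits (≤-trans (div₀-≤ (suc h) g) h<D)))
            (ev-reg {m} 13 r13) (D-fits (≤-trans (mod₀-≤ (suc h div₀ g) Q) (≤-trans (div₀-≤ (suc h) g) h<D))))
          (ev-lit {m} 4) (≤-<-trans (≤-trans (≤-trans (m≤n+m (i * 4) z) (m≤n+m y 17)) y≤S) S<2^w))
        (≤-<-trans y≤S S<2^w)
      where
      y≤S : 17 + y ≤ S
      y≤S = ≤-trans (+-monoʳ-≤ 17 (m≤m+n y 4)) y+4≤S
    cell≡ : ∀ {m} k {_ : Bool.T (k ≤ᵇ 3)} → m 7 ≡ suc h → m 11 ≡ g → m 13 ≡ Q → m 15 ≡ 17 + z →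
            eval w m (slotExp ∔ lit k) ≡ 17 + (y + k)
    cell≡ {m} k {k≤3} r7 r11 r13 r15 =
      ev-bin {m} {add} {slotExp} {lit k} (slot≡ {m} r7 r11 r13 r15)
        (ev-lit {m} k {≤⇒≤ᵇ (≤-trans (≤ᵇ⇒≤ k 3 k≤3) (m≤m+n 3 29))})
        (<-trans (cell<S k (s≤s (≤ᵇ⇒≤ k 3 k≤3))) S<2^w)
    bit-true : bit divides? ≢ 0 → divides? ≡ true
    bit-true with divides?
    ... | true  = λ _ → refl
    ... | false = λ ≢0 → contradiction refl ≢0
    bit-false : bit divides? ≡ 0 → divides? ≡ false
    bit-false with divides?
    ... | true  = λ ()
    ... | false = λ _ → refl
    skipped : divides? ≡ false → ∀ s → latest g Q s (suc h) ≡ latest g Q s h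
    skipped eq s rewrite eq = refl
    replaced : divides? ≡ true → latest g Q i (suc h) ≡ suc h
    replaced eq rewrite eq | ≡ᵇ-refl i = refl
    kept : divides? ≡ true → ∀ s → i ≢ s → latest g Q s (suc h) ≡ latest g Q s h
    kept eq s i≢s rewrite eq | ≢⇒≡ᵇ i≢s = refl
    written : divides? ≡ true → Level m₄ z g Q (suc h)
    written eq s s<Q with i ≟ s
    ... | yes refl = subst (SlotAt m₄ y) (sym (replaced eq)) (write₄-hit m y (suc h))
    ... | no i≢s   = subst (SlotAt m₄ (z + s * 4)) (sym (kept eq s i≢s))
      (slot-same {m} {m₄} (λ j j<4 → write₄-miss m (slot-disjoint {z} {s} {i} j j<4 (≢-sym i≢s))) (level s s<Q))
    away : ∀ j → Outside z Q j → j < 17 + y ⊎ 17 + y + 4 ≤ j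
    away j (inj₁ j<)  = inj₁ (<-≤-trans j< (+-monoʳ-≤ 17 (m≤m+n z (i * 4))))
    away j (inj₂ ≤j) = inj₂ (≤-trans (subst (_≤ 17 + (z + Q * 4)) (eq z i) (+-monoʳ-≤ 17 (+-monoʳ-≤ z (*-monoˡ-≤ 4 i<Q)))) ≤j)
      where
      eq : ∀ z i → 17 + (z + suc i * 4) ≡ 17 + (z + i * 4) + 4
      eq = solve-∀

  low : ∀ {z Q} i {_ : Bool.T (i <ᵇ 17)} → Outside z Q i
  low {z} i {i<17} = inj₁ (<-≤-trans (<ᵇ⇒< i 17 i<17) (m≤m+n 17 z))

  reg<S : ∀ i {_ : Bool.T (i <ᵇ 17)} → i < S
  reg<S i {i<17} = <-≤-trans (<ᵇ⇒< i 17 i<17) 17≤S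

  level-run : ∀ {h m z g Q b ℓ} → suc h ≤ n → 0 < Q → Current m (suc h) → m 1 ≡ ℓ → m 11 ≡ g → m 12 ≡ b → m 13 ≡ Q →
              m 15 ≡ 17 + z → g ≤ D → b ≤ D → Level m z g Q h → 17 + (z + Q * 4) ≤ S →
              Run levelBody m (levelTime Q) λ m′ →
                m′ 1 ≡ scan (suc h) Q (λ s → latest g Q s (suc h)) ℓ × m′ 11 ≡ g * b × m′ 15 ≡ 17 + (z + Q * 4) ×
                Level m′ z g Q (suc h) × (∀ i → scratch i ≡ false → Outside z Q i → m′ i ≡ m i)
  level-run {h} {m} {z} {g} {Q} {b} {ℓ} h<n 0<Q cur@(current r5 r7 r8 r9 r10) r1 r11 r12 r13 r15 g≤D b≤D level fit =
    run-seq (write-run h<n 0<Q cur r11 r13 r15 level fit) λ m₁ (level₁ , fr₁) →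
    run-store-seq {m₁} {lit 16} {reg 13} (ev-lit {m₁} 16) (ev-reg {m₁} 13 (trans (fr₁ 13 (low {z} {Q} 13)) r13)) (reg<S 16)
    (run-seq
      (scan-run Q (λ s → latest g Q s (suc h)) h<n
        (current (trans (fr₁ 5 (low {z} {Q} 5)) r5) (trans (fr₁ 7 (low {z} {Q} 7)) r7) (trans (fr₁ 8 (low {z} {Q} 8)) r8)
                 (trans (fr₁ 9 (low {z} {Q} 9)) r9) (trans (fr₁ 10 (low {z} {Q} 10)) r10))
        (trans (fr₁ 1 (low {z} {Q} 1)) r1) (trans (fr₁ 15 (low {z} {Q} 15)) r15) refl level₁ fit)
      λ m₃ (o , p15 , fr₃) →
        run-store {m₃} {lit 11} {reg 11 · reg 12} (ev-lit {m₃} 11)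
          (ev-bin {m₃} {mul} {reg 11} {reg 12}
            (ev-reg {m₃} 11 (trans (fr₃ 11 refl) (trans (fr₁ 11 (low {z} {Q} 11)) r11)))
            (ev-reg {m₃} 12 (trans (fr₃ 12 refl) (trans (fr₁ 12 (low {z} {Q} 12)) r12)))
            (mul-fits g≤D b≤D))
          (reg<S 11)
          (o , refl , p15 , (λ s s<Q → slot-frame {m₁ [ 16 ↦ Q ]} {m₃} fr₃ (level₁ s s<Q)) , frame fr₁ fr₃))
    where
    frame : ∀ {m₁ m₃ v} → (∀ i → Outside z Q i → m₁ i ≡ m i) → m₃ ≈[ scanned ] (m₁ [ 16 ↦ Q ]) →
            ∀ i → scratch i ≡ false → Outside z Q i → (m₃ [ 11 ↦ v ]) i ≡ m i
    frame {m₁} fr₁ fr₃ i i∉ out with neither {i ≡ᵇ 11} i∉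
    ... | i≢11 , i∉′ rewrite i≢11 = trans (fr₃ i i∉′) (trans (≢16 i (proj₂ (neither {i ≡ᵇ 15} (proj₂ (neither {i ≡ᵇ 1} i∉′))))) (fr₁ i out))
      where
      ≢16 : ∀ i → (i ≡ᵇ 16) ≡ false → (m₁ [ 16 ↦ Q ]) i ≡ m₁ i
      ≢16 i eq rewrite eq = refl

  Levels : Memory → (z Q h : ℕ) → List ℕ → Set
  Levels m z Q h []       = ⊤
  Levels m z Q h (g ∷ gs) = Level m z g Q h × Levels m (z + Q * 4) Q h gs

  levels-same : ∀ {m m′ Q h} z gs → (∀ i → scratch i ≡ false → 17 + z ≤ i → m′ i ≡ m i) →
                Levels m z Q h gs → Levels m′ z Q h gs
  levels-same z []       same tt = tt
  levels-same {m} {m′} {Q} z (g ∷ gs) same (level , rest) =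
    (λ s s<Q → slot-same {m} {m′} (λ j j<4 → same (17 + (z + s * 4) + j) refl (+-monoʳ-≤ 17 (≤-trans (m≤m+n z (s * 4)) (m≤m+n _ j)))) (level s s<Q)) ,
    levels-same (z + Q * 4) gs (λ i i∉ le → same i i∉ (≤-trans (+-monoʳ-≤ 17 (m≤m+n z (Q * 4))) le)) rest

  level-same : ∀ {m m′ z g Q h} → (∀ i → scratch i ≡ false → i < 17 + (z + Q * 4) → m′ i ≡ m i) →
               Level m z g Q h → Level m′ z g Q h
  level-same {m} {m′} {z} {g} {Q} {h} same level s s<Q =
    slot-same {m} {m′} (λ j j<4 → same (17 + (z + s * 4) + j) refl (<-≤-trans (+-monoʳ-< (17 + (z + s * 4)) j<4)
      (subst (_≤ 17 + (z + Q * 4)) (eq z s) (+-monoʳ-≤ 17 (+-monoʳ-≤ z (*-monoˡ-≤ 4 s<Q)))))) (level s s<Q)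
    where
    eq : ∀ z s → 17 + (z + suc s * 4) ≡ 17 + (z + s * 4) + 4
    eq = solve-∀

  -- L < g + f is preserved because b ≥ 2 raises g by at least 1 whenever f drops by 1. Hence the
  -- fuel of `levels` cannot run out while the guard still holds, and the loop makes exactly one
  -- iteration per element of the list.
  levels-run : ∀ f {h m z g Q b L ℓ} → suc h ≤ n → 0 < Q → 0 < g → 2 ≤ b → b ≤ D → L < D → L < g + f →
               Current m (suc h) → m 1 ≡ ℓ → m 11 ≡ g → m 12 ≡ b → m 13 ≡ Q → m 14 ≡ L →
               m 15 ≡ 17 + z → Levels m z Q h (levels b L f g) → 17 + (z + length (levels b L f g) * (Q * 4)) ≤ S →
               Run allLevels m (length (levels b L f g) * (guardTime + levelTime Q) + guardTime) λ m′ →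
                 m′ 1 ≡ scanLevels (suc h) Q (levels b L f g) ℓ × Levels m′ z Q (suc h) (levels b L f g) ×
                 (∀ i → scratch i ≡ false → i < 17 + z → m′ i ≡ m i)
  levels-run f {h} {m} {z} {g} {Q} {b} {L} {ℓ} h<n 0<Q 0<g 2≤b b≤D L<D L<g+f cur r1 r11 r12 r13 r14 r15 =
    go f L<g+f
    where
    guard≡ : eval w m (bin less (reg 11) (reg 14 ∔ lit 1)) ≡ bit (g <ᵇ L + 1)
    guard≡ = ev-bin {m} {less} {reg 11} {reg 14 ∔ lit 1} (ev-reg {m} 11 r11)
      (ev-bin {m} {add} {reg 14} {lit 1} (ev-reg {m} 14 r14) (ev-lit {m} 1) (D-fits (subst (_≤ D) (+-comm 1 L) L<D)))
      (bit-fits (g <ᵇ L + 1))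
    done : (g <ᵇ L + 1) ≡ false → Run allLevels m guardTime λ m′ →
             m′ 1 ≡ ℓ × ⊤ × (∀ i → scratch i ≡ false → i < 17 + z → m′ i ≡ m i)
    done eq = run-exit {e = bin less (reg 11) (reg 14 ∔ lit 1)} (trans guard≡ (cong bit eq)) (r1 , tt , λ _ _ _ → refl)
    go : ∀ f → L < g + f → Levels m z Q h (levels b L f g) → 17 + (z + length (levels b L f g) * (Q * 4)) ≤ S →
         Run allLevels m (length (levels b L f g) * (guardTime + levelTime Q) + guardTime) λ m′ →
                 m′ 1 ≡ scanLevels (suc h) Q (levels b L f g) ℓ × Levels m′ z Q (suc h) (levels b L f g) ×
                 (∀ i → scratch i ≡ false → i < 17 + z → m′ i ≡ m i)
    go zero L<g _ _ = done (≢-<ᵇ (≤⇒≯ (subst₂ _≤_ (+-comm 1 L) (+-identityʳ g) L<g)))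
      where
      ≢-<ᵇ : ¬ g < L + 1 → (g <ᵇ L + 1) ≡ false
      ≢-<ᵇ g≮ with g <ᵇ L + 1 in eq
      ... | false = refl
      ... | true  = contradiction (<ᵇ⇒< g (L + 1) (subst Bool.T (sym eq) tt)) g≮
    go (suc f) L<g+f lvs fit with g <ᵇ L + 1 in eq
    ... | false = done eq
    ... | true  =
      run-weaken {allLevels} (≤-reflexive (time-eq (length (levels b L f (g * b)) * (guardTime + levelTime Q)) (levelTime Q))) (λ _ → id)
      (run-loop {e = bin less (reg 11) (reg 14 ∔ lit 1)} (trans guard≡ (cong bit eq)) (λ ())
        (level-run h<n 0<Q cur r1 r11 r12 r13 r15 g≤D b≤D (proj₁ lvs)
          (≤-trans (+-monoʳ-≤ 17 (+-monoʳ-≤ z (m≤m+n (Q * 4) _))) fit))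
        λ m₁ (o , p11 , p15 , lev₁ , fr) →
          run-weaken {allLevels} ≤-refl
            (λ m₂ (o₂ , levs₂ , fr₂) → o₂ , (level-same {m₁} {m₂} {z} {g} {Q} {suc h} fr₂ lev₁ , levs₂) ,
              λ i i∉ i< → trans (fr₂ i i∉ (<-≤-trans i< (+-monoʳ-≤ 17 (m≤m+n z (Q * 4))))) (fr i i∉ (inj₁ i<)))
          (levels-run f h<n 0<Q (≤-trans 0<g g≤gb) 2≤b b≤D L<D L<gb+f
            (current (trans (fr 5 refl (low {z} {Q} 5)) r5) (trans (fr 7 refl (low {z} {Q} 7)) r7) (trans (fr 8 refl (low {z} {Q} 8)) r8)
                     (trans (fr 9 refl (low {z} {Q} 9)) r9) (trans (fr 10 refl (low {z} {Q} 10)) r10))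
            o p11 (trans (fr 12 refl (low {z} {Q} 12)) r12) (trans (fr 13 refl (low {z} {Q} 13)) r13) (trans (fr 14 refl (low {z} {Q} 14)) r14)
            p15
            (levels-same {m} {m₁} (z + Q * 4) (levels b L f (g * b)) (λ i i∉ le → fr i i∉ (inj₂ le)) (proj₂ lvs))
            (subst (_≤ S) (cong (17 +_) (sym (+-assoc z (Q * 4) _))) fit)))
      where
      open Current cur
      g≤D : g ≤ D
      g≤D = ≤-trans (≤-pred (subst (g <_) (+-comm L 1) (<ᵇ⇒< g (L + 1) (subst Bool.T (sym eq) tt)))) (<⇒≤ L<D)
      g<gb : g < g * b
      g<gb = m<m*n g b {{>-nonZero 0<g}} 2≤b
      g≤gb : g ≤ g * b
      g≤gb = <⇒≤ g<gb
      L<gb+f : L < g * b + f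
      L<gb+f = <-≤-trans (subst (L <_) (+-suc g f) L<g+f) (+-monoˡ-≤ f g<gb)
      time-eq : ∀ c d → suc (evalTime (bin less (reg 11) (reg 14 ∔ lit 1)) + (d + (c + guardTime))) ≡ guardTime + d + c + guardTime
      time-eq c d = trans (sym (+-assoc guardTime d (c + guardTime))) (sym (+-assoc (guardTime + d) c guardTime))

  mul-add-fits : ∀ {s u v} → s ≤ D → u ≤ D → v ≤ D → u * v + s < 2 ^ w
  mul-add-fits {s} {u} {v} s≤ u≤ v≤ = subst (_< 2 ^ w) (+-comm s (u * v)) (add-mul-fits s≤ u≤ v≤)

  advance-run : ∀ {h m a} → suc h ≤ n → m 0 ≡ a → a ≤ D → m 6 ≡ x → Current m h →
                Y (suc h) ≡ ((Y h + 1) * x + (p ∸ 1)) mod₀ p →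
                F (suc h) ≡ (F h + (Y (suc h) + 1) * a) mod₀ p →
                R (suc h) ≡ ((R h + a) * x) mod₀ p →
                Run advance m (time advance) λ m′ →
                  Current m′ (suc h) × m′ 15 ≡ 17 × (∀ i → i ≤ 6 → m′ i ≡ m i) × (∀ i → 11 ≤ i → i ≢ 15 → m′ i ≡ m i)
  advance-run {h} {m} {a} h<n r0 a≤D r6 (current r5 r7 r8 r9 r10) Y≡ F≡ R≡ =
    run-store-seq {m} {lit 7} {reg 7 ∔ lit 1} (ev-lit {m} 7)
      (trans (ev-bin {m} {add} {reg 7} {lit 1} (ev-reg {m} 7 r7) (ev-lit {m} 1) (D-fits (subst (_≤ D) (+-comm 1 h) (≤-trans h<n n≤D)))) (+-comm h 1)) (reg<S 7)
    (run-store-seq {m₁} {lit 10} {newY} (ev-lit {m₁} 10)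
      (trans (ev-bin {m₁} {rem} {(reg 10 ∔ lit 1) · reg 6 ∔ bin sub (reg 5) (lit 1)} {reg 5}
        (ev-bin {m₁} {add} {(reg 10 ∔ lit 1) · reg 6} {bin sub (reg 5) (lit 1)}
          (ev-bin {m₁} {mul} {reg 10 ∔ lit 1} {reg 6} (ev-bin {m₁} {add} {reg 10} {lit 1} (ev-reg {m₁} 10 r10) (ev-lit {m₁} 1) (D-fits (1+y≤D (Y<p h))))
            (ev-reg {m₁} 6 r6) (mul-fits (1+y≤D (Y<p h)) x≤D))
          (ev-bin {m₁} {sub} {reg 5} {lit 1} (ev-reg {m₁} 5 r5) (ev-lit {m₁} 1) (D-fits (≤-trans (m∸n≤m p 1) p≤D)))
          (mul-add-fits (≤-trans (m∸n≤m p 1) p≤D) (1+y≤D (Y<p h)) x≤D))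
        (ev-reg {m₁} 5 r5) (mod-fits _)) (sym Y≡)) (reg<S 10)
    (run-store-seq {m₂} {lit 8} {newF} (ev-lit {m₂} 8)
      (trans (ev-bin {m₂} {rem} {reg 8 ∔ (reg 10 ∔ lit 1) · reg 0} {reg 5}
        (ev-bin {m₂} {add} {reg 8} {(reg 10 ∔ lit 1) · reg 0} (ev-reg {m₂} 8 r8)
          (ev-bin {m₂} {mul} {reg 10 ∔ lit 1} {reg 0} (ev-bin {m₂} {add} {reg 10} {lit 1} (ev-reg {m₂} 10 refl) (ev-lit {m₂} 1) (D-fits (1+y≤D (Y<p (suc h)))))
            (ev-reg {m₂} 0 r0) (mul-fits (1+y≤D (Y<p (suc h))) a≤D))
          (add-mul-fits (≤-trans (<⇒≤ (F<p h)) p≤D) (1+y≤D (Y<p (suc h))) a≤D))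
        (ev-reg {m₂} 5 r5) (mod-fits _)) (sym F≡)) (reg<S 8)
    (run-store-seq {m₃} {lit 9} {newR} (ev-lit {m₃} 9)
      (trans (ev-bin {m₃} {rem} {(reg 9 ∔ reg 0) · reg 6} {reg 5}
        (ev-bin {m₃} {mul} {reg 9 ∔ reg 0} {reg 6}
          (ev-bin {m₃} {add} {reg 9} {reg 0} (ev-reg {m₃} 9 r9) (ev-reg {m₃} 0 r0) sum-fits)
          (ev-reg {m₃} 6 r6) prod-fits)
        (ev-reg {m₃} 5 r5) (mod-fits _)) (sym R≡)) (reg<S 9)
    (run-store {m₄} {lit 15} {lit 17} (ev-lit {m₄} 15) (ev-lit {m₄} 17) (reg<S 15)
      (current r5 refl refl refl refl , refl , low-frame , high-frame)))))
    where
    newY newF newR : Exp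
    newY = bin rem ((reg 10 ∔ lit 1) · reg 6 ∔ bin sub (reg 5) (lit 1)) (reg 5)
    newF = bin rem (reg 8 ∔ (reg 10 ∔ lit 1) · reg 0) (reg 5)
    newR = bin rem ((reg 9 ∔ reg 0) · reg 6) (reg 5)
    m₁ m₂ m₃ m₄ m₅ : Memory
    m₁ = m [ 7 ↦ suc h ]
    m₂ = m₁ [ 10 ↦ Y (suc h) ]
    m₃ = m₂ [ 8 ↦ F (suc h) ]
    m₄ = m₃ [ 9 ↦ R (suc h) ]
    m₅ = m₄ [ 15 ↦ 17 ]
    mod-fits : ∀ u → u mod₀ p < 2 ^ w
    mod-fits u = D-fits (≤-trans (<⇒≤ (mod₀-< u 0<p)) p≤D)
    sum≤ : R h + a ≤ D + D
    sum≤ = +-mono-≤ (≤-trans (<⇒≤ (R<p h)) p≤D) a≤D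
    2D² : (D + D) * D ≤ 3 * (D * D)
    2D² = subst (_≤ 3 * (D * D)) (eq D) (m≤n+m (2 * (D * D)) (D * D))
      where
      eq : ∀ D → 2 * (D * D) ≡ (D + D) * D
      eq = solve-∀
    sum-fits : R h + a < 2 ^ w
    sum-fits = fits (≤-trans sum≤ (≤-trans (m≤m*n (D + D) D {{>-nonZero (≤-trans (s≤s z≤n) 32≤D)}}) 2D²))
    prod-fits : (R h + a) * x < 2 ^ w
    prod-fits = fits (≤-trans (*-mono-≤ sum≤ x≤D) 2D²)
    low-frame : ∀ i → i ≤ 6 → m₅ i ≡ m i
    low-frame i i≤6
      rewrite ≢⇒≡ᵇ (<⇒≢ (≤-<-trans i≤6 (m≤m+n 7 8))) | ≢⇒≡ᵇ (<⇒≢ (≤-<-trans i≤6 (m≤m+n 7 2)))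
            | ≢⇒≡ᵇ (<⇒≢ (≤-<-trans i≤6 (m≤m+n 7 1))) | ≢⇒≡ᵇ (<⇒≢ (≤-<-trans i≤6 (m≤m+n 7 3)))
            | ≢⇒≡ᵇ (<⇒≢ (≤-<-trans i≤6 (m≤m+n 7 0))) = refl
    high-frame : ∀ i → 11 ≤ i → i ≢ 15 → m₅ i ≡ m i
    high-frame i 11≤i i≢15
      rewrite ≢⇒≡ᵇ i≢15 | ≢⇒≡ᵇ (≢-sym (<⇒≢ (<-≤-trans (m≤m+n 10 1) 11≤i))) | ≢⇒≡ᵇ (≢-sym (<⇒≢ (<-≤-trans (m≤m+n 9 2) 11≤i)))
            | ≢⇒≡ᵇ (≢-sym (<⇒≢ 11≤i)) | ≢⇒≡ᵇ (≢-sym (<⇒≢ (<-≤-trans (m≤m+n 8 3) 11≤i))) = refl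

  -- Memory that was never written is a valid slot, since it describes the landmark 0.
  fresh-slots : ∀ {m h} z Q gs → h ≡ 0 → F 0 ≡ 0 → R 0 ≡ 0 → Y 0 ≡ 0 → (∀ y → m (17 + y) ≡ 0) → Levels m z Q h gs
  fresh-slots z Q []       h≡0 F0 R0 Y0 zero-cells = tt
  fresh-slots {m} z Q (g ∷ gs) refl F0 R0 Y0 zero-cells =
    (λ s _ → zero-cells (z + s * 4) , trans (zero-cells (z + s * 4 + 1)) (sym F0) ,
             trans (zero-cells (z + s * 4 + 2)) (sym R0) , trans (zero-cells (z + s * 4 + 3)) (sym Y0)) ,
    fresh-slots {m} (z + Q * 4) Q gs refl F0 R0 Y0 zero-cells

-- Landmark sets read off the slots

isSetup : ℕ → Bool
isSetup i = (11 ≤ᵇ i) ∧ (i ≤ᵇ 14)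

anyBelow : ℕ → (ℕ → Bool) → Bool
anyBelow zero    f = false
anyBelow (suc k) f = f k ∨ anyBelow k f

-- Landmarks are by definition whatever the slots contain, so they need no separate bookkeeping. A
-- slot that has not been filled yet contributes position 0.
onLevel : (g Q h t : ℕ) → Bool
onLevel g Q h t = anyBelow Q (λ s → latest g Q s h ≡ᵇ t)

isLandmark : (Q : ℕ) → List ℕ → Landmarks
isLandmark Q []       h t = false
isLandmark Q (g ∷ gs) h t = onLevel g Q h t ∨ isLandmark Q gs h t

anyBelow-sound : ∀ k f → anyBelow k f ≡ true → ∃[ s ] s < k × f s ≡ true
anyBelow-sound (suc k) f eq with f k in fk
... | true  = k , ≤-refl , fk
... | false with anyBelow-sound k f eq
...   | s , s<k , fs = s , m≤n⇒m≤1+n s<k , fs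

anyBelow-complete : ∀ k f {s} → s < k → f s ≡ true → anyBelow k f ≡ true
anyBelow-complete (suc k) f {s} s<1+k fs with s ≟ k
... | yes refl rewrite fs = refl
... | no s≢k rewrite anyBelow-complete k f (≤∧≢⇒< (≤-pred s<1+k) s≢k) fs = Bool.∨-zeroʳ (f k)

∨-true : ∀ {a b} → a ∨ b ≡ true → a ≡ true ⊎ b ≡ true
∨-true {true}  _  = inj₁ refl
∨-true {false} eq = inj₂ eq

onLevel-sound : ∀ {g Q h t} → onLevel g Q h t ≡ true → ∃[ s ] s < Q × latest g Q s h ≡ t
onLevel-sound {g} {Q} {h} {t} eq with anyBelow-sound Q _ eq
... | s , s<Q , eq′ = s , s<Q , ≡ᵇ-sound _ t eq′

latest≤ : ∀ g Q s h → latest g Q s h ≤ h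
latest≤ g Q s zero = z≤n
latest≤ g Q s (suc h) with (suc h mod₀ g ≡ᵇ 0) ∧ ((suc h div₀ g) mod₀ Q ≡ᵇ s)
... | true  = ≤-refl
... | false = m≤n⇒m≤1+n (latest≤ g Q s h)

latest-step : ∀ g Q s h → latest g Q s (suc h) ≡ suc h ⊎ latest g Q s (suc h) ≡ latest g Q s h
latest-step g Q s h with (suc h mod₀ g ≡ᵇ 0) ∧ ((suc h div₀ g) mod₀ Q ≡ᵇ s)
... | true  = inj₁ refl
... | false = inj₂ refl

-- A slot changes only by receiving the current position, so its content is either new or was a
-- landmark one step earlier.
isLandmark-admissible : ∀ Q gs → Admissible (isLandmark Q gs)
isLandmark-admissible Q gs = record { inPast = inPast gs ; created = created gs }
  where
  inPast : ∀ gs h t → isLandmark Q gs h t ≡ true → t ≤ h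
  inPast (g ∷ gs) h t eq with ∨-true {onLevel g Q h t} eq
  ... | inj₂ eq′ = inPast gs h t eq′
  ... | inj₁ eq′ with onLevel-sound {g} {Q} {h} {t} eq′
  ...   | s , _ , refl = latest≤ g Q s h
  created : ∀ gs h t → isLandmark Q gs (suc h) t ≡ true → t ≡ suc h ⊎ isLandmark Q gs h t ≡ true
  created (g ∷ gs) h t eq with ∨-true {onLevel g Q (suc h) t} eq
  ... | inj₂ eq′ with created gs h t eq′
  ...   | inj₁ t≡ = inj₁ t≡
  ...   | inj₂ eq″ rewrite eq″ = inj₂ (Bool.∨-zeroʳ (onLevel g Q h t))
  created (g ∷ gs) h t eq | inj₁ eq′ with onLevel-sound {g} {Q} {suc h} {t} eq′
  ... | s , s<Q , refl with latest-step g Q s h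
  ...   | inj₁ new = inj₁ new
  ...   | inj₂ old rewrite old
        | anyBelow-complete Q (λ s′ → latest g Q s′ h ≡ᵇ latest g Q s h) s<Q (≡ᵇ-refl (latest g Q s h)) = inj₂ refl

-- Running the program over a whole stream

module Stream {σ : ℕ} (T : Text σ)
  (w S p x n D : ℕ) (F R Y : ℕ → ℕ)
  (0<p : 0 < p) (p≤D : p ≤ D) (x≤D : x ≤ D) (n≤D : n ≤ D) (32≤D : 32 ≤ D)
  (4D²≤2^w : 4 * (D * D) ≤ 2 ^ w) (S<2^w : S < 2 ^ w) (17≤S : 17 ≤ S)
  (F<p : ∀ t → F t < p) (R<p : ∀ t → R t < p) (Y<p : ∀ t → Y t < p)
  (F₀ : F 0 ≡ 0) (R₀ : R 0 ≡ 0) (Y₀ : Y 0 ≡ 0) (T≤D : ∀ t → toℕ (T t) ≤ D)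
  (Y-suc : ∀ h → Y (suc h) ≡ ((Y h + 1) * x + (p ∸ 1)) mod₀ p)
  (F-suc : ∀ h → F (suc h) ≡ (F h + (Y (suc h) + 1) * toℕ (T (suc h))) mod₀ p)
  (R-suc : ∀ h → R (suc h) ≡ ((R h + toℕ (T (suc h))) * x) mod₀ p)
  (e : ℚᵘ) (g b Q L : ℕ) (0<Q : 0 < Q) (0<g : 0 < g) (2≤b : 2 ≤ b) (b≤D : b ≤ D) (L<D : L < D)
  (fit : 17 + length (levels b L (suc L) g) * (Q * 4) ≤ S)
  where

  open Machine w S p x n D F R Y 0<p p≤D x≤D n≤D 32≤D 4D²≤2^w S<2^w 17≤S F<p R<p Y<p
  open RAM w S 32<2^w
  open Scan p F R Y

  gs : List ℕ
  gs = levels b L (suc L) g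

  SetupCorrect : Cmd → Set
  SetupCorrect setup = ∀ m → m 2 ≡ n → m 3 ≡ ℤ.∣ ↥ e ∣ → m 4 ≡ ↧ₙ e →
    Run setup m (time setup) λ m′ →
      m′ 11 ≡ g × m′ 12 ≡ b × m′ 13 ≡ Q × m′ 14 ≡ L × (∀ i → isSetup i ≡ false → m′ i ≡ m i)

  record Invariant (h : ℕ) (m : Memory) : Set where
    constructor invariant
    field
      r2  : m 2 ≡ n
      r3  : m 3 ≡ ℤ.∣ ↥ e ∣
      r4  : m 4 ≡ ↧ₙ e
      r6  : m 6 ≡ x
      r1  : m 1 ≡ reported Q gs h
      cur : Current m h
      lvs : Levels m 0 Q h gs

  stepTime : Cmd → ℕ
  stepTime setup = time setup + (time advance + (length gs * (guardTime + levelTime Q) + guardTime))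

  from-17 : ∀ {m m′ : Memory} → (∀ y → m′ (17 + y) ≡ m (17 + y)) → ∀ {i} → 17 ≤ i → m′ i ≡ m i
  from-17 {m} {m′} same {i} 17≤i = subst (λ i → m′ i ≡ m i) (m+[n∸m]≡n 17≤i) (same (i ∸ 17))

  step-run : ∀ {setup h m} → SetupCorrect setup → suc h ≤ n → Invariant h m →
             Run (streamProgram setup) (m [ inputCell ↦ toℕ (T (suc h)) ]) (stepTime setup) (Invariant (suc h))
  step-run {setup} {h} {m} setup-run h<n (invariant r2 r3 r4 r6 r1 (current r5 r7 r8 r9 r10) lvs) =
    run-seq (setup-run m₀ r2 r3 r4) λ m₁ (p11 , p12 , p13 , p14 , fr₁) →
    run-seq
      (advance-run {m = m₁} h<n (fr₁ 0 refl) (T≤D (suc h)) (trans (fr₁ 6 refl) r6)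
        (current (trans (fr₁ 5 refl) r5) (trans (fr₁ 7 refl) r7) (trans (fr₁ 8 refl) r8) (trans (fr₁ 9 refl) r9) (trans (fr₁ 10 refl) r10))
        (Y-suc h) (F-suc h) (R-suc h))
      λ m₂ (cur₂ , p15 , lo , hi) →
        run-weaken {allLevels} ≤-refl
          (λ m₃ (o , lvs₃ , fr₃) →
            invariant (trans (fr₃ 2 refl (below 2)) (trans (lo 2 (m≤m+n 2 4)) (trans (fr₁ 2 refl) r2)))
              (trans (fr₃ 3 refl (below 3)) (trans (lo 3 (m≤m+n 3 3)) (trans (fr₁ 3 refl) r3)))
              (trans (fr₃ 4 refl (below 4)) (trans (lo 4 (m≤m+n 4 2)) (trans (fr₁ 4 refl) r4)))
              (trans (fr₃ 6 refl (below 6)) (trans (lo 6 ≤-refl) (trans (fr₁ 6 refl) r6)))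
              o
              (current (trans (fr₃ 5 refl (below 5)) (Current.r5 cur₂)) (trans (fr₃ 7 refl (below 7)) (Current.r7 cur₂))
                       (trans (fr₃ 8 refl (below 8)) (Current.r8 cur₂)) (trans (fr₃ 9 refl (below 9)) (Current.r9 cur₂))
                       (trans (fr₃ 10 refl (below 10)) (Current.r10 cur₂)))
              lvs₃)
          (levels-run (suc L) {m = m₂} h<n 0<Q 0<g 2≤b b≤D L<D (m≤n+m (suc L) g) cur₂
            (trans (lo 1 (m≤m+n 1 5)) (trans (fr₁ 1 refl) r1))
            (trans (hi 11 ≤-refl (λ ())) p11) (trans (hi 12 (m≤m+n 11 1) (λ ())) p12)
            (trans (hi 13 (m≤m+n 11 2) (λ ())) p13) (trans (hi 14 (m≤m+n 11 3) (λ ())) p14)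
            p15
            (levels-same {m} {m₂} 0 gs
              (λ i _ 17≤i → from-17 {m} {m₂} (λ y → trans (hi (17 + y) (m≤m+n 11 (6 + y)) (λ ())) (fr₁ (17 + y) refl)) 17≤i) lvs)
            fit)
    where
    m₀ : Memory
    m₀ = m [ inputCell ↦ toℕ (T (suc h)) ]
    below : ∀ i {_ : Bool.T (i <ᵇ 17)} → i < 17
    below i {i<17} = <ᵇ⇒< i 17 i<17

  Reached : Cmd → (ℕ → Set) → ℕ → Set
  Reached setup InTime h = Σ[ m ∈ Memory ]
    Reaches w S (streamProgram setup) InTime (initialMemory n e p x) T h m × Invariant h m

  initial-invariant : Invariant 0 (initialMemory n e p x)
  initial-invariant = invariant refl refl refl refl refl (current refl refl (sym F₀) (sym R₀) (sym Y₀))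
    (fresh-slots {initialMemory n e p x} 0 Q gs refl F₀ R₀ Y₀ (λ _ → refl))

  reached-next : ∀ {setup InTime h m} → (∀ τ → τ ≤ stepTime setup → InTime τ) →
                 Reaches w S (streamProgram setup) InTime (initialMemory n e p x) T h m →
                 Run (streamProgram setup) (m [ inputCell ↦ toℕ (T (suc h)) ]) (stepTime setup) (Invariant (suc h)) →
                 Reached setup InTime (suc h)
  reached-next inTime reach (m′ , τ , exec , τ≤ , inv′) = m′ , next reach exec (inTime τ τ≤) , inv′

  stream-run : ∀ {setup} {InTime : ℕ → Set} → SetupCorrect setup → (∀ τ → τ ≤ stepTime setup → InTime τ) →
               ∀ h → h ≤ n → Reached setup InTime h
  stream-run setup-run inTime zero _ = initialMemory n e p x , before-stream , initial-invariant
  stream-run {setup} {InTime} setup-run inTime (suc h) h<n = continue (stream-run setup-run inTime h (<⇒≤ h<n))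
    where
    continue : Reached setup InTime h → Reached setup InTime (suc h)
    continue (m , reach , inv) = reached-next {setup} {InTime} {h} {m} inTime reach (step-run {setup} {h} {m} setup-run h<n inv)

  -- The disjunction makes the cell determine t, which gives injectivity: cell 8 serves h only, and
  -- a fingerprint cell inside a slot is preceded by the cell that holds t. Levels may share a
  -- position, so a landmark can have several candidate cells, of which one is picked.
  FingerprintCell : (h t : ℕ) → Memory → ℕ → Set
  FingerprintCell h t m c =
    c < S × m c ≡ F t × ((c ≡ 8 × t ≡ h) ⊎ (∃[ y ] c ≡ 17 + y + 1 × m (17 + y) ≡ t))

  landmark-cell : ∀ {h t m} z gs → Levels m z Q h gs → 17 + (z + length gs * (Q * 4)) ≤ S →
                  isLandmark Q gs h t ≡ true → ∃[ c ] FingerprintCell h t m c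
  landmark-cell {h} {t} {m} z (g ∷ gs) (level , rest) fit eq with ∨-true {onLevel g Q h t} eq
  ... | inj₂ eq′ = landmark-cell {h} {t} {m} (z + Q * 4) gs rest (subst (_≤ S) (cong (17 +_) (sym (+-assoc z (Q * 4) _))) fit) eq′
  ... | inj₁ eq′ with onLevel-sound {g} {Q} {h} {t} eq′
  ...   | s , s<Q , refl with level s s<Q
  ...     | s₀ , s₁ , _ = 17 + (z + s * 4) + 1 , cell<S , s₁ , inj₂ (z + s * 4 , refl , s₀)
    where
    cell<S : 17 + (z + s * 4) + 1 < S
    cell<S = begin-strict
      17 + (z + s * 4) + 1   <⟨ +-monoʳ-< (17 + (z + s * 4)) {1} {4} (m≤m+n 2 2) ⟩
      17 + (z + s * 4) + 4   ≡⟨ eq-slot z s ⟩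
      17 + (z + suc s * 4)   ≤⟨ +-monoʳ-≤ 17 (+-monoʳ-≤ z (*-monoˡ-≤ 4 s<Q)) ⟩
      17 + (z + Q * 4)       ≤⟨ +-monoʳ-≤ 17 (+-monoʳ-≤ z (m≤m+n (Q * 4) _)) ⟩
      17 + (z + (Q * 4 + length gs * (Q * 4)))  ≤⟨ fit ⟩
      S                      ∎
      where
      open ≤-Reasoning
      eq-slot : ∀ z s → 17 + (z + s * 4) + 4 ≡ 17 + (z + suc s * 4)
      eq-slot = solve-∀

  fingerprints-stored : ∀ {h m} → (∀ t → F t ≡ fingerprint p x (segment T 0 t)) → Invariant h m →
                        FingerprintsStored S p x (isLandmark Q gs) T h m
  fingerprints-stored {h} {m} F≡ (invariant _ _ _ _ _ cur lvs) = proj₁ ∘ pick , correct , injective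
    where
    Stored : ℕ → Set
    Stored t = isLandmark Q gs h t ≡ true ⊎ t ≡ h
    pick : ∀ t → Σ[ c ∈ ℕ ] (Stored t → FingerprintCell h t m c)
    pick t with t ≟ h
    -- The current position gets cell 8 even when it is a landmark as well.
    ... | yes refl = 8 , λ _ → reg<S 8 , Current.r8 cur , inj₁ (refl , refl)
    ... | no t≢h with isLandmark Q gs h t in eq
    ...   | true with landmark-cell {h} {t} {m} 0 gs lvs fit eq
    ...     | c , found = c , λ _ → found
    pick t | no t≢h | false = 0 , [ (λ ()) , (λ t≡h → contradiction t≡h t≢h) ]′
    correct : ∀ t → Stored t → proj₁ (pick t) < S × m (proj₁ (pick t)) ≡ fingerprint p x (segment T 0 t)
    correct t st with proj₂ (pick t) st
    ... | c<S , m≡ , _ = c<S , trans m≡ (F≡ t)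
    injective : ∀ t u → Stored t → Stored u → proj₁ (pick t) ≡ proj₁ (pick u) → t ≡ u
    injective t u st su same with proj₂ (pick t) st | proj₂ (pick u) su
    ... | _ , _ , inj₁ (_ , t≡h) | _ , _ , inj₁ (_ , u≡h) = trans t≡h (sym u≡h)
    ... | _ , _ , inj₁ (c≡8 , _) | _ , _ , inj₂ (_ , d≡ , _) = contradiction (trans (sym c≡8) (trans same d≡)) λ ()
    ... | _ , _ , inj₂ (_ , c≡ , _) | _ , _ , inj₁ (d≡8 , _) = contradiction (trans (sym d≡8) (trans (sym same) c≡)) λ ()
    ... | _ , _ , inj₂ (y , c≡ , y≡t) | _ , _ , inj₂ (z , d≡ , z≡u) =
      trans (sym y≡t) (trans (cong (λ i → m (17 + i)) (+-cancelʳ-≡ 1 y z (+-cancelˡ-≡ 17 _ _ (trans (sym c≡) (trans same d≡))))) z≡u)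

-- Fingerprints

module _ {p : ℕ} .{{_ : NonZero p}} where

  %≡⇒∣ : ∀ {a b} → a % p ≡ b % p → p ∣ ∣ a - b ∣
  %≡⇒∣ {a} {b} eq = divides ∣ a / p - b / p ∣ (begin
    ∣ a - b ∣                                     ≡⟨ cong₂ ∣_-_∣ (m≡m%n+[m/n]*n a p) (m≡m%n+[m/n]*n b p) ⟩
    ∣ a % p + a / p * p - b % p + b / p * p ∣     ≡⟨ cong (λ r → ∣ r + a / p * p - b % p + b / p * p ∣) eq ⟩
    ∣ b % p + a / p * p - b % p + b / p * p ∣     ≡⟨ ∣m+n-m+o∣≡∣n-o∣ (b % p) _ _ ⟩
    ∣ a / p * p - b / p * p ∣                     ≡⟨ *-distribʳ-∣-∣ p (a / p) (b / p) ⟨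
    ∣ a / p - b / p ∣ * p                         ∎)
    where open ≡-Reasoning

  ∣⇒%≡ : ∀ {a b} → p ∣ ∣ a - b ∣ → a % p ≡ b % p
  ∣⇒%≡ {a} {b} p∣ with ≤-total a b
  ... | inj₁ a≤b = sym (trans (%-congˡ {o = p} (sym (m+[n∸m]≡n a≤b))) (%-remove-+ʳ a (subst (p ∣_) (m≤n⇒∣m-n∣≡n∸m a≤b) p∣)))
  ... | inj₂ b≤a = trans (%-congˡ {o = p} (sym (m+[n∸m]≡n b≤a))) (%-remove-+ʳ b (subst (p ∣_) (m≤n⇒∣n-m∣≡n∸m b≤a) p∣))

  %-cong-+ : ∀ a a′ b b′ → a % p ≡ a′ % p → b % p ≡ b′ % p → (a + b) % p ≡ (a′ + b′) % p
  %-cong-+ a a′ b b′ a≡ b≡ = begin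
    (a + b) % p              ≡⟨ %-distribˡ-+ a b p ⟩
    (a % p + b % p) % p      ≡⟨ cong₂ (λ u v → (u + v) % p) a≡ b≡ ⟩
    (a′ % p + b′ % p) % p    ≡⟨ %-distribˡ-+ a′ b′ p ⟨
    (a′ + b′) % p            ∎
    where open ≡-Reasoning

  %-cong-* : ∀ a a′ b b′ → a % p ≡ a′ % p → b % p ≡ b′ % p → (a * b) % p ≡ (a′ * b′) % p
  %-cong-* a a′ b b′ a≡ b≡ = begin
    (a * b) % p              ≡⟨ %-distribˡ-* a b p ⟩
    (a % p * (b % p)) % p    ≡⟨ cong₂ (λ u v → (u * v) % p) a≡ b≡ ⟩
    (a′ % p * (b′ % p)) % p  ≡⟨ %-distribˡ-* a′ b′ p ⟨
    (a′ * b′) % p            ∎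
    where open ≡-Reasoning

  %-cancelˡ-+ : ∀ c {a b} → (c + a) % p ≡ (c + b) % p → a % p ≡ b % p
  %-cancelˡ-+ c {a} {b} eq = ∣⇒%≡ (subst (p ∣_) (∣m+n-m+o∣≡∣n-o∣ c a b) (%≡⇒∣ {c + a} {c + b} eq))

  %-cancelˡ-* : ∀ c {a b} → Prime p → ¬ p ∣ c → (c * a) % p ≡ (c * b) % p → a % p ≡ b % p
  %-cancelˡ-* c {a} {b} p-prime p∤c eq
    with euclidsLemma c ∣ a - b ∣ p-prime (subst (p ∣_) (sym (*-distribˡ-∣-∣ c a b)) (%≡⇒∣ {c * a} {c * b} eq))
  ... | inj₁ p∣c = contradiction p∣c p∤c
  ... | inj₂ p∣d = ∣⇒%≡ p∣d

mod₀≡% : ∀ {p} .{{_ : NonZero p}} a → a mod₀ p ≡ a % p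
mod₀≡% {suc p} a = refl

prime∤power : ∀ {p x} t → Prime p → ¬ p ∣ x → ¬ p ∣ x ^ t
prime∤power {p} zero p-prime p∤x p∣1 = p∤x (subst (_∣ _) (sym (∣1⇒≡1 p∣1)) (1∣ _))
prime∤power {p} {x} (suc t) p-prime p∤x p∣xᵗ⁺¹ with euclidsLemma x (x ^ t) p-prime p∣xᵗ⁺¹
... | inj₁ p∣x  = p∤x p∣x
... | inj₂ p∣xᵗ = prime∤power t p-prime p∤x p∣xᵗ

polynomial : ∀ {σ} → ℕ → List (Fin σ) → ℕ
polynomial x = foldr (λ a s → x * (toℕ a + s)) 0

polynomial-++ : ∀ {σ} x (u v : List (Fin σ)) →
                polynomial x (u ++ v) ≡ polynomial x u + x ^ length u * polynomial x v
polynomial-++ x []      v = sym (+-identityʳ (polynomial x v))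
polynomial-++ x (a ∷ u) v = begin
  x * (toℕ a + polynomial x (u ++ v))
    ≡⟨ cong (λ s → x * (toℕ a + s)) (polynomial-++ x u v) ⟩
  x * (toℕ a + (polynomial x u + x ^ length u * polynomial x v))
    ≡⟨ eq x (toℕ a) (polynomial x u) (x ^ length u) (polynomial x v) ⟩
  x * (toℕ a + polynomial x u) + x * x ^ length u * polynomial x v ∎
  where
  open ≡-Reasoning
  eq : ∀ x a s y z → x * (a + (s + y * z)) ≡ x * (a + s) + x * y * z
  eq = solve-∀

module _ {σ : ℕ} (T : Text σ) where

  segment-applyUpTo : ∀ t h → segment T t h ≡ applyUpTo (λ i → T (suc t + i)) (h ∸ t)
  segment-applyUpTo t h = List.map-upTo (λ i → T (suc t + i)) (h ∸ t)

  length-segment : ∀ t h → length (segment T t h) ≡ h ∸ t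
  length-segment t h = trans (cong length (segment-applyUpTo t h)) (List.length-applyUpTo _ (h ∸ t))

  applyUpTo-+ : ∀ {A : Set} (f : ℕ → A) t k → applyUpTo f (t + k) ≡ applyUpTo f t ++ applyUpTo (λ i → f (t + i)) k
  applyUpTo-+ f zero    k = refl
  applyUpTo-+ f (suc t) k = cong (f 0 ∷_) (applyUpTo-+ (f ∘ suc) t k)

  segment-split : ∀ {t h} → t ≤ h → segment T 0 h ≡ segment T 0 t ++ segment T t h
  segment-split {t} {h} t≤h = begin
    segment T 0 h                                     ≡⟨ segment-applyUpTo 0 h ⟩
    applyUpTo (T ∘ suc) h                             ≡⟨ cong (applyUpTo (T ∘ suc)) (m+[n∸m]≡n t≤h) ⟨
    applyUpTo (T ∘ suc) (t + (h ∸ t))                 ≡⟨ applyUpTo-+ (T ∘ suc) t (h ∸ t) ⟩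
    applyUpTo (T ∘ suc) t ++ applyUpTo (λ i → T (suc t + i)) (h ∸ t)
      ≡⟨ cong₂ _++_ (segment-applyUpTo 0 t) (segment-applyUpTo t h) ⟨
    segment T 0 t ++ segment T t h                    ∎
    where open ≡-Reasoning

  segment-suc : ∀ h → segment T 0 (suc h) ≡ segment T 0 h ++ [ T (suc h) ]
  segment-suc h = trans (cong (map (T ∘ suc)) (sym (List.upTo-∷ʳ h))) (List.map-++ (T ∘ suc) (upTo h) [ h ])

  module Fingerprints (p x : ℕ) (p-prime : Prime p) where

    instance
      p≢0 : NonZero p
      p≢0 = prime⇒nonZero p-prime

    -- Y t + 1 ≡ xᵗ (mod p).  Storing xᵗ − 1 makes zeroed memory describe position 0.
    F R Y : ℕ → ℕ
    F t = fingerprint p x (segment T 0 t)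
    R t = fingerprint p x (reverse (segment T 0 t))
    Y zero    = 0
    Y (suc t) = ((Y t + 1) * x + (p ∸ 1)) mod₀ p

    fingerprint≡% : ∀ u → fingerprint {σ} p x u ≡ polynomial x u % p
    fingerprint≡% u = mod₀≡% (polynomial x u)

    fingerprint% : ∀ u → fingerprint {σ} p x u % p ≡ polynomial x u % p
    fingerprint% u = trans (cong (_% p) (fingerprint≡% u)) (m%n%n≡m%n (polynomial x u) p)

    Y+1%p : ∀ t → (Y t + 1) % p ≡ (x ^ t) % p
    Y+1%p zero    = refl
    Y+1%p (suc t) = begin
      (((Y t + 1) * x + (p ∸ 1)) mod₀ p + 1) % p
        ≡⟨ %-cong-+ (((Y t + 1) * x + (p ∸ 1)) mod₀ p) ((Y t + 1) * x + (p ∸ 1)) 1 1 (trans (cong (_% p) (mod₀≡% ((Y t + 1) * x + (p ∸ 1)))) (m%n%n≡m%n ((Y t + 1) * x + (p ∸ 1)) p)) refl ⟩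
      ((Y t + 1) * x + (p ∸ 1) + 1) % p
        ≡⟨ cong (_% p) (trans (+-assoc ((Y t + 1) * x) (p ∸ 1) 1) (cong ((Y t + 1) * x +_) (m∸n+n≡m (>-nonZero⁻¹ p)))) ⟩
      ((Y t + 1) * x + p) % p      ≡⟨ [m+n]%n≡m%n ((Y t + 1) * x) p ⟩
      ((Y t + 1) * x) % p          ≡⟨ %-cong-* (Y t + 1) (x ^ t) x x (Y+1%p t) refl ⟩
      (x ^ t * x) % p              ≡⟨ cong (_% p) (*-comm (x ^ t) x) ⟩
      (x ^ suc t) % p              ∎
      where open ≡-Reasoning

    F-suc : ∀ h → F (suc h) ≡ (F h + (Y (suc h) + 1) * toℕ (T (suc h))) mod₀ p
    F-suc h = begin
      F (suc h)                                               ≡⟨ fingerprint≡% (segment T 0 (suc h)) ⟩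
      polynomial x (segment T 0 (suc h)) % p                  ≡⟨ cong (λ u → polynomial x u % p) (segment-suc h) ⟩
      polynomial x (segment T 0 h ++ [ T (suc h) ]) % p       ≡⟨ cong (_% p) (polynomial-++ x (segment T 0 h) [ T (suc h) ]) ⟩
      (polynomial x (segment T 0 h) + x ^ length (segment T 0 h) * (x * (a + 0))) % p
        ≡⟨ cong (λ k → (polynomial x (segment T 0 h) + x ^ k * (x * (a + 0))) % p) (length-segment 0 h) ⟩
      (polynomial x (segment T 0 h) + x ^ h * (x * (a + 0))) % p
        ≡⟨ cong (λ s → (polynomial x (segment T 0 h) + s) % p) (eq x a (x ^ h)) ⟩
      (polynomial x (segment T 0 h) + x ^ suc h * a) % p
        ≡⟨ %-cong-+ (F h) (polynomial x (segment T 0 h)) ((Y (suc h) + 1) * a) (x ^ suc h * a) (fingerprint% (segment T 0 h))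
             (%-cong-* (Y (suc h) + 1) (x ^ suc h) a a (Y+1%p (suc h)) refl) ⟨
      (F h + (Y (suc h) + 1) * a) % p                         ≡⟨ mod₀≡% (F h + (Y (suc h) + 1) * a) ⟨
      (F h + (Y (suc h) + 1) * a) mod₀ p                      ∎
      where
      open ≡-Reasoning
      a = toℕ (T (suc h))
      eq : ∀ x a y → y * (x * (a + 0)) ≡ x * y * a
      eq = solve-∀

    R-suc : ∀ h → R (suc h) ≡ ((R h + toℕ (T (suc h))) * x) mod₀ p
    R-suc h = begin
      R (suc h)                                               ≡⟨ fingerprint≡% (reverse (segment T 0 (suc h))) ⟩
      polynomial x (reverse (segment T 0 (suc h))) % p        ≡⟨ cong (λ u → polynomial x (reverse u) % p) (segment-suc h) ⟩
      polynomial x (reverse (segment T 0 h ++ [ T (suc h) ])) % p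
        ≡⟨ cong (λ u → polynomial x u % p) (List.reverse-++ (segment T 0 h) [ T (suc h) ]) ⟩
      (x * (a + polynomial x (reverse (segment T 0 h)))) % p
        ≡⟨ cong (_% p) (eq x a (polynomial x (reverse (segment T 0 h)))) ⟩
      ((polynomial x (reverse (segment T 0 h)) + a) * x) % p
        ≡⟨ %-cong-* (R h + a) (polynomial x (reverse (segment T 0 h)) + a) x x
             (%-cong-+ (R h) (polynomial x (reverse (segment T 0 h))) a a (fingerprint% (reverse (segment T 0 h))) refl) refl ⟨
      ((R h + a) * x) % p                                     ≡⟨ mod₀≡% ((R h + a) * x) ⟨
      ((R h + a) * x) mod₀ p                                  ∎
      where
      open ≡-Reasoning
      a = toℕ (T (suc h))
      eq : ∀ x a s → x * (a + s) ≡ (s + a) * x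
      eq = solve-∀

    module _ (p∤x : ¬ p ∣ x) {t h : ℕ} (t≤h : t ≤ h) where

      private
        u v : List (Fin σ)
        u = segment T 0 t
        v = segment T t h
        -- The part that both sides of the program's comparison share modulo p. What remains is xᵗ
        -- times the polynomial of v on one side and of its reversal on the other.
        c : ℕ
        c = polynomial x u + x ^ h * polynomial x (reverse u)

      x^t*x^[h∸t] : x ^ t * x ^ length v ≡ x ^ h
      x^t*x^[h∸t] = trans (cong (λ k → x ^ t * x ^ k) (length-segment t h))
        (trans (sym (^-distribˡ-+-* x t (h ∸ t))) (cong (x ^_) (m+[n∸m]≡n t≤h)))

      forward% : (F h + (Y h + 1) * R t) % p ≡ (c + x ^ t * polynomial x v) % p
      forward% = begin
        (F h + (Y h + 1) * R t) % p
          ≡⟨ %-cong-+ (F h) (polynomial x (segment T 0 h)) ((Y h + 1) * R t) (x ^ h * polynomial x (reverse u)) (fingerprint% (segment T 0 h))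
             (%-cong-* (Y h + 1) (x ^ h) (R t) (polynomial x (reverse u)) (Y+1%p h) (fingerprint% (reverse u))) ⟩
        (polynomial x (segment T 0 h) + x ^ h * polynomial x (reverse u)) % p
          ≡⟨ cong (λ s → (polynomial x s + x ^ h * polynomial x (reverse u)) % p) (segment-split t≤h) ⟩
        (polynomial x (u ++ v) + x ^ h * polynomial x (reverse u)) % p
          ≡⟨ cong (λ s → (s + x ^ h * polynomial x (reverse u)) % p) (polynomial-++ x u v) ⟩
        (polynomial x u + x ^ length u * polynomial x v + x ^ h * polynomial x (reverse u)) % p
          ≡⟨ cong (λ k → (polynomial x u + x ^ k * polynomial x v + x ^ h * polynomial x (reverse u)) % p) (length-segment 0 t) ⟩
        (polynomial x u + x ^ t * polynomial x v + x ^ h * polynomial x (reverse u)) % p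
          ≡⟨ cong (_% p) (eq (polynomial x u) (x ^ t * polynomial x v) (x ^ h * polynomial x (reverse u))) ⟩
        (c + x ^ t * polynomial x v) % p ∎
        where
        open ≡-Reasoning
        eq : ∀ a b c → a + b + c ≡ a + c + b
        eq = solve-∀

      -- The reversed prefix of length h is `reverse v ++ reverse u`. Multiplied by xᵗ, its first
      -- part gives the term with `reverse v`, and its second part, shifted by h - t further places,
      -- gives the term xʰ of `c`.
      backward% : (F t + (Y t + 1) * R h) % p ≡ (c + x ^ t * polynomial x (reverse v)) % p
      backward% = begin
        (F t + (Y t + 1) * R h) % p
          ≡⟨ %-cong-+ (F t) (polynomial x u) ((Y t + 1) * R h) (x ^ t * polynomial x (reverse (segment T 0 h))) (fingerprint% u)
             (%-cong-* (Y t + 1) (x ^ t) (R h) (polynomial x (reverse (segment T 0 h))) (Y+1%p t) (fingerprint% (reverse (segment T 0 h)))) ⟩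
        (polynomial x u + x ^ t * polynomial x (reverse (segment T 0 h))) % p
          ≡⟨ cong (λ s → (polynomial x u + x ^ t * polynomial x s) % p) (trans (cong reverse (segment-split t≤h)) (List.reverse-++ u v)) ⟩
        (polynomial x u + x ^ t * polynomial x (reverse v ++ reverse u)) % p
          ≡⟨ cong (λ s → (polynomial x u + x ^ t * s) % p) (polynomial-++ x (reverse v) (reverse u)) ⟩
        (polynomial x u + x ^ t * (polynomial x (reverse v) + x ^ length (reverse v) * polynomial x (reverse u))) % p
          ≡⟨ cong (λ k → (polynomial x u + x ^ t * (polynomial x (reverse v) + x ^ k * polynomial x (reverse u))) % p) (List.length-reverse v) ⟩
        (polynomial x u + x ^ t * (polynomial x (reverse v) + x ^ length v * polynomial x (reverse u))) % p
          ≡⟨ cong (_% p) (eq (polynomial x u) (x ^ t) (polynomial x (reverse v)) (x ^ length v) (polynomial x (reverse u))) ⟩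
        (polynomial x u + x ^ t * x ^ length v * polynomial x (reverse u) + x ^ t * polynomial x (reverse v)) % p
          ≡⟨ cong (λ s → (polynomial x u + s * polynomial x (reverse u) + x ^ t * polynomial x (reverse v)) % p) x^t*x^[h∸t] ⟩
        (c + x ^ t * polynomial x (reverse v)) % p ∎
        where
        open ≡-Reasoning
        eq : ∀ a b c d e → a + b * (c + d * e) ≡ a + b * d * e + b * c
        eq = solve-∀

      -- Adding `c` and multiplying by xᵗ are both cancellable modulo a prime that does not divide
      -- x. The equivalence therefore holds for every admissible base, including those that produce
      -- false positives.
      test⇔ : ((F h + (Y h + 1) * R t) mod₀ p ≡ᵇ (F t + (Y t + 1) * R h) mod₀ p) ≡ palindromeTest p x T t h
      test⇔ = ≡ᵇ-cong to from
        where
        ≡ᵇ-cong : ∀ {a b c d} → (a ≡ b → c ≡ d) → (c ≡ d → a ≡ b) → (a ≡ᵇ b) ≡ (c ≡ᵇ d)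
        ≡ᵇ-cong {a} {b} {c} {d} f g with a ≟ b
        ... | yes refl rewrite f refl | ≡ᵇ-refl a | ≡ᵇ-refl d = refl
        ... | no a≢b rewrite ≢⇒≡ᵇ a≢b | ≢⇒≡ᵇ (a≢b ∘ g) = refl
        lhs rhs f b : ℕ
        lhs = F h + (Y h + 1) * R t
        rhs = F t + (Y t + 1) * R h
        f = polynomial x v
        b = polynomial x (reverse v)
        to : lhs mod₀ p ≡ rhs mod₀ p → fingerprint p x v ≡ fingerprint p x (reverse v)
        to eq = trans (fingerprint≡% v) (trans
          (%-cancelˡ-* (x ^ t) {f} {b} p-prime (prime∤power t p-prime p∤x)
            (%-cancelˡ-+ c {x ^ t * f} {x ^ t * b}
              (trans (sym forward%) (trans (subst₂ _≡_ (mod₀≡% lhs) (mod₀≡% rhs) eq) backward%))))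
          (sym (fingerprint≡% (reverse v))))
        from : fingerprint p x v ≡ fingerprint p x (reverse v) → lhs mod₀ p ≡ rhs mod₀ p
        from eq = subst₂ _≡_ (sym (mod₀≡% lhs)) (sym (mod₀≡% rhs)) (trans forward% (trans
          (%-cong-+ c c (x ^ t * f) (x ^ t * b) refl
            (%-cong-* (x ^ t) (x ^ t) f b refl (subst₂ _≡_ (fingerprint≡% v) (fingerprint≡% (reverse v)) eq)))
          (sym backward%)))

-- The reported answers

-- Describes r as the start value ℓ raised to the largest value in P, independently of the order in
-- which the candidates were tried; two differently organised loops are compared through it.
record Maximum (P : ℕ → Set) (ℓ r : ℕ) : Set where
  constructor maximum
  field
    above    : ℓ ≤ r
    bounds   : ∀ v → P v → v ≤ r
    attained : r ≡ ℓ ⊎ P r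

maximum-none : ∀ {P ℓ} → (∀ v → P v → v ≤ ℓ) → Maximum P ℓ ℓ
maximum-none small = maximum ≤-refl small (inj₁ refl)

maximum-resp : ∀ {P P′ : ℕ → Set} {ℓ r} → (∀ v → P v → P′ v) → (∀ v → P′ v → P v) → Maximum P ℓ r → Maximum P′ ℓ r
maximum-resp {r = r} to from (maximum a b c) = maximum a (λ v → b v ∘ from v) ([ inj₁ , inj₂ ∘ to r ]′ c)

maximum-then : ∀ {P P′ P″ : ℕ → Set} {ℓ r r′} → Maximum P ℓ r → Maximum P′ r r′ →
               (∀ v → P″ v → P v ⊎ P′ v) → (∀ v → P v ⊎ P′ v → P″ v) → Maximum P″ ℓ r′
maximum-then {P} {P′} {P″} {ℓ} {r} {r′} (maximum a₁ b₁ c₁) (maximum a₂ b₂ c₂) split join =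
  maximum (≤-trans a₁ a₂) (λ v p″ → [ (λ p → ≤-trans (b₁ v p) a₂) , b₂ v ]′ (split v p″)) (attain c₂ c₁)
  where
  attain : r′ ≡ r ⊎ P′ r′ → r ≡ ℓ ⊎ P r → r′ ≡ ℓ ⊎ P″ r′
  attain (inj₂ p′)   _           = inj₂ (join r′ (inj₂ p′))
  attain (inj₁ refl) (inj₁ refl) = inj₁ refl
  attain (inj₁ refl) (inj₂ p)    = inj₂ (join r (inj₁ p))

-- The hypotheses are asymmetric because one side may have extra candidates that do not exceed ℓ.
-- This absorbs the empty palindrome: a slot that holds the current position proposes radius 0,
-- whereas the centres run by `answer` propose positive radii only.
maximum-unique : ∀ {P P′ : ℕ → Set} {ℓ r r′} → Maximum P ℓ r → Maximum P′ ℓ r′ →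
                 (∀ v → P v → v ≤ ℓ ⊎ P′ v) → (∀ v → P′ v → P v) → r ≡ r′
maximum-unique {P} {P′} {ℓ} {r} {r′} (maximum a₁ b₁ c₁) (maximum a₂ b₂ c₂) f g =
  ≤-antisym ([ (λ { refl → a₂ }) , (λ p → [ (λ r≤ℓ → ≤-trans r≤ℓ a₂) , b₂ r ]′ (f r p)) ]′ c₁)
            ([ (λ { refl → a₁ }) , (λ p′ → b₁ r′ (g r′ p′)) ]′ c₂)

module _ (p : ℕ) (F R Y : ℕ → ℕ) where

  open Scan p F R Y

  Passing : (h t v : ℕ) → Set
  Passing h t v = passes h t ≡ true × v ≡ (h ∸ t) div₀ 2

  visit-maximum : ∀ h t ℓ → Maximum (Passing h t) ℓ (visit h t ℓ)
  visit-maximum h t ℓ with passes h t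
  ... | false = maximum-none λ { _ (() , _) }
  ... | true with ℓ <ᵇ (h ∸ t) div₀ 2 in eq
  ...   | true  = maximum (<⇒≤ (<ᵇ⇒< ℓ _ (subst Bool.T (sym eq) tt))) (λ { _ (_ , refl) → ≤-refl }) (inj₂ (refl , refl))
  ...   | false = maximum-none λ { v (_ , refl) → ≮⇒≥ λ ℓ<v → subst Bool.T eq (<⇒<ᵇ ℓ<v) }

  scan-maximum : ∀ h k val ℓ → Maximum (λ v → ∃[ s ] s < k × Passing h (val s) v) ℓ (scan h k val ℓ)
  scan-maximum h zero    val ℓ = maximum-none λ { _ (_ , () , _) }
  scan-maximum h (suc k) val ℓ = maximum-then (visit-maximum h (val 0) ℓ) (scan-maximum h k (val ∘ suc) (visit h (val 0) ℓ)) split join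
    where
    split : ∀ v → ∃[ s ] s < suc k × Passing h (val s) v → Passing h (val 0) v ⊎ (∃[ s ] s < k × Passing h (val (suc s)) v)
    split v (zero  , _ , pass)       = inj₁ pass
    split v (suc s , s≤s s<k , pass) = inj₂ (s , s<k , pass)
    join : ∀ v → Passing h (val 0) v ⊎ (∃[ s ] s < k × Passing h (val (suc s)) v) → ∃[ s ] s < suc k × Passing h (val s) v
    join v (inj₁ pass)             = 0 , s≤s z≤n , pass
    join v (inj₂ (s , s<k , pass)) = suc s , s≤s s<k , pass

  scanLevels-maximum : ∀ h Q gs ℓ →
    Maximum (λ v → ∃[ t ] isLandmark Q gs h t ≡ true × Passing h t v) ℓ (scanLevels h Q gs ℓ)
  scanLevels-maximum h Q []       ℓ = maximum-none λ { _ (_ , () , _) }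
  scanLevels-maximum h Q (g ∷ gs) ℓ =
    maximum-then (scan-maximum h Q (λ s → latest g Q s h) ℓ)
      (scanLevels-maximum h Q gs (scan h Q (λ s → latest g Q s h) ℓ)) split join
    where
    split : ∀ v → ∃[ t ] isLandmark Q (g ∷ gs) h t ≡ true × Passing h t v →
            (∃[ s ] s < Q × Passing h (latest g Q s h) v) ⊎ (∃[ t ] isLandmark Q gs h t ≡ true × Passing h t v)
    split v (t , mark , pass) with ∨-true {onLevel g Q h t} mark
    ... | inj₂ deeper = inj₂ (t , deeper , pass)
    ... | inj₁ here′ with onLevel-sound {g} {Q} {h} {t} here′
    ...   | s , s<Q , refl = inj₁ (s , s<Q , pass)
    join : ∀ v → (∃[ s ] s < Q × Passing h (latest g Q s h) v) ⊎ (∃[ t ] isLandmark Q gs h t ≡ true × Passing h t v) →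
           ∃[ t ] isLandmark Q (g ∷ gs) h t ≡ true × Passing h t v
    join v (inj₁ (s , s<Q , pass)) = latest g Q s h , on-level , pass
      where
      on-level : isLandmark Q (g ∷ gs) h (latest g Q s h) ≡ true
      on-level rewrite anyBelow-complete Q (λ s′ → latest g Q s′ h ≡ᵇ latest g Q s h) s<Q (≡ᵇ-refl (latest g Q s h)) = refl
    join v (inj₂ (t , deeper , pass)) = t , deep , pass
      where
      deep : isLandmark Q (g ∷ gs) h t ≡ true
      deep rewrite deeper = Bool.∨-zeroʳ (onLevel g Q h t)

module _ {σ : ℕ} (T : Text σ) (p x : ℕ) (𝓛 : Landmarks) where

  Active : (h c : ℕ) → Set
  Active h c = h + 2 ≤ 2 * c × 𝓛 h (2 * c ∸ h ∸ 2) ≡ true × palindromeTest p x T (2 * c ∸ h ∸ 2) h ≡ true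

  process-maximum : ∀ h c ℓ → Maximum (λ v → Active h c × v ≡ suc h ∸ c) ℓ (process p x 𝓛 T h c ℓ)
  process-maximum h c ℓ
    with h + 2 ≤ᵇ 2 * c in eq | 𝓛 h (2 * c ∸ h ∸ 2) | palindromeTest p x T (2 * c ∸ h ∸ 2) h
  ... | false | _     | _     = maximum-none λ { _ ((le , _) , _) → ⊥-elim (subst Bool.T eq (≤⇒≤ᵇ le)) }
  ... | true  | false | _     = maximum-none λ { _ ((_ , () , _) , _) }
  ... | true  | true  | false = maximum-none λ { _ ((_ , _ , ()) , _) }
  ... | true  | true  | true  = maximum (m≤m⊔n ℓ (suc h ∸ c)) (λ { _ (_ , refl) → m≤n⊔m ℓ (suc h ∸ c) }) attain
    where
    attain : ℓ ⊔ (suc h ∸ c) ≡ ℓ ⊎ ((h + 2 ≤ 2 * c × true ≡ true × true ≡ true) × ℓ ⊔ (suc h ∸ c) ≡ suc h ∸ c)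
    attain with ≤-total (suc h ∸ c) ℓ
    ... | inj₁ v≤ℓ = inj₁ (m≥n⇒m⊔n≡m v≤ℓ)
    ... | inj₂ ℓ≤v = inj₂ ((≤ᵇ⇒≤ (h + 2) (2 * c) (subst Bool.T (sym eq) tt) , refl , refl) , m≤n⇒m⊔n≡n ℓ≤v)

  processes-maximum : ∀ h cs ℓ →
    Maximum (λ v → ∃[ c ] c ∈ cs × Active h c × v ≡ suc h ∸ c) ℓ (foldr (process p x 𝓛 T h) ℓ cs)
  processes-maximum h []       ℓ = maximum-none λ { _ (_ , () , _) }
  processes-maximum h (c ∷ cs) ℓ =
    maximum-then (processes-maximum h cs ℓ) (process-maximum h c (foldr (process p x 𝓛 T h) ℓ cs))
      (λ { v (_ , here refl , act) → inj₂ act ; v (c′ , there c′∈ , act) → inj₁ (c′ , c′∈ , act) })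
      (λ { v (inj₁ (c′ , c′∈ , act)) → c′ , there c′∈ , act ; v (inj₂ act) → c , here refl , act })

  answer-maximum : ∀ h → Maximum (λ v → ∃[ c ] c ≤ suc h × Active (suc h) c × v ≡ suc (suc h) ∸ c)
                                 (answer p x 𝓛 T h) (answer p x 𝓛 T (suc h))
  answer-maximum h = maximum-resp
    (λ { v (c , c∈ , act) → c , ≤-pred (∈-upTo⁻ c∈) , act }) (λ { v (c , c≤ , act) → c , ∈-upTo⁺ (s≤s c≤) , act })
    (processes-maximum (suc h) (upTo (suc (suc h))) (answer p x 𝓛 T h))

-- Together with `centre` this translates between the two names of a candidate: its centre c and its
-- landmark t. The block T[t+1..h] has length 2 k, where k = h + 1 - c is the radius.
split-at-centre : ∀ {h c} → c ≤ h → h + 2 ≤ 2 * c → h ≡ (2 * c ∸ h ∸ 2) + 2 * (suc h ∸ c)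
split-at-centre {h} {c} c≤h le = +-cancelʳ-≡ (2 * c) h (t + 2 * k) (begin
  h + 2 * c              ≡⟨ cong (h +_) 2c≡ ⟩
  h + (t + (h + 2))      ≡⟨ eq₁ h t ⟩
  t + 2 * suc h          ≡⟨ cong (λ s → t + 2 * s) (m∸n+n≡m (m≤n⇒m≤1+n c≤h)) ⟨
  t + 2 * (k + c)        ≡⟨ eq₂ t k c ⟩
  t + 2 * k + 2 * c      ∎)
  where
  open ≡-Reasoning
  t k : ℕ
  t = 2 * c ∸ h ∸ 2
  k = suc h ∸ c
  2c≡ : 2 * c ≡ t + (h + 2)
  2c≡ = trans (sym (m∸n+n≡m le)) (cong (_+ (h + 2)) (sym (∸-+-assoc (2 * c) h 2)))
  eq₁ : ∀ h t → h + (t + (h + 2)) ≡ t + 2 * suc h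
  eq₁ = solve-∀
  eq₂ : ∀ t k c → t + 2 * (k + c) ≡ t + 2 * k + 2 * c
  eq₂ = solve-∀

centre : ∀ h t k → h ≡ t + 2 * k → 2 * (suc h ∸ k) ∸ h ∸ 2 ≡ t × suc h ∸ (suc h ∸ k) ≡ k × h + 2 ≤ 2 * (suc h ∸ k)
centre h t k refl = trans (cong (λ c → 2 * c ∸ h ∸ 2) c≡) (trans (cong (λ m → m ∸ h ∸ 2) (eq₁ t k)) (trans (cong (_∸ 2) (m+n∸n≡m (t + 2) h)) (m+n∸n≡m t 2))) ,
  m∸[m∸n]≡n (≤-trans (m≤m+n k (k + 0)) (≤-trans (m≤n+m (2 * k) t) (n≤1+n h))) ,
  subst (λ c → h + 2 ≤ 2 * c) (sym c≡) (subst (h + 2 ≤_) (eq₂ t k) (m≤n+m (h + 2) t))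
  where
  c≡ : suc h ∸ k ≡ suc (t + k)
  c≡ = trans (cong (_∸ k) (eq₀ t k)) (m+n∸n≡m (suc (t + k)) k)
    where
    eq₀ : ∀ t k → suc (t + 2 * k) ≡ suc (t + k) + k
    eq₀ = solve-∀
  eq₁ : ∀ t k → 2 * suc (t + k) ≡ t + 2 + (t + 2 * k)
  eq₁ = solve-∀
  eq₂ : ∀ t k → t + (t + 2 * k + 2) ≡ 2 * suc (t + k)
  eq₂ = solve-∀

module _ {σ : ℕ} (T : Text σ) (p x : ℕ) (p-prime : Prime p) (p∤x : ¬ p ∣ x) (Q : ℕ) (gs : List ℕ) where

  open Fingerprints T p x p-prime
  open Scan p F R Y

  landmark≤ : ∀ {h t} → isLandmark Q gs h t ≡ true → t ≤ h
  landmark≤ {h} {t} = Admissible.inPast (isLandmark-admissible Q gs) h t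

  -- The parity check selects the landmarks of the form 2c - h - 2, and for those `test⇔` identifies
  -- the two tests. Since both steps start from the same earlier answer, equal candidates give equal
  -- maxima.
  reported≡answer : ∀ h → reported Q gs h ≡ answer p x (isLandmark Q gs) T h
  reported≡answer zero = refl
  reported≡answer (suc h) rewrite reported≡answer h =
    maximum-unique (scanLevels-maximum p F R Y (suc h) Q gs _) (answer-maximum T p x (isLandmark Q gs) h) to from
    where
    ∧-true : ∀ {a b} → a ∧ b ≡ true → a ≡ true × b ≡ true
    ∧-true {true} {true} refl = refl , refl
    to : ∀ v → ∃[ t ] isLandmark Q gs (suc h) t ≡ true × Passing p F R Y (suc h) t v →
         v ≤ answer p x (isLandmark Q gs) T h ⊎ (∃[ c ] c ≤ suc h × Active T p x (isLandmark Q gs) (suc h) c × v ≡ suc (suc h) ∸ c)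
    to v (t , mark , pass , refl) with ∧-true {(suc h ∸ t) mod₀ 2 ≡ᵇ 0} pass
    ... | even , test = by-size ((suc h ∸ t) / 2) refl
      where
      t≤ : t ≤ suc h
      t≤ = landmark≤ mark
      double : suc h ≡ t + 2 * ((suc h ∸ t) / 2)
      double = trans (sym (m+[n∸m]≡n t≤)) (cong (t +_) (trans (m≡m%n+[m/n]*n (suc h ∸ t) 2)
        (trans (cong (_+ (suc h ∸ t) / 2 * 2) (≡ᵇ-sound _ 0 even)) (*-comm ((suc h ∸ t) / 2) 2))))
      by-size : ∀ k → (suc h ∸ t) / 2 ≡ k → k ≤ answer p x (isLandmark Q gs) T h ⊎
                (∃[ c ] c ≤ suc h × Active T p x (isLandmark Q gs) (suc h) c × k ≡ suc (suc h) ∸ c)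
      by-size zero    _  = inj₁ z≤n
      by-size (suc k) eq with centre (suc h) t (suc k) (subst (λ k → suc h ≡ t + 2 * k) eq double)
      ... | t≡ , k≡ , le = inj₂ (suc (suc h) ∸ suc k , m∸n≤m (suc h) k ,
        (le , subst (λ t → isLandmark Q gs (suc h) t ≡ true) (sym t≡) mark ,
         subst (λ t → palindromeTest p x T t (suc h) ≡ true) (sym t≡) (trans (sym (test⇔ p∤x t≤)) test)) , sym k≡)
    from : ∀ v → ∃[ c ] c ≤ suc h × Active T p x (isLandmark Q gs) (suc h) c × v ≡ suc (suc h) ∸ c →
           ∃[ t ] isLandmark Q gs (suc h) t ≡ true × Passing p F R Y (suc h) t v
    from v (c , c≤ , (le , mark , test) , refl) = t , mark , passing , sym half
      where
      t k : ℕ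
      t = 2 * c ∸ suc h ∸ 2
      k = suc (suc h) ∸ c
      t≤ : t ≤ suc h
      t≤ = landmark≤ mark
      h≡ : suc h ≡ t + 2 * k
      h≡ = split-at-centre c≤ le
      diff : suc h ∸ t ≡ k * 2
      diff = trans (cong (_∸ t) h≡) (trans (m+n∸m≡n t (2 * k)) (*-comm 2 k))
      half : (suc h ∸ t) / 2 ≡ k
      half = trans (cong (_/ 2) diff) (m*n/n≡m k 2)
      passing : passes (suc h) t ≡ true
      passing rewrite trans (cong (_% 2) diff) (m*n%n≡0 k 2) = trans (test⇔ p∤x t≤) test

-- Roots of polynomials modulo p

∣p∪q∣≤∣p∣+∣q∣ : ∀ {N} (B C : Subset N) → Sub.∣ B Sub.∪ C ∣ ≤ Sub.∣ B ∣ + Sub.∣ C ∣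
∣p∪q∣≤∣p∣+∣q∣ []          []          = z≤n
∣p∪q∣≤∣p∣+∣q∣ (false ∷ B) (false ∷ C) = ∣p∪q∣≤∣p∣+∣q∣ B C
∣p∪q∣≤∣p∣+∣q∣ (false ∷ B) (true ∷ C)  =
  subst (suc Sub.∣ B Sub.∪ C ∣ ≤_) (sym (+-suc Sub.∣ B ∣ Sub.∣ C ∣)) (s≤s (∣p∪q∣≤∣p∣+∣q∣ B C))
∣p∪q∣≤∣p∣+∣q∣ (true ∷ B)  (false ∷ C) = s≤s (∣p∪q∣≤∣p∣+∣q∣ B C)
∣p∪q∣≤∣p∣+∣q∣ (true ∷ B)  (true ∷ C)  =
  s≤s (≤-trans (∣p∪q∣≤∣p∣+∣q∣ B C) (+-monoʳ-≤ Sub.∣ B ∣ (n≤1+n Sub.∣ C ∣)))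

⋃ : ∀ {N} → ℕ → (ℕ → Subset N) → Subset N
⋃ zero    f = Sub.⊥
⋃ (suc k) f = f k Sub.∪ ⋃ k f

∈-⋃ : ∀ {N} k {f : ℕ → Subset N} {s i} → s < k → i Sub.∈ f s → i Sub.∈ ⋃ k f
∈-⋃ (suc k) {s = s} s<1+k i∈ with s ≟ k
... | yes refl = Sub.x∈p∪q⁺ (inj₁ i∈)
... | no s≢k   = Sub.x∈p∪q⁺ (inj₂ (∈-⋃ k (≤∧≢⇒< (≤-pred s<1+k) s≢k) i∈))

∣⋃∣≤ : ∀ {N} k {f : ℕ → Subset N} {b} → (∀ s → Sub.∣ f s ∣ ≤ b) → Sub.∣ ⋃ k f ∣ ≤ k * b
∣⋃∣≤ {N} zero    small = ≤-reflexive (Sub.∣⊥∣≡0 N)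
∣⋃∣≤ (suc k) {f} small = ≤-trans (∣p∪q∣≤∣p∣+∣q∣ (f k) (⋃ k f)) (+-mono-≤ (small k) (∣⋃∣≤ k small))

horner : List ℤ → ℤ → ℤ
horner []       y = ℤ.+ 0
horner (d ∷ ds) y = d ℤ.+ y ℤ.* horner ds y

-- The coefficients of (P(X) − P(r)) / (X − r).
quotientBy : ℤ → List ℤ → List ℤ
quotientBy r []            = []
quotientBy r (d ∷ [])      = []
quotientBy r (d ∷ d′ ∷ ds) = horner (d′ ∷ ds) r ∷ quotientBy r (d′ ∷ ds)

-- Synthetic division: each quotient coefficient is the value at r of the remaining tail. The
-- divisor X - r is monic, so the identity holds already over the integers.
horner-quotientBy : ∀ r ds y → horner ds y ≡ horner ds r ℤ.+ (y ℤ.- r) ℤ.* horner (quotientBy r ds) y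
horner-quotientBy r []       y = sym (trans (ℤ.+-identityˡ _) (ℤ.*-zeroʳ (y ℤ.- r)))
horner-quotientBy r (d ∷ []) y = eq d y r
  where
  eq : ∀ d y r → d ℤ.+ y ℤ.* ℤ.+ 0 ≡ d ℤ.+ r ℤ.* ℤ.+ 0 ℤ.+ (y ℤ.- r) ℤ.* ℤ.+ 0
  eq = solveℤ-∀
horner-quotientBy r (d ∷ ds@(_ ∷ _)) y = trans (cong (λ s → d ℤ.+ y ℤ.* s) (horner-quotientBy r ds y))
  (eq d y r (horner ds r) (horner (quotientBy r ds) y))
  where
  eq : ∀ d y r a q → d ℤ.+ y ℤ.* (a ℤ.+ (y ℤ.- r) ℤ.* q) ≡ d ℤ.+ r ℤ.* a ℤ.+ (y ℤ.- r) ℤ.* (a ℤ.+ y ℤ.* q)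
  eq = solveℤ-∀

length-quotientBy : ∀ r d ds → length (quotientBy r (d ∷ ds)) ≡ length ds
length-quotientBy r d []        = refl
length-quotientBy r d (d′ ∷ ds) = cong suc (length-quotientBy r d′ ds)

∣+a-+b∣ : ∀ a b → ℤ.∣ ℤ.+ a ℤ.- ℤ.+ b ∣ ≡ ∣ a - b ∣
∣+a-+b∣ a b with ≤-total a b
... | inj₁ a≤b = trans (cong ℤ.∣_∣ (ℤ.m-n≡m⊖n a b)) (trans (ℤ.∣⊖∣-≤ a≤b) (sym (m≤n⇒∣m-n∣≡n∸m a≤b)))
... | inj₂ b≤a = trans (cong ℤ.∣_∣ (trans (ℤ.m-n≡m⊖n a b) (ℤ.⊖-≥ b≤a))) (sym (m≤n⇒∣n-m∣≡n∸m b≤a))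

module Roots (p : ℕ) (p-prime : Prime p) where

  infix 4 p∣_
  p∣_ : ℤ → Set
  p∣ z = ℤ.+ p ℤˢ.∣ z

  euclid : ∀ y z → p∣ y ℤ.* z → p∣ y ⊎ p∣ z
  euclid y z div with euclidsLemma ℤ.∣ y ∣ ℤ.∣ z ∣ p-prime (subst (p ∣_) (ℤ.abs-* y z) (ℤˢ.∣⇒∣ᵤ div))
  ... | inj₁ p∣y = inj₁ (ℤˢ.∣ᵤ⇒∣ p∣y)
  ... | inj₂ p∣z = inj₂ (ℤˢ.∣ᵤ⇒∣ p∣z)

  small-multiple : ∀ {a b} → a < p → b < p → p∣ ℤ.+ a ℤ.- ℤ.+ b → a ≡ b
  small-multiple {a} {b} a<p b<p div with ∣ a - b ∣ ≟ 0
  ... | yes d≡0 = ∣m-n∣≡0⇒m≡n d≡0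
  ... | no d≢0  = contradiction
    (∣⇒≤ {{≢-nonZero d≢0}} (subst (p ∣_) (∣+a-+b∣ a b) (ℤˢ.∣⇒∣ᵤ div)))
    (<⇒≱ (≤-<-trans (∣m-n∣≤m⊔n a b) (⊔-pres-<m a<p b<p)))

  Vanishes : List ℤ → Set
  Vanishes ds = ∀ {d} → d ∈ ds → p∣ d

  -- The leading entry q of the quotient list is the value of the tail at r, and d + r q is the
  -- value of the whole polynomial; so p divides d. Divisibility of q is also the hypothesis needed
  -- to continue with the tail.
  vanishing-quotient : ∀ r ds → p∣ horner ds r → Vanishes (quotientBy r ds) → Vanishes ds
  vanishing-quotient r (d ∷ []) p∣d _ (here refl) = subst p∣_ (eq d r) p∣d
    where
    eq : ∀ d r → d ℤ.+ r ℤ.* ℤ.+ 0 ≡ d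
    eq = solveℤ-∀
  vanishing-quotient r (d ∷ ds@(_ ∷ _)) p∣P van (here refl) =
    ℤˢ.∣m+n∣n⇒∣m p∣P (ℤˢ.∣n⇒∣m*n r (van (here refl)))
  vanishing-quotient r (d ∷ ds@(_ ∷ _)) p∣P van (there d∈) =
    vanishing-quotient r ds (van (here refl)) (van ∘ there) d∈

  point : Fin (p ∸ 1) → ℤ
  point i = ℤ.+ suc (toℕ i)

  point<p : (i : Fin (p ∸ 1)) → suc (toℕ i) < p
  point<p i = subst (suc (suc (toℕ i)) ≤_) (m+[n∸m]≡n (>-nonZero⁻¹ p {{prime⇒nonZero p-prime}})) (s≤s (Fin.toℕ<n i))

  point-injective : ∀ i j → p∣ point i ℤ.- point j → i ≡ j
  point-injective i j div = Fin.toℕ-injective (suc-injective (small-multiple (point<p i) (point<p j) div))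

  -- Lagrange's bound by splitting off one root r: for another root y, p divides (y - r) Q(y) but
  -- not y - r, so y is a root of the quotient, which is shorter by one coefficient and still
  -- nonzero modulo p by `vanishing-quotient`. The number k bounds the length to make the recursion
  -- structural.
  root-count : ∀ k ds (B : Subset (p ∸ 1)) → length ds ≤ k → (∀ {i} → i Sub.∈ B → p∣ horner ds (point i)) →
               ¬ Vanishes ds → Sub.∣ B ∣ < length ds
  root-count k [] B _ roots nonzero = contradiction (λ ()) nonzero
  root-count (suc k) ds@(d ∷ ds′) B (s≤s len≤k) roots nonzero with Sub.nonempty? B
  ... | no empty rewrite Sub.Empty-unique empty | Sub.∣⊥∣≡0 (p ∸ 1) = s≤s z≤n
  ... | yes (j , j∈B) = begin-strict
    Sub.∣ B ∣                        ≤⟨ Sub.p⊆q⇒∣p∣≤∣q∣ covered ⟩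
    Sub.∣ Sub.⁅ j ⁆ Sub.∪ B′ ∣        ≤⟨ ∣p∪q∣≤∣p∣+∣q∣ Sub.⁅ j ⁆ B′ ⟩
    Sub.∣ Sub.⁅ j ⁆ ∣ + Sub.∣ B′ ∣    ≡⟨ cong (_+ Sub.∣ B′ ∣) (Sub.∣⁅x⁆∣≡1 j) ⟩
    suc Sub.∣ B′ ∣                   <⟨ s≤s (subst (Sub.∣ B′ ∣ <_) (length-quotientBy r d ds′)
                                          (root-count k (quotientBy r ds) B′ (subst (_≤ k) (sym (length-quotientBy r d ds′)) len≤k) roots′
                                            (nonzero ∘ vanishing-quotient r ds (roots j∈B)))) ⟩
    length ds                        ∎
    where
    open ≤-Reasoning
    r : ℤ
    r = point j
    B′ : Subset (p ∸ 1)
    B′ = B Sub.∩ Sub.∁ Sub.⁅ j ⁆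
    covered : B Sub.⊆ Sub.⁅ j ⁆ Sub.∪ B′
    covered {i} i∈B with i Fin.≟ j
    ... | yes refl = Sub.x∈p∪q⁺ (inj₁ (Sub.x∈⁅x⁆ i))
    ... | no i≢j   = Sub.x∈p∪q⁺ (inj₂ (Sub.x∈p∩q⁺ (i∈B , Sub.x∉p⇒x∈∁p (Sub.x≢y⇒x∉⁅y⁆ i≢j))))
    roots′ : ∀ {i} → i Sub.∈ B′ → p∣ horner (quotientBy r ds) (point i)
    roots′ {i} i∈B′ with Sub.x∈p∩q⁻ B (Sub.∁ Sub.⁅ j ⁆) i∈B′
    ... | i∈B , i∉j with euclid (point i ℤ.- r) (horner (quotientBy r ds) (point i))
                          (ℤˢ.∣m+n∣m⇒∣n (subst p∣_ (horner-quotientBy r ds (point i)) (roots i∈B)) (roots j∈B))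
    ...   | inj₂ div = div
    ...   | inj₁ div with point-injective i j div
    ...     | refl = contradiction (Sub.x∈⁅x⁆ i) (Sub.x∈∁p⇒x∉p i∉j)

  differences : ∀ {σ} → List (Fin σ) → List (Fin σ) → List ℤ
  differences (a ∷ u) (b ∷ v) = (ℤ.+ toℕ a ℤ.- ℤ.+ toℕ b) ∷ differences u v
  differences _       _       = []

  length-differences : ∀ {σ} (u v : List (Fin σ)) → length (differences u v) ≤ length u
  length-differences []      v       = z≤n
  length-differences (a ∷ u) []      = z≤n
  length-differences (a ∷ u) (b ∷ v) = s≤s (length-differences u v)

  polynomial-difference : ∀ {σ} x (u v : List (Fin σ)) → length u ≡ length v →
    ℤ.+ polynomial x u ℤ.- ℤ.+ polynomial x v ≡ ℤ.+ x ℤ.* horner (differences u v) (ℤ.+ x)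
  polynomial-difference x []      []      _  = sym (ℤ.*-zeroʳ (ℤ.+ x))
  polynomial-difference x (a ∷ u) (b ∷ v) eq = begin
    ℤ.+ (x * (toℕ a + f)) ℤ.- ℤ.+ (x * (toℕ b + g))
      ≡⟨ cong₂ ℤ._-_ (cast (toℕ a) f) (cast (toℕ b) g) ⟩
    ℤ.+ x ℤ.* (ℤ.+ toℕ a ℤ.+ ℤ.+ f) ℤ.- ℤ.+ x ℤ.* (ℤ.+ toℕ b ℤ.+ ℤ.+ g)
      ≡⟨ regroup (ℤ.+ x) (ℤ.+ toℕ a) (ℤ.+ f) (ℤ.+ toℕ b) (ℤ.+ g) ⟩
    ℤ.+ x ℤ.* ((ℤ.+ toℕ a ℤ.- ℤ.+ toℕ b) ℤ.+ (ℤ.+ f ℤ.- ℤ.+ g))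
      ≡⟨ cong (λ s → ℤ.+ x ℤ.* ((ℤ.+ toℕ a ℤ.- ℤ.+ toℕ b) ℤ.+ s)) (polynomial-difference x u v (suc-injective eq)) ⟩
    ℤ.+ x ℤ.* horner (differences (a ∷ u) (b ∷ v)) (ℤ.+ x) ∎
    where
    open ≡-Reasoning
    f = polynomial x u
    g = polynomial x v
    cast : ∀ a f → ℤ.+ (x * (a + f)) ≡ ℤ.+ x ℤ.* (ℤ.+ a ℤ.+ ℤ.+ f)
    cast a f = ℤ.pos-* x (a + f)
    regroup : ∀ x a f b g → x ℤ.* (a ℤ.+ f) ℤ.- x ℤ.* (b ℤ.+ g) ≡ x ℤ.* ((a ℤ.- b) ℤ.+ (f ℤ.- g))
    regroup = solveℤ-∀

  -- With σ ≤ p, characters that agree modulo p are equal. This is what makes the difference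
  -- polynomial of two distinct words nonzero modulo p.
  vanishing-differences : ∀ {σ} → σ ≤ p → (u v : List (Fin σ)) → length u ≡ length v → Vanishes (differences u v) → u ≡ v
  vanishing-differences σ≤p []      []      _  _   = refl
  vanishing-differences σ≤p (a ∷ u) (b ∷ v) eq van = cong₂ _∷_
    (Fin.toℕ-injective (small-multiple (<-≤-trans (Fin.toℕ<n a) σ≤p) (<-≤-trans (Fin.toℕ<n b) σ≤p) (van (here refl))))
    (vanishing-differences σ≤p u v (suc-injective eq) (van ∘ there))

  -- Fingerprint polynomials have no constant term, so their difference carries a factor x, which is
  -- cancelled because x lies strictly between 0 and p.
  collision : ∀ {σ} (u v : List (Fin σ)) i → length u ≡ length v →
              fingerprint p (suc (toℕ i)) u ≡ fingerprint p (suc (toℕ i)) v → p∣ horner (differences u v) (point i)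
  collision u v i len eq with euclid (point i) (horner (differences u v) (point i))
    (subst p∣_ (polynomial-difference (suc (toℕ i)) u v len)
      (ℤˢ.∣ᵤ⇒∣ (subst (p ∣_) (sym (∣+a-+b∣ f g)) (%≡⇒∣ {{p≢0}} {f} {g} (trans (sym (mod₀≡% {{p≢0}} f)) (trans eq (mod₀≡% {{p≢0}} g)))))))
    where
    p≢0 = prime⇒nonZero p-prime
    f = polynomial (suc (toℕ i)) u
    g = polynomial (suc (toℕ i)) v
  ... | inj₂ div = div
  ... | inj₁ div with small-multiple {suc (toℕ i)} {0} (point<p i) (>-nonZero⁻¹ p {{prime⇒nonZero p-prime}}) (subst p∣_ (sym (ℤ.+-identityʳ (point i))) div)
  ...   | ()

  module _ {σ : ℕ} (T : Text σ) (σ≤p : σ ≤ p) (n : ℕ) where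

    Mirrored : (t h : ℕ) → Set
    Mirrored t h = segment T t h ≡ reverse (segment T t h)

    passing : (t h : ℕ) → Subset (p ∸ 1)
    passing t h = tabulate λ i → palindromeTest p (suc (toℕ i)) T t h

    misleading : (t h : ℕ) → Subset (p ∸ 1)
    misleading t h with List.≡-dec Fin._≟_ (segment T t h) (reverse (segment T t h))
    ... | yes _ = Sub.⊥
    ... | no  _ = passing t h

    ∈-passing⁺ : ∀ {t h i} → palindromeTest p (suc (toℕ i)) T t h ≡ true → i Sub.∈ passing t h
    ∈-passing⁺ {t} {h} {i} eq = Vec.lookup⇒[]= i (passing t h) (trans (Vec.lookup∘tabulate _ i) eq)

    ∈-passing⁻ : ∀ {t h i} → i Sub.∈ passing t h → palindromeTest p (suc (toℕ i)) T t h ≡ true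
    ∈-passing⁻ {t} {h} {i} i∈ = trans (sym (Vec.lookup∘tabulate _ i)) (Vec.[]=⇒lookup i∈)

    ∣misleading∣≤ : ∀ t h → h ≤ n → Sub.∣ misleading t h ∣ ≤ n
    ∣misleading∣≤ t h h≤n with List.≡-dec Fin._≟_ (segment T t h) (reverse (segment T t h))
    ... | yes _      = subst (_≤ n) (sym (Sub.∣⊥∣≡0 (p ∸ 1))) z≤n
    ... | no u≢revu = begin
      Sub.∣ passing t h ∣                                          <⟨ root-count _ _ (passing t h) ≤-refl
                                                                      (λ {i} i∈ → collision u (reverse u) i same-length (≡ᵇ-sound _ _ (∈-passing⁻ {t} {h} {i} i∈)))
                                                                      (u≢revu ∘ vanishing-differences σ≤p u (reverse u) same-length) ⟩
      length (differences u (reverse u))                           ≤⟨ length-differences u (reverse u) ⟩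
      length u                                                     ≡⟨ length-segment T t h ⟩
      h ∸ t                                                        ≤⟨ ≤-trans (m∸n≤m h t) h≤n ⟩
      n                                                            ∎
      where
      open ≤-Reasoning
      u = segment T t h
      same-length : length u ≡ length (reverse u)
      same-length = sym (List.length-reverse u)

    reliable-bases : Σ[ G ∈ Subset (p ∸ 1) ] Sub.∣ Sub.∁ G ∣ ≤ n * (n * n) ×
      (∀ i → i Sub.∈ G → ∀ {t h} → t < h → h ≤ n → palindromeTest p (suc (toℕ i)) T t h ≡ true → Mirrored t h)
    reliable-bases = Sub.∁ bad , count , reliable
      where
      bad : Subset (p ∸ 1)
      -- The index h stands for the position h + 1. Capping it at n lets the size bound hold for
      -- every index, as `∣⋃∣≤` demands, without changing the sets that occur for h < n.
      bad = ⋃ n λ h → ⋃ n λ t → misleading t (suc h ⊓ n)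
      count : Sub.∣ Sub.∁ (Sub.∁ bad) ∣ ≤ n * (n * n)
      count = begin
        Sub.∣ Sub.∁ (Sub.∁ bad) ∣        ≡⟨ Sub.∣∁p∣≡n∸∣p∣ (Sub.∁ bad) ⟩
        p ∸ 1 ∸ Sub.∣ Sub.∁ bad ∣        ≡⟨ cong (p ∸ 1 ∸_) (Sub.∣∁p∣≡n∸∣p∣ bad) ⟩
        p ∸ 1 ∸ (p ∸ 1 ∸ Sub.∣ bad ∣)    ≡⟨ m∸[m∸n]≡n (Sub.∣p∣≤n bad) ⟩
        Sub.∣ bad ∣                      ≤⟨ ∣⋃∣≤ n (λ h → ∣⋃∣≤ n λ t → ∣misleading∣≤ t (suc h ⊓ n) (m⊓n≤n (suc h) n)) ⟩
        n * (n * n)                      ∎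
        where open ≤-Reasoning
      reliable : ∀ i → i Sub.∈ Sub.∁ bad → ∀ {t h} → t < h → h ≤ n → palindromeTest p (suc (toℕ i)) T t h ≡ true → Mirrored t h
      reliable i i∈G {t} {suc h} t<h h<n test with List.≡-dec Fin._≟_ (segment T t (suc h)) (reverse (segment T t (suc h))) in eq
      ... | yes same = same
      ... | no _     = contradiction (∈-⋃ n h<n (∈-⋃ n (<-≤-trans t<h h<n) is-misleading)) (Sub.x∈∁p⇒x∉p i∈G)
        where
        is-misleading : i Sub.∈ misleading t (suc h ⊓ n)
        is-misleading rewrite m≤n⇒m⊓n≡m h<n | eq = ∈-passing⁺ {t} {suc h} test

-- Palindromes and landmarks

module _ {σ : ℕ} (T : Text σ) where

  applyUpTo-cong : ∀ {A : Set} {f g : ℕ → A} n → (∀ i → i < n → f i ≡ g i) → applyUpTo f n ≡ applyUpTo g n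
  applyUpTo-cong zero    f≡g = refl
  applyUpTo-cong (suc n) f≡g = cong₂ _∷_ (f≡g 0 (s≤s z≤n)) (applyUpTo-cong n (λ i i<n → f≡g (suc i) (s≤s i<n)))

  applyUpTo-injective : ∀ {A : Set} {f g : ℕ → A} n → applyUpTo f n ≡ applyUpTo g n → ∀ i → i < n → f i ≡ g i
  applyUpTo-injective (suc n) eq zero    _         = List.∷-injectiveˡ eq
  applyUpTo-injective (suc n) eq (suc i) (s≤s i<n) = applyUpTo-injective n (List.∷-injectiveʳ eq) i i<n

  reverse-as-applyUpTo : ∀ {A : Set} (f : ℕ → A) n → reverse (applyUpTo f n) ≡ applyUpTo (λ i → f (n ∸ suc i)) n
  reverse-as-applyUpTo f n = trans (List.reverse-applyUpTo f n) (downFrom f n)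
    where
    downFrom : ∀ {A : Set} (f : ℕ → A) n → applyDownFrom f n ≡ applyUpTo (λ i → f (n ∸ suc i)) n
    downFrom f zero    = refl
    downFrom f (suc n) = cong (f n ∷_) (downFrom f n)

  reverse-segment : ∀ t h → reverse (segment T t h) ≡ applyUpTo (λ i → T (suc t + (h ∸ t ∸ suc i))) (h ∸ t)
  reverse-segment t h = trans (cong reverse (segment-applyUpTo T t h)) (reverse-as-applyUpTo (λ i → T (suc t + i)) (h ∸ t))

  -- The even palindrome of radius r around c = t + r + 1 is T[t+1..t+2r].
  module _ (t r : ℕ) where

    private
      mirror : ∀ i → T (suc t + r + i) ≡ T (suc t + r ∸ suc i) → i < r →
               T (suc t + (r + i)) ≡ T (suc t + (r + r ∸ suc (r + i)))
      mirror i eq i<r = trans (cong T (sym (+-assoc (suc t) r i))) (trans eq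
        (cong T (trans (+-∸-assoc (suc t) i<r) (cong (suc t +_) (trans (sym ([m+n]∸[m+o]≡n∸o r r (suc i))) (cong (r + r ∸_) (+-suc r i)))))))

    mirrored⇒palindrome : segment T t (t + (r + r)) ≡ reverse (segment T t (t + (r + r))) →
                          EvenPalindrome T (t + (r + r)) (suc t + r) r
    mirrored⇒palindrome eq = s≤s (m≤n+m r t) , ≤-reflexive (cong suc (+-assoc t r r)) , λ i i<r → begin
      T (suc t + r + i)                           ≡⟨ cong T (+-assoc (suc t) r i) ⟩
      T (suc t + (r + i))                         ≡⟨ pointwise (r + i) (+-monoʳ-< r i<r) ⟩
      T (suc t + (r + r ∸ suc (r + i)))           ≡⟨ cong (λ k → T (suc t + (r + r ∸ k))) (+-suc r i) ⟨
      T (suc t + (r + r ∸ (r + suc i)))           ≡⟨ cong (λ k → T (suc t + k)) ([m+n]∸[m+o]≡n∸o r r (suc i)) ⟩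
      T (suc t + (r ∸ suc i))                     ≡⟨ cong T (+-∸-assoc (suc t) i<r) ⟨
      T (suc t + r ∸ suc i)                       ∎
      where
      open ≡-Reasoning
      pointwise : ∀ i → i < r + r → T (suc t + i) ≡ T (suc t + (r + r ∸ suc i))
      pointwise = subst (λ d → ∀ i → i < d → T (suc t + i) ≡ T (suc t + (d ∸ suc i))) (m+n∸m≡n t (r + r))
        (applyUpTo-injective (t + (r + r) ∸ t) (trans (sym (segment-applyUpTo T t (t + (r + r)))) (trans eq (reverse-segment t (t + (r + r))))))

    palindrome⇒mirrored : (∀ i → i < r → T (suc t + r + i) ≡ T (suc t + r ∸ suc i)) →
                          segment T t (t + (r + r)) ≡ reverse (segment T t (t + (r + r)))
    palindrome⇒mirrored pal = trans (segment-applyUpTo T t (t + (r + r))) (trans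
      (applyUpTo-cong (t + (r + r) ∸ t)
        (subst (λ d → ∀ i → i < d → T (suc t + i) ≡ T (suc t + (d ∸ suc i))) (sym (m+n∸m≡n t (r + r))) pointwise))
      (sym (reverse-segment t (t + (r + r)))))
      where
      upper : ∀ i → i < r → T (suc t + (r + i)) ≡ T (suc t + (r + r ∸ suc (r + i)))
      upper i i<r = mirror i (pal i i<r) i<r
      pointwise : ∀ i → i < r + r → T (suc t + i) ≡ T (suc t + (r + r ∸ suc i))
      pointwise i i<2r with r ≤? i
      ... | yes r≤i = subst (λ i → T (suc t + i) ≡ T (suc t + (r + r ∸ suc i))) (m+[n∸m]≡n r≤i)
                        (upper (i ∸ r) (+-cancelˡ-< r _ _ (subst (_< r + r) (sym (m+[n∸m]≡n r≤i)) i<2r)))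
      -- The lower half is the upper half read backwards: i is the mirror image of r + j for j = r -
      -- 1 - i.
      ... | no r≰i = begin
        T (suc t + i)                             ≡⟨ cong (λ k → T (suc t + k)) (m∸[m∸n]≡n (<⇒≤ i<r)) ⟨
        T (suc t + (r ∸ (r ∸ i)))                 ≡⟨ cong (λ k → T (suc t + (r ∸ k))) (+-∸-assoc 1 i<r) ⟩
        T (suc t + (r ∸ suc (r ∸ suc i)))         ≡⟨ cong (λ k → T (suc t + k)) (trans (sym ([m+n]∸[m+o]≡n∸o r r (suc j))) (cong (r + r ∸_) (+-suc r j))) ⟩
        T (suc t + (r + r ∸ suc (r + j)))         ≡⟨ upper j (∸-monoʳ-< {r} (s≤s z≤n) i<r) ⟨
        T (suc t + (r + j))                       ≡⟨ cong (λ k → T (suc t + k)) (+-∸-assoc r i<r) ⟨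
        T (suc t + (r + r ∸ suc i))               ∎
        where
        open ≡-Reasoning
        i<r : i < r
        i<r = ≰⇒> r≰i
        j : ℕ
        j = r ∸ suc i

  palindrome-grows : ∀ {h h′ c r} → h ≤ h′ → EvenPalindrome T h c r → EvenPalindrome T h′ c r
  palindrome-grows h≤h′ (r<c , c+r≤ , sym-T) = r<c , ≤-trans c+r≤ (s≤s h≤h′) , sym-T

  palindrome? : ∀ h c r → Dec (EvenPalindrome T h c r)
  palindrome? h c r = (r <? c) ×-dec (c + r ≤? suc h) ×-dec
    map′ (λ all i i<r → all i<r) (λ all {i} i<r → all i i<r) (allUpTo? (λ i → T (c + i) Fin.≟ T (c ∸ suc i)) r)

  greatest : ∀ {P : ℕ → Set} → (∀ r → Dec (P r)) → P 0 → ∀ b → ∃[ r ] P r × (∀ r′ → r′ ≤ b → P r′ → r′ ≤ r)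
  greatest P? p₀ zero    = 0 , p₀ , λ _ r′≤0 _ → r′≤0
  greatest P? p₀ (suc b) with P? (suc b)
  ... | yes p = suc b , p , λ _ r′≤ _ → r′≤
  ... | no ¬p with greatest P? p₀ b
  ...   | r , p , max = r , p , λ r′ r′≤ p′ → max r′ (≤-pred (≤∧≢⇒< r′≤ λ { refl → ¬p p′ })) p′

  Longest : (h R : ℕ) → Set
  Longest h R = (∃[ c ] EvenPalindrome T h c R) × (∀ c r → EvenPalindrome T h c r → r ≤ R)

  longest : ∀ h → ∃[ R ] Longest h R
  -- Radii up to h and centres up to h + 1 exhaust all palindromes, because r < c and c + r ≤ h + 1.
  -- The empty palindrome at centre 1 starts the search.
  longest h with greatest (λ r → anyUpTo? (λ c → palindrome? h c r) (suc (suc h)))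
                          (1 , s≤s (s≤s z≤n) , s≤s z≤n , s≤s z≤n , λ _ ()) h
  ... | R , (c , _ , pal) , max = R , (c , pal) , bounded
    where
    bounded : ∀ c r → EvenPalindrome T h c r → r ≤ R
    bounded c r pal@(r<c , c+r≤ , _) =
      max r (≤-pred (≤-trans (≤-trans r<c (m≤m+n c r)) c+r≤)) (c , s≤s (≤-trans (m≤m+n c r) c+r≤) , pal)

  longest⇒largest : ∀ {h R} → Longest h R → IsLargestRadius T h R
  longest⇒largest ((c , pal) , max) = (c , pal , λ r′ → max c r′) , λ c r (pal , _) → max c r pal

  module _ (p x : ℕ) (𝓛 : Landmarks) where

    answer-mono : ∀ {h h′} → h ≤ h′ → answer p x 𝓛 T h ≤ answer p x 𝓛 T h′
    answer-mono {h} {h′} h≤h′ = subst (λ k → answer p x 𝓛 T h ≤ answer p x 𝓛 T k) (m∸n+n≡m h≤h′) (later (h′ ∸ h))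
      where
      later : ∀ k → answer p x 𝓛 T h ≤ answer p x 𝓛 T (k + h)
      later zero    = ≤-refl
      later (suc k) = ≤-trans (later k) (Maximum.above (answer-maximum T p x 𝓛 (k + h)))

    -- The answer changes only when a process succeeds, and for a reliable base a success exhibits a
    -- genuine palindrome of that radius, which persists as the text grows. This is the source of ℓ
    -- ≤ R.
    answer-attained : ∀ {n} → (∀ {t h} → t < h → h ≤ n → palindromeTest p x T t h ≡ true → segment T t h ≡ reverse (segment T t h)) →
                      ∀ h → h ≤ n → ∃[ c ] EvenPalindrome T h c (answer p x 𝓛 T h)
    answer-attained reliable zero    _   = 1 , s≤s z≤n , s≤s z≤n , λ _ ()
    answer-attained reliable (suc h) h<n with answer p x 𝓛 T (suc h) | Maximum.attained (answer-maximum T p x 𝓛 h)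
    ... | _ | inj₁ refl with answer-attained reliable h (<⇒≤ h<n)
    ...   | c , pal = c , palindrome-grows (n≤1+n h) pal
    answer-attained reliable (suc h) h<n | _ | inj₂ (c , c≤ , (le , _ , test) , refl) =
      suc t + r , subst (λ k → EvenPalindrome T k (suc t + r) r) (sym h≡)
        (mirrored⇒palindrome t r (subst (λ k → segment T t k ≡ reverse (segment T t k)) h≡ (reliable t<h h<n test)))
      where
      t r : ℕ
      t = 2 * c ∸ suc h ∸ 2
      r = suc (suc h) ∸ c
      h≡ : suc h ≡ t + (r + r)
      h≡ = trans (split-at-centre c≤ le) (cong (λ k → t + (r + k)) (+-identityʳ r))
      t<h : t < suc h
      t<h = subst (t <_) (sym h≡) (m<m+n t (≤-trans (m<n⇒0<n∸m (s≤s c≤)) (m≤m+n r r)))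

    -- The palindrome of radius r ≤ R around c is verified at time c − 1 + r.
    answer-reaches : ∀ {h u R r} → EvenPalindrome T h (suc u) R → 1 ≤ r → r ≤ R → 𝓛 (u + r) (u ∸ r) ≡ true →
                     r ≤ answer p x 𝓛 T h
    answer-reaches {h} {u} {R} {suc r} (s≤s R≤u , c+R≤ , sym-T) _ r<R mark = ≤-trans
      (Maximum.bounds (answer-maximum T p x 𝓛 (u + r)) (suc r)
        (suc u , s≤s (m≤m+n u r) , subst (λ k → Active T p x 𝓛 k (suc u)) (+-suc u r) active , sym radius))
      (answer-mono (≤-trans (subst (_≤ u + R) (+-suc u r) (+-monoʳ-≤ u r<R)) (≤-pred c+R≤)))
      where
      k t : ℕ
      k = suc r
      t = u ∸ k
      k≤u : k ≤ u
      k≤u = ≤-trans r<R R≤u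
      t+k≡u : t + k ≡ u
      t+k≡u = m∸n+n≡m k≤u
      h≡ : u + k ≡ t + 2 * k
      h≡ = trans (cong (_+ k) (sym t+k≡u)) (trans (+-assoc t k k) (cong (λ z → t + (k + z)) (sym (+-identityʳ k))))
      radius : suc (suc (u + r)) ∸ suc u ≡ suc r
      radius = trans (cong (_∸ u) (sym (+-suc u r))) (m+n∸m≡n u (suc r))
      c≡ : suc (u + k) ∸ k ≡ suc u
      c≡ = m+n∸n≡m (suc u) k
      t≡ : 2 * suc u ∸ (u + k) ∸ 2 ≡ t
      t≡ = subst (λ c → 2 * c ∸ (u + k) ∸ 2 ≡ t) c≡ (proj₁ (centre (u + k) t k h≡))
      active : Active T p x 𝓛 (u + k) (suc u)
      active = subst (λ c → u + k + 2 ≤ 2 * c) c≡ (proj₂ (proj₂ (centre (u + k) t k h≡))) ,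
        subst (λ t → 𝓛 (u + k) t ≡ true) (sym t≡) mark ,
        subst (λ t → palindromeTest p x T t (u + k) ≡ true) (sym t≡) test
        where
        mirrored : segment T t (u + k) ≡ reverse (segment T t (u + k))
        mirrored = subst (λ h → segment T t h ≡ reverse (segment T t h)) (sym (trans h≡ (cong (λ z → t + (k + z)) (+-identityʳ k))))
          (palindrome⇒mirrored t k (subst (λ c → ∀ i → i < k → T (c + i) ≡ T (c ∸ suc i)) (cong suc (sym t+k≡u)) (λ i i<k → sym-T i (<-≤-trans i<k r<R))))
        test : palindromeTest p x T t (u + k) ≡ true
        test = trans (cong (fingerprint p x (segment T t (u + k)) ≡ᵇ_) (cong (fingerprint p x) (sym mirrored)))
                 (≡ᵇ-refl (fingerprint p x (segment T t (u + k))))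

-- Lifetime of landmarks in the circular buffers

div₀≡/ : ∀ {g} .{{_ : NonZero g}} a → a div₀ g ≡ a / g
div₀≡/ {suc g} a = refl

-- Two multiples of g less than Q g apart never share a slot.
latest-multiple : ∀ {g Q i} h .{{_ : NonZero g}} .{{_ : NonZero Q}} → i * g ≤ h → h < i * g + Q * g →
                  latest g Q (i % Q) h ≡ i * g
latest-multiple {g} {Q} {i} zero    ig≤ _ = sym (n≤0⇒n≡0 ig≤)
latest-multiple {g} {Q} {i} (suc h) ig≤ h< with i * g ≟ suc h
... | yes ig≡ = trans (latest-now divisible slot) (sym ig≡)
  where
  latest-now : (suc h mod₀ g ≡ᵇ 0) ≡ true → ((suc h div₀ g) mod₀ Q ≡ᵇ i % Q) ≡ true → latest g Q (i % Q) (suc h) ≡ suc h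
  latest-now eq₁ eq₂ rewrite eq₁ | eq₂ = refl
  divisible : (suc h mod₀ g ≡ᵇ 0) ≡ true
  divisible = cong (_≡ᵇ 0) (trans (mod₀≡% {g} (suc h)) (trans (cong (_% g) (sym ig≡)) (m*n%n≡0 i g)))
  slot : ((suc h div₀ g) mod₀ Q ≡ᵇ i % Q) ≡ true
  slot = trans (cong (λ k → k mod₀ Q ≡ᵇ i % Q) (trans (div₀≡/ {g} (suc h)) (trans (cong (_/ g) (sym ig≡)) (m*n/n≡m i g))))
           (trans (cong (_≡ᵇ i % Q) (mod₀≡% {Q} i)) (≡ᵇ-refl (i % Q)))
... | no ig≢ with suc h mod₀ g ≡ᵇ 0 in eq₁ | (suc h div₀ g) mod₀ Q ≡ᵇ i % Q in eq₂
...   | false | _     = latest-multiple {i = i} h (≤-pred (≤∧≢⇒< ig≤ ig≢)) (<-trans (n<1+n h) h<)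
...   | true  | false = latest-multiple {i = i} h (≤-pred (≤∧≢⇒< ig≤ ig≢)) (<-trans (n<1+n h) h<)
...   | true  | true  = contradiction (∣⇒≤ {{>-nonZero (m<n⇒0<n∸m i<j)}} (subst (Q ∣_) (m≤n⇒∣n-m∣≡n∸m (<⇒≤ i<j)) (%≡⇒∣ {Q} {j} {i} j%Q≡))) (<⇒≱ j∸i<Q)
  where
  j : ℕ
  j = suc h / g
  jg≡ : j * g ≡ suc h
  jg≡ = m/n*n≡m (m%n≡0⇒n∣m (suc h) g (trans (sym (mod₀≡% {g} (suc h))) (≡ᵇ-sound _ 0 eq₁)))
  j%Q≡ : j % Q ≡ i % Q
  j%Q≡ = trans (sym (mod₀≡% {Q} j)) (trans (cong (_mod₀ Q) (sym (div₀≡/ {g} (suc h)))) (≡ᵇ-sound _ (i % Q) eq₂))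
  i<j : i < j
  i<j = *-cancelʳ-< g i j (subst (i * g <_) (sym jg≡) (≤∧≢⇒< ig≤ ig≢))
  j<i+Q : j < i + Q
  j<i+Q = *-cancelʳ-< g j (i + Q) (subst₂ _<_ (sym jg≡) (sym (*-distribʳ-+ g i Q)) h<)
  j∸i<Q : j ∸ i < Q
  j∸i<Q = subst (j ∸ i <_) (m+n∸m≡n i Q) (∸-monoˡ-< j<i+Q (<⇒≤ i<j))

multiple-isLandmark : ∀ {g Q gs h t} → g ∈ gs → 0 < g → 0 < Q → g ∣ t → t ≤ h → h < t + Q * g → isLandmark Q gs h t ≡ true
multiple-isLandmark {g} {Q} {g ∷ gs} {h} (here refl) 0<g 0<Q (divides i refl) t≤h h<
  rewrite anyBelow-complete Q (λ s → latest g Q s h ≡ᵇ i * g) {_%_ i Q {{>-nonZero 0<Q}}} (m%n<n i Q {{>-nonZero 0<Q}})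
            (trans (cong (_≡ᵇ i * g) (latest-multiple {g} {Q} {i} h {{>-nonZero 0<g}} {{>-nonZero 0<Q}} t≤h h<)) (≡ᵇ-refl (i * g))) = refl
multiple-isLandmark {Q = Q} {g′ ∷ gs} {h} {t} (there g∈) 0<g 0<Q g∣t t≤h h<
  rewrite multiple-isLandmark {Q = Q} {gs} {h} {t} g∈ 0<g 0<Q g∣t t≤h h< = Bool.∨-zeroʳ (onLevel g′ Q h t)

-- Round u - m up to a multiple t of g and take r = u - t. The rounding costs less than g, and g ≤ m
-- leaves a positive radius.
multiple-in-window : ∀ {g u m} → 0 < g → g ≤ m → m ≤ u → ∃[ r ] 1 ≤ r × r ≤ m × m < r + g × g ∣ u ∸ r
multiple-in-window {suc g} {u} {m} _ g≤m m≤u = u ∸ t , m<n⇒0<n∸m t<u , r≤m , m<r+g , subst (suc g ∣_) (sym (m∸[m∸n]≡n (<⇒≤ t<u))) (n∣m*n q)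
  where
  a q t : ℕ
  a = u ∸ m
  -- The spacing is `suc g`, so this is the quotient of a by the spacing, rounded up.
  q = (a + g) / suc g
  t = q * suc g
  a+m≡u : a + m ≡ u
  a+m≡u = m∸n+n≡m m≤u
  t≤a+g : t ≤ a + g
  t≤a+g = m/n*n≤m (a + g) (suc g)
  t<u : t < u
  t<u = ≤-<-trans t≤a+g (subst (a + g <_) a+m≡u (+-monoʳ-< a g≤m))
  a≤t : a ≤ t
  a≤t = +-cancelʳ-≤ g a t (≤-trans (≤-reflexive (m≡m%n+[m/n]*n (a + g) (suc g)))
          (subst (_≤ t + g) (+-comm t ((a + g) % suc g)) (+-monoʳ-≤ t (≤-pred (m%n<n (a + g) (suc g))))))
  r≤m : u ∸ t ≤ m
  r≤m = subst (u ∸ t ≤_) (m∸[m∸n]≡n m≤u) (∸-monoʳ-≤ u a≤t)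
  m<r+g : m < u ∸ t + suc g
  m<r+g = +-cancelˡ-< a m (u ∸ t + suc g) (begin-strict
    a + m                      ≡⟨ a+m≡u ⟩
    u                          ≡⟨ m+[n∸m]≡n (<⇒≤ t<u) ⟨
    t + (u ∸ t)                ≤⟨ +-monoˡ-≤ (u ∸ t) t≤a+g ⟩
    a + g + (u ∸ t)            <⟨ n<1+n _ ⟩
    suc (a + g + (u ∸ t))      ≡⟨ eq a g (u ∸ t) ⟩
    a + (u ∸ t + suc g)        ∎)
    where
    open ≤-Reasoning
    eq : ∀ a g r → suc (a + g + r) ≡ a + (r + suc g)
    eq = solve-∀

-- Here m is the radius aimed at. It may be smaller than R, because a palindrome contains all those
-- of smaller radius around the same centre; a smaller m shortens the time for which the buffer has
-- to remember u - r.
answer-window : ∀ {σ} (T : Text σ) p x Q gs {g h u R m} → EvenPalindrome T h (suc u) R → m ≤ R → g ∈ gs → 0 < g → 0 < Q →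
                g ≤ m → (∀ r → r ≤ m → u + r < (u ∸ r) + Q * g) →
                ∃[ r ] m < r + g × r ≤ answer p x (isLandmark Q gs) T h
answer-window T p x Q gs {g} {h} {u} {R} {m} pal@(s≤s R≤u , _) m≤R g∈ 0<g 0<Q g≤m recent
  with multiple-in-window {g} {u} {m} 0<g g≤m (≤-trans m≤R R≤u)
... | r , 1≤r , r≤m , m<r+g , g∣t = r , m<r+g ,
  answer-reaches T p x (isLandmark Q gs) pal 1≤r (≤-trans r≤m m≤R)
    (multiple-isLandmark {gs = gs} g∈ 0<g 0<Q g∣t (≤-trans (m∸n≤m u r) (m≤m+n u r)) (recent r r≤m))

-- Assembling an approximation scheme

n≤2^⌈log₂n⌉ : ∀ n → n ≤ 2 ^ ⌈log₂ n ⌉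
n≤2^⌈log₂n⌉ n = <-rec (λ n → n ≤ 2 ^ ⌈log₂ n ⌉) step n
  where
  step : ∀ n → (∀ {m} → m < n → m ≤ 2 ^ ⌈log₂ m ⌉) → n ≤ 2 ^ ⌈log₂ n ⌉
  step 0 _ = z≤n
  step 1 _ = s≤s z≤n
  step n@(suc (suc n′)) rec = begin
    n                                    ≡⟨ ⌊n/2⌋+⌈n/2⌉≡n n ⟨
    ⌊ n /2⌋ + ⌈ n /2⌉                    ≤⟨ +-monoˡ-≤ ⌈ n /2⌉ (⌊n/2⌋≤⌈n/2⌉ n) ⟩
    ⌈ n /2⌉ + ⌈ n /2⌉                    ≡⟨ cong (⌈ n /2⌉ +_) (+-identityʳ ⌈ n /2⌉) ⟨
    2 * ⌈ n /2⌉                          ≤⟨ *-monoʳ-≤ 2 (rec (⌈n/2⌉<n n′)) ⟩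
    2 * 2 ^ ⌈log₂ ⌈ n /2⌉ ⌉              ≡⟨ cong (λ k → 2 * 2 ^ k) (⌈log₂⌈n/2⌉⌉≡⌈log₂n⌉∸1 n) ⟩
    2 ^ suc (⌈log₂ n ⌉ ∸ 1)              ≡⟨ cong (2 ^_) (m+[n∸m]≡n (⌈log₂⌉-mono-≤ {2} {n} (s≤s (s≤s z≤n)))) ⟩
    2 ^ ⌈log₂ n ⌉                        ∎
    where open ≤-Reasoning

zero-mod : ∀ p → 0 mod₀ p ≡ 0
zero-mod zero    = refl
zero-mod (suc p) = refl

length-levels≤ : ∀ b L f g → length (levels b L f g) ≤ f
length-levels≤ b L zero    g = z≤n
length-levels≤ b L (suc f) g with g <ᵇ L + 1
... | true  = s≤s (length-levels≤ b L f (g * b))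
... | false = z≤n

level₀∈ : ∀ {b L} f {g} → g ≤ L → g ∈ levels b L (suc f) g
level₀∈ {b} {L} f {g} g≤L with g <ᵇ L + 1 in eq
... | true  = here refl
... | false = ⊥-elim (subst Bool.T eq (<⇒<ᵇ (subst (g <_) (+-comm 1 L) (s≤s g≤L))))

stepTime-bound : ∀ setup len Q → 1 ≤ len → 1 ≤ Q →
  time setup + (time advance + (len * (guardTime + levelTime Q) + guardTime)) ≤
  (time setup + time advance + guardTime + (guardTime + levelTime 1)) * (len * Q)
stepTime-bound setup (suc l) (suc q) _ _ =
  subst (time setup + (time advance + (suc l * (guardTime + levelTime (suc q)) + guardTime)) ≤_)
    (eq (time setup) (time advance) guardTime (time writeSlot) (time (store (lit 16) (reg 13))) visitTime (time (store (lit 11) (reg 11 · reg 12))) l q)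
    (m≤m+n _ _)
  where
  -- The summand after the time is the exact slack of the inequality, written out so that the claim
  -- becomes a polynomial identity in l = len - 1 and q = Q - 1.
  eq : ∀ s a g w c v d l q →
       s + (a + (suc l * (g + (w + (c + ((suc q * v + 3) + d)))) + g)) + ((s + a + g) * (l + q + l * q) + suc l * q * (g + (w + (c + (3 + d))))) ≡
       (s + a + g + (g + (w + (c + ((1 * v + 3) + d))))) * (suc l * suc q)
  eq = solve-∀

-- A choice of the first spacing g, the ratio b, the number Q of slots per level and
-- the largest spacing L, with a command that computes them.
record Scheme (V : Variant) : Set₁ where
  open Variant V
  field
    g b Q L : ℕ → ℚᵘ → ℕ
    setup   : Cmd
    factor  : ℕ → ℕ

  spacings : ℕ → ℚᵘ → List ℕ
  spacings n e = levels (b n e) (L n e) (suc (L n e)) (g n e)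

  marks : ℕ → ℚᵘ → Landmarks
  marks n e = isLandmark (Q n e) (spacings n e)

  field
    correct : ∀ n .{{_ : NonZero n}} e → InRange n e →
      0 < g n e × g n e ≤ L n e × 2 ≤ b n e × b n e ≤ 3 * n × 0 < Q n e × Q n e ≤ 16 * n × L n e ≤ 2 * n
    approximates : ∀ n .{{_ : NonZero n}} e → InRange n e → ∀ {σ} (T : Text σ) p x h {R} → h ≤ n → Longest T h R →
      answer p x (marks n e) T h ≤ R → Approx e (answer p x (marks n e) T h) R
    bounded : ∀ n .{{_ : NonZero n}} e → InRange n e → ∀ X {s} →
      s ≤ X * (length (spacings n e) * Q n e) → Bound (factor X) n e s
    setup-run : ∀ n .{{_ : NonZero n}} e → InRange n e → ∀ {w S} (32<2^w : 32 < 2 ^ w) →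
      16 * n < 2 ^ w → ℤ.∣ ↥ e ∣ < 2 ^ w → ↧ₙ e < 2 ^ w → 17 ≤ S → ∀ m → m 2 ≡ n → m 3 ≡ ℤ.∣ ↥ e ∣ → m 4 ≡ ↧ₙ e →
      RAM.Run w S 32<2^w setup m (time setup) λ m′ →
        m′ 11 ≡ g n e × m′ 12 ≡ b n e × m′ 13 ≡ Q n e × m′ 14 ≡ L n e × (∀ i → isSetup i ≡ false → m′ i ≡ m i)

module Achieves {V : Variant} (scheme : Scheme V) where

  open Variant V
  open Scheme scheme

  -- One constant serves both resources: the step time is at most X per slot, and so is the memory,
  -- since 21 words per slot suffice and X ≥ 21.
  X : ℕ
  X = time setup + time advance + guardTime + (guardTime + levelTime 1)

  -- Origin of the exponents: nᶜ n³ ≤ p - 1 requires p to exceed M^(3 + c), which M^(4 + c) ≤ p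
  -- guarantees as M ≥ 2. Then D = M^(5 + c) bounds p, the characters and the parameters of the
  -- scheme, and 4 D² ≤ M^(2 (5 + c) + 2) ≤ 2ʷ dictates the word length.
  module _ (c n σ : ℕ) .{{_ : NonZero n}} (e : ℚᵘ) (inRange : InRange n e) (p w : ℕ) (p-prime : Prime p)
           (M^a≤p : (n ⊔ σ ⊔ 2) ^ (4 + c) ≤ p) (p≤M^1+a : p ≤ (n ⊔ σ ⊔ 2) ^ (5 + c))
           (word-long : (2 * (5 + c) + 2) * ⌈log₂ (n ⊔ σ ⊔ 2) ⌉ ≤ w) where

    M D : ℕ
    M = n ⊔ σ ⊔ 2
    D = M ^ (5 + c)

    2≤M : 2 ≤ M
    2≤M = m≤n⊔m (n ⊔ σ) 2

    n≤M : n ≤ M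
    n≤M = ≤-trans (m≤m⊔n n σ) (m≤m⊔n (n ⊔ σ) 2)

    σ≤M : σ ≤ M
    σ≤M = ≤-trans (m≤n⊔m n σ) (m≤m⊔n (n ⊔ σ) 2)

    instance
      M≢0 : NonZero M
      M≢0 = >-nonZero (≤-trans (s≤s z≤n) 2≤M)

    n≥1 : 1 ≤ n
    n≥1 = >-nonZero⁻¹ n

    power-≤ : ∀ {i j} → i ≤ j → M ^ i ≤ M ^ j
    power-≤ = ^-monoʳ-≤ M

    2^i*M : ∀ i {k} → i ≤ 4 + c → k ≤ 2 ^ i * n → k ≤ D
    2^i*M i {k} i≤ k≤ = begin
      k             ≤⟨ k≤ ⟩
      2 ^ i * n     ≤⟨ *-mono-≤ (^-monoˡ-≤ i 2≤M) n≤M ⟩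
      M ^ i * M     ≡⟨ *-comm (M ^ i) M ⟩
      M ^ suc i     ≤⟨ power-≤ (s≤s i≤) ⟩
      D             ∎
      where open ≤-Reasoning

    16n≤D : 16 * n ≤ D
    16n≤D = 2^i*M 4 (m≤m+n 4 c) ≤-refl

    n≤D : n ≤ D
    n≤D = 2^i*M 0 z≤n (≤-reflexive (sym (+-identityʳ n)))

    M≤D : M ≤ D
    M≤D = subst (_≤ D) (*-identityʳ M) (power-≤ {1} {5 + c} (s≤s z≤n))

    32≤D : 32 ≤ D
    32≤D = ≤-trans (^-monoˡ-≤ 5 2≤M) (power-≤ (m≤m+n 5 c))

    4D²≤2^w : 4 * (D * D) ≤ 2 ^ w
    4D²≤2^w = begin
      4 * (D * D)                            ≤⟨ *-monoˡ-≤ (D * D) (^-monoˡ-≤ 2 2≤M) ⟩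
      M ^ 2 * (D * D)                        ≡⟨ cong (M ^ 2 *_) (^-distribˡ-+-* M (5 + c) (5 + c)) ⟨
      M ^ 2 * M ^ (5 + c + (5 + c))          ≡⟨ ^-distribˡ-+-* M 2 (5 + c + (5 + c)) ⟨
      M ^ (2 + (5 + c + (5 + c)))            ≡⟨ cong (M ^_) (eq c) ⟩
      M ^ k                                  ≤⟨ ^-monoˡ-≤ k (n≤2^⌈log₂n⌉ M) ⟩
      (2 ^ ⌈log₂ M ⌉) ^ k                    ≡⟨ ^-*-assoc 2 ⌈log₂ M ⌉ k ⟩
      2 ^ (⌈log₂ M ⌉ * k)                    ≡⟨ cong (2 ^_) (*-comm ⌈log₂ M ⌉ k) ⟩
      2 ^ (k * ⌈log₂ M ⌉)                    ≤⟨ ^-monoʳ-≤ 2 word-long ⟩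
      2 ^ w                                  ∎
      where
      open ≤-Reasoning
      k = 2 * (5 + c) + 2
      eq : ∀ c → 2 + (5 + c + (5 + c)) ≡ 2 * (5 + c) + 2
      eq = solve-∀

    D²<2^w : D * D < 2 ^ w
    D²<2^w = <-≤-trans (subst (D * D <_) (*-comm (D * D) 4) (m<m*n (D * D) 4 {{m*n≢0 D D {{D≢0}} {{D≢0}}}} (s≤s (s≤s z≤n)))) 4D²≤2^w
      where
      D≢0 : NonZero D
      D≢0 = m^n≢0 M (5 + c)

    D<2^w : D < 2 ^ w
    D<2^w = ≤-<-trans (m≤m*n D D {{m^n≢0 M (5 + c)}}) D²<2^w

    params = correct n e inRange
    0<g = proj₁ params
    g≤L = proj₁ (proj₂ params)
    2≤b = proj₁ (proj₂ (proj₂ params))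
    b≤3n = proj₁ (proj₂ (proj₂ (proj₂ params)))
    0<Q = proj₁ (proj₂ (proj₂ (proj₂ (proj₂ params))))
    Q≤16n = proj₁ (proj₂ (proj₂ (proj₂ (proj₂ (proj₂ params)))))
    L≤2n = proj₂ (proj₂ (proj₂ (proj₂ (proj₂ (proj₂ params)))))

    ls : List ℕ
    ls = spacings n e

    1≤len : 1 ≤ length ls
    1≤len with levels (b n e) (L n e) (suc (L n e)) (g n e) | level₀∈ {b n e} (L n e) g≤L
    ... | _ ∷ _ | _ = s≤s z≤n

    S : ℕ
    S = 17 + length ls * (Q n e * 4)

    len≤3n : length ls ≤ 3 * n
    len≤3n = ≤-trans (length-levels≤ (b n e) (L n e) (suc (L n e)) (g n e)) (≤-trans (s≤s L≤2n) (+-mono-≤ n≥1 ≤-refl))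

    S<2^w : S < 2 ^ w
    S<2^w = ≤-<-trans (begin
      17 + length ls * (Q n e * 4)          ≤⟨ +-mono-≤ (*-monoʳ-≤ 17 (*-mono-≤ n≥1 n≥1)) (*-mono-≤ len≤3n (*-monoˡ-≤ 4 Q≤16n)) ⟩
      17 * (n * n) + 3 * n * (16 * n * 4)   ≡⟨ eq n ⟩
      209 * (n * n)                         ≤⟨ *-monoˡ-≤ (n * n) (m≤m+n 209 47) ⟩
      256 * (n * n)                         ≡⟨ eq₂ n ⟩
      16 * n * (16 * n)                     ≤⟨ *-mono-≤ 16n≤D 16n≤D ⟩
      D * D                                 ∎) D²<2^w
      where
      open ≤-Reasoning
      eq : ∀ n → 17 * (n * n) + 3 * n * (16 * n * 4) ≡ 209 * (n * n)
      eq = solve-∀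
      eq₂ : ∀ n → 256 * (n * n) ≡ 16 * n * (16 * n)
      eq₂ = solve-∀

    S≤ : S ≤ X * (length ls * Q n e)
    S≤ = begin
      17 + length ls * (Q n e * 4)                   ≤⟨ +-monoˡ-≤ _ (*-monoʳ-≤ 17 (*-mono-≤ 1≤len 0<Q)) ⟩
      17 * (length ls * Q n e) + length ls * (Q n e * 4) ≡⟨ eq (length ls) (Q n e) ⟩
      21 * (length ls * Q n e)                       ≤⟨ *-monoˡ-≤ (length ls * Q n e) 21≤X ⟩
      X * (length ls * Q n e)                        ∎
      where
      open ≤-Reasoning
      eq : ∀ l q → 17 * (l * q) + l * (q * 4) ≡ 21 * (l * q)
      eq = solve-∀
      21≤X : 21 ≤ X
      21≤X = ≤-trans (≤ᵇ⇒≤ 21 (guardTime + levelTime 1) tt) (m≤n+m _ (time setup + time advance + guardTime))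

    p>0 : 0 < p
    p>0 = >-nonZero⁻¹ p {{prime⇒nonZero p-prime}}

    n^c-bound : n ^ c * (n * (n * n)) ≤ p ∸ 1
    n^c-bound = begin
      n ^ c * (n * (n * n))                  ≡⟨ cong (λ k → n ^ c * (n * (n * k))) (*-identityʳ n) ⟨
      n ^ c * n ^ 3                          ≡⟨ ^-distribˡ-+-* n c 3 ⟨
      n ^ (c + 3)                            ≡⟨ cong (n ^_) (+-comm c 3) ⟩
      n ^ (3 + c)                            ≤⟨ ^-monoˡ-≤ (3 + c) n≤M ⟩
      M ^ (3 + c)                            ≤⟨ ≤-pred (begin
        suc (M ^ (3 + c))                      ≤⟨ m<m*n (M ^ (3 + c)) M {{m^n≢0 M (3 + c)}} 2≤M ⟩
        M ^ (3 + c) * M                        ≡⟨ *-comm (M ^ (3 + c)) M ⟩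
        M ^ (4 + c)                            ≤⟨ M^a≤p ⟩
        p                                      ≡⟨ m+[n∸m]≡n p>0 ⟨
        suc (p ∸ 1)                            ∎) ⟩
      p ∸ 1                                  ∎
      where open ≤-Reasoning

    σ≤p : σ ≤ p
    σ≤p = ≤-trans σ≤M (≤-trans (subst (_≤ M ^ (4 + c)) (*-identityʳ M) (power-≤ {1} {4 + c} (s≤s z≤n))) M^a≤p)

    probable : (T : Text σ) → HighProbability c n p λ x → ∀ h → 1 ≤ h → h ≤ n →
               ∃[ R ] IsLargestRadius T h R × Approx e (answer p x (marks n e) T h) R
    probable T with Roots.reliable-bases p p-prime T σ≤p n
    ... | G , few , reliable = G , event , ≤-trans (*-monoʳ-≤ (n ^ c) few) n^c-bound
      where
      event : ∀ i → i Sub.∈ G → ∀ h → 1 ≤ h → h ≤ n →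
              ∃[ R ] IsLargestRadius T h R × Approx e (answer p (suc (toℕ i)) (marks n e) T h) R
      event i i∈G h _ h≤n with longest T h
      ... | R , long with answer-attained T p (suc (toℕ i)) (marks n e) {n} (reliable i i∈G) h h≤n
      ...   | c , pal = R , longest⇒largest T long ,
                approximates n e inRange T p (suc (toℕ i)) h h≤n long (proj₂ long c _ pal)

    implements : ℤ.∣ ↥ e ∣ < 2 ^ w → ↧ₙ e < 2 ^ w → (T : Text σ) (x : ℕ) → 1 ≤ x → x < p →
                 Implements w S (streamProgram setup) (Bound (factor X) n e) n e p x (marks n e) T
    implements num-fits den-fits T x 1≤x x<p h 1≤h h≤n = finish (stream-run setup-correct in-time h h≤n)
      where
      open Fingerprints T p x p-prime
      p∤x : ¬ p ∣ x
      p∤x p∣x = <⇒≱ x<p (∣⇒≤ {{>-nonZero 1≤x}} p∣x)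
      Y<p : ∀ t → Y t < p
      Y<p zero    = p>0
      Y<p (suc t) = mod₀-< _ p>0
      open Stream T w S p x n D F R Y p>0 p≤M^1+a (≤-trans (<⇒≤ x<p) p≤M^1+a) n≤D 32≤D 4D²≤2^w S<2^w (m≤m+n 17 _)
        (λ t → mod₀-< _ p>0) (λ t → mod₀-< _ p>0) Y<p (zero-mod p) (zero-mod p) refl
        (λ t → ≤-trans (<⇒≤ (Fin.toℕ<n (T t))) (≤-trans σ≤M M≤D)) (λ _ → refl) F-suc R-suc
        e (g n e) (b n e) (Q n e) (L n e) 0<Q 0<g 2≤b (≤-trans b≤3n (2^i*M 2 (s≤s (s≤s z≤n)) (*-monoˡ-≤ n (n≤1+n 3))))
        (<-≤-trans (s≤s L≤2n) (2^i*M 2 (s≤s (s≤s z≤n)) (≤-trans (+-mono-≤ n≥1 ≤-refl) (*-monoˡ-≤ n (n≤1+n 3))))) ≤-refl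
        using (SetupCorrect; Reached; Invariant; module Invariant; stream-run; stepTime; fingerprints-stored)
      setup-correct : SetupCorrect setup
      setup-correct = setup-run n e inRange (≤-<-trans 32≤D D<2^w) (≤-<-trans 16n≤D D<2^w) num-fits den-fits (m≤m+n 17 _)
      in-time : ∀ τ → τ ≤ stepTime setup → Bound (factor X) n e τ
      in-time τ τ≤ = bounded n e inRange X (≤-trans τ≤ (stepTime-bound setup (length ls) (Q n e) 1≤len 0<Q))
      finish : Reached setup (Bound (factor X) n e) h → _
      finish (m , reach , inv) = m , reach ,
        trans (Invariant.r1 inv) (reported≡answer T p x p-prime p∤x (Q n e) ls h) , fingerprints-stored (λ _ → refl) inv

  achieves : BasicAlgorithmAchieves V
  achieves = marks , (λ n e → isLandmark-admissible (Q n e) (spacings n e)) , λ c d →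
    streamProgram setup , factor X , 4 + c , 2 * (5 + c) + 2 , exponent c ,
    λ n σ e p w inRange _ p-prime M^a≤p p≤M^1+a word-long num-fits den-fits →
      probable c n σ e inRange p w p-prime M^a≤p p≤M^1+a word-long ,
      S c n σ e inRange p w p-prime M^a≤p p≤M^1+a word-long ,
      m≤m+n 7 _ ,
      bounded n e inRange X (S≤ c n σ e inRange p w p-prime M^a≤p p≤M^1+a word-long) ,
      implements c n σ e inRange p w p-prime M^a≤p p≤M^1+a word-long num-fits den-fits
    where
    exponent : ∀ c → suc (4 + c) < 2 * (5 + c) + 2
    exponent c = subst (suc (4 + c) <_) (eq c) (m≤m+n (6 + c) (6 + c))
      where
      eq : ∀ c → 6 + c + (6 + c) ≡ 2 * (5 + c) + 2
      eq = solve-∀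

-- Rational bounds

-- Numerator and denominator are tracked without normalisation: sums, products and powers follow the
-- schoolbook formulas, and inequalities become cross-multiplied inequalities in ℕ.
record Fraction (q : ℚᵘ) (a b : ℕ) : Set where
  constructor fraction
  field
    numerator≡   : ↥ q ≡ ℤ.+ a
    denominator≡ : ↧ₙ q ≡ b

fraction-fromℕ : ∀ k → Fraction (fromℕ k) k 1
fraction-fromℕ k = fraction refl refl

fraction-+ : ∀ {q r a b c d} → Fraction q a b → Fraction r c d → Fraction (q ℚ.+ r) (a * d + c * b) (b * d)
fraction-+ {mkℚᵘ _ b} {mkℚᵘ _ d} {a} {c = c} (fraction refl refl) (fraction refl refl) =
  fraction (cong₂ ℤ._+_ (sym (ℤ.pos-* a (suc d))) (sym (ℤ.pos-* c (suc b)))) refl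

fraction-* : ∀ {q r a b c d} → Fraction q a b → Fraction r c d → Fraction (q ℚ.* r) (a * c) (b * d)
fraction-* {mkℚᵘ _ _} {mkℚᵘ _ _} {a} {c = c} (fraction refl refl) (fraction refl refl) = fraction (sym (ℤ.pos-* a c)) refl

fraction-^ : ∀ {q a b} k → Fraction q a b → Fraction (q ^ℚ k) (a ^ k) (b ^ k)
fraction-^ zero    f = fraction refl refl
fraction-^ (suc k) f = fraction-* f (fraction-^ k f)

fraction-≤ : ∀ {q r a b c d} → Fraction q a b → Fraction r c d → a * d ≤ c * b → q ℚ.≤ r
fraction-≤ {mkℚᵘ _ b} {mkℚᵘ _ d} {a} {c = c} (fraction refl refl) (fraction refl refl) le =
  ℚ.*≤* (subst₂ ℤ._≤_ (ℤ.pos-* a (suc d)) (ℤ.pos-* c (suc b)) (ℤ.+≤+ le))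

fraction-≤⁻ : ∀ {q r a b c d} → Fraction q a b → Fraction r c d → q ℚ.≤ r → a * d ≤ c * b
fraction-≤⁻ {mkℚᵘ _ b} {mkℚᵘ _ d} {a} {c = c} (fraction refl refl) (fraction refl refl) (ℚ.*≤* le) =
  ℤ.drop‿+≤+ (subst₂ ℤ._≤_ (sym (ℤ.pos-* a (suc d))) (sym (ℤ.pos-* c (suc b))) le)

-- A parameter above a non-negative fraction has a non-negative numerator, so the absolute value
-- found in the initial memory is the numerator itself.
fraction-above : ∀ {q a b} e → Fraction q a b → q ℚ.≤ e → Fraction e ℤ.∣ ↥ e ∣ (↧ₙ e)
fraction-above (mkℚᵘ (ℤ.+ u) d) _ _ = fraction refl refl
fraction-above {mkℚᵘ _ _} {zero}  (mkℚᵘ ℤ.-[1+ k ] d) (fraction refl refl) (ℚ.*≤* ())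
fraction-above {mkℚᵘ _ _} {suc a} (mkℚᵘ ℤ.-[1+ k ] d) (fraction refl refl) (ℚ.*≤* ())

fraction-/ : ∀ a n .{{_ : NonZero n}} → Fraction (ℤ.+ a ℚ./ n) a n
fraction-/ a (suc n) = fraction refl refl

div₀-*-≤ : ∀ a g → a div₀ g * g ≤ a
div₀-*-≤ a zero    = z≤n
div₀-*-≤ a (suc g) = m/n*n≤m a (suc g)

div₀-< : ∀ a {g} → 0 < g → a < (a div₀ g + 1) * g
div₀-< a {suc g} _ = begin-strict
  a                                              ≡⟨ m≡m%n+[m/n]*n a (suc g) ⟩
  a % suc g + a / suc g * suc g                  <⟨ +-monoˡ-< (a / suc g * suc g) (m%n<n a (suc g)) ⟩
  suc (a / suc g) * suc g                        ≡⟨ cong (_* suc g) (+-comm 1 (a / suc g)) ⟩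
  (a / suc g + 1) * suc g                        ∎
  where open ≤-Reasoning

div₀-bound : ∀ {a g k} → 0 < g → a ≤ k * g → a div₀ g ≤ k
div₀-bound {a} {g} {k} 0<g a≤ = *-cancelʳ-≤ _ _ g {{>-nonZero 0<g}} (≤-trans (div₀-*-≤ a g) a≤)

palindrome-centre : ∀ {σ} {T : Text σ} {h c R} → EvenPalindrome T h c R →
                    ∃[ u ] EvenPalindrome T h (suc u) R × R ≤ u × u + R ≤ h
palindrome-centre {c = suc u} pal@(s≤s R≤u , s≤s u+R≤h , _) = u , pal , R≤u , u+R≤h

module SetupRun {w S : ℕ} (32<2^w : 32 < 2 ^ w) (17≤S : 17 ≤ S) where

  open RAM w S 32<2^w

  setup-frame : ∀ (m : Memory) {a b c d} i → isSetup i ≡ false → (m [ 11 ↦ a ] [ 12 ↦ b ] [ 13 ↦ c ] [ 14 ↦ d ]) i ≡ m i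
  setup-frame m i notSetup = trans (miss m₃ _ (≢ 14 refl)) (trans (miss m₂ _ (≢ 13 refl)) (trans (miss m₁ _ (≢ 12 refl)) (miss m _ (≢ 11 refl))))
    where
    m₁ m₂ m₃ : Memory
    m₁ = m [ 11 ↦ _ ]
    m₂ = m₁ [ 12 ↦ _ ]
    m₃ = m₂ [ 13 ↦ _ ]
    ≢ : ∀ r → isSetup r ≡ true → i ≢ r
    ≢ r setup refl = contradiction (trans (sym setup) notSetup) λ ()

  setup-run₄ : ∀ {m e₁ e₂ e₃ e₄ a b c d} →
    eval w m e₁ ≡ a → eval w (m [ 11 ↦ a ]) e₂ ≡ b → eval w (m [ 11 ↦ a ] [ 12 ↦ b ]) e₃ ≡ c →
    eval w (m [ 11 ↦ a ] [ 12 ↦ b ] [ 13 ↦ c ]) e₄ ≡ d →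
    let C = store (lit 11) e₁ ⨾ store (lit 12) e₂ ⨾ store (lit 13) e₃ ⨾ store (lit 14) e₄ in
    Run C m (time C) λ m′ → m′ 11 ≡ a × m′ 12 ≡ b × m′ 13 ≡ c × m′ 14 ≡ d × (∀ i → isSetup i ≡ false → m′ i ≡ m i)
  setup-run₄ {m} {e₁} {e₂} {e₃} {e₄} {a} {b} {c} {d} p₁ p₂ p₃ p₄ =
    run-store-seq {m} {lit 11} {e₁} (ev-lit {m} 11) p₁ (below 11 tt)
    (run-store-seq {m₁} {lit 12} {e₂} (ev-lit {m₁} 12) p₂ (below 12 tt)
    (run-store-seq {m₂} {lit 13} {e₃} (ev-lit {m₂} 13) p₃ (below 13 tt)
    (run-store {m₃} {lit 14} {e₄} (ev-lit {m₃} 14) p₄ (below 14 tt)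
      (refl , refl , refl , refl , setup-frame m))))
    where
    m₁ m₂ m₃ : Memory
    m₁ = m [ 11 ↦ a ]
    m₂ = m₁ [ 12 ↦ b ]
    m₃ = m₂ [ 13 ↦ c ]
    below : ∀ i → Bool.T (i <ᵇ 17) → i < S
    below i i<17 = <-≤-trans (<ᵇ⇒< i 17 i<17) 17≤S

levels-exhausted : ∀ {b L g} f → L < g → length (levels b L f g) ≡ 0
levels-exhausted zero L<g = refl
levels-exhausted {b} {L} {g} (suc f) L<g with g <ᵇ L + 1 in eq
... | false = refl
... | true  = contradiction (≤-pred (subst (g <_) (+-comm L 1) (<ᵇ⇒< g (L + 1) (subst Bool.T (sym eq) tt)))) (<⇒≱ L<g)

length-levels-suc : ∀ b L f g → length (levels b L (suc f) g) ≤ suc (length (levels b L f (g * b)))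
length-levels-suc b L f g with g <ᵇ L + 1
... | true  = ≤-refl
... | false = z≤n

-- Additive error

additiveSetup : Cmd
additiveSetup =
  store (lit 11) (bin quo (reg 3) (reg 4)) ⨾
  store (lit 12) (reg 2 ∔ lit 1) ⨾
  store (lit 13) (bin quo (reg 2) (reg 11) ∔ lit 1) ⨾
  store (lit 14) (reg 2)

module Additive where

  open Variant additive

  -- A single level: its successor has spacing g (n + 1) > n.
  g b Q L : ℕ → ℚᵘ → ℕ
  g n e = ℤ.∣ ↥ e ∣ div₀ ↧ₙ e
  b n e = n + 1
  Q n e = n div₀ g n e + 1
  L n e = n

  module _ (n : ℕ) .{{_ : NonZero n}} (e : ℚᵘ) (inRange : InRange n e) where

    u v : ℕ
    u = ℤ.∣ ↥ e ∣
    v = ↧ₙ e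

    e-fraction : Fraction e u v
    e-fraction = fraction-above e (fraction-fromℕ 1) (proj₁ inRange)

    v≤u : v ≤ u
    v≤u = subst₂ _≤_ (+-identityʳ v) (*-identityʳ u) (fraction-≤⁻ (fraction-fromℕ 1) e-fraction (proj₁ inRange))

    u≤nv : u ≤ n * v
    u≤nv = subst (_≤ n * v) (*-identityʳ u) (fraction-≤⁻ e-fraction (fraction-fromℕ n) (proj₂ inRange))

    0<v : 0 < v
    0<v = s≤s z≤n

    0<g : 0 < g n e
    0<g = m≥n⇒m/n>0 {u} {v} v≤u

    g≤n : g n e ≤ n
    g≤n = div₀-bound 0<v u≤nv

    n≥1 : 1 ≤ n
    n≥1 = >-nonZero⁻¹ n

    q≤n : n div₀ g n e ≤ n
    q≤n = div₀-≤ n (g n e)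

    n<Qg : n < Q n e * g n e
    n<Qg = div₀-< n 0<g

    one-level : length (levels (b n e) n (suc n) (g n e)) ≤ 1
    one-level = subst (λ k → length (levels (b n e) n (suc n) (g n e)) ≤ suc k) (levels-exhausted n n<gb) (length-levels-suc (b n e) n n (g n e))
      where
      n<gb : n < g n e * (n + 1)
      n<gb = ≤-trans (≤-reflexive (+-comm 1 n)) (m≤n*m (n + 1) (g n e) {{>-nonZero 0<g}})

    -- As g ≥ 1, rounding E down to g loses at most a factor 2, so (n / g) E ≤ 2 n. The additional
    -- slot costs E ≤ n.
    Qu≤3nv : Q n e * u ≤ 3 * (n * v)
    Qu≤3nv = begin
      (q + 1) * u                          ≡⟨ eq q u ⟩
      q * u + u                            ≤⟨ +-mono-≤ (*-monoʳ-≤ q u≤2gv) u≤nv ⟩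
      q * (2 * (g n e * v)) + n * v        ≡⟨ eq₂ q (g n e) v (n * v) ⟩
      2 * (q * g n e * v) + n * v          ≤⟨ +-monoˡ-≤ (n * v) (*-monoʳ-≤ 2 (*-monoˡ-≤ v (div₀-*-≤ n (g n e)))) ⟩
      2 * (n * v) + n * v                  ≡⟨ eq₃ (n * v) ⟩
      3 * (n * v)                          ∎
      where
      open ≤-Reasoning
      q = n div₀ g n e
      u≤2gv : u ≤ 2 * (g n e * v)
      u≤2gv = begin
        u                          ≤⟨ <⇒≤ (div₀-< u 0<v) ⟩
        (g n e + 1) * v            ≤⟨ *-monoˡ-≤ v (+-monoʳ-≤ (g n e) 0<g) ⟩
        (g n e + g n e) * v        ≡⟨ eq₄ (g n e) v ⟩
        2 * (g n e * v)            ∎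
        where
        eq₄ : ∀ g v → (g + g) * v ≡ 2 * (g * v)
        eq₄ = solve-∀
      eq : ∀ q u → (q + 1) * u ≡ q * u + u
      eq = solve-∀
      eq₂ : ∀ q g v k → q * (2 * (g * v)) + k ≡ 2 * (q * g * v) + k
      eq₂ = solve-∀
      eq₃ : ∀ k → 2 * k + k ≡ 3 * k
      eq₃ = solve-∀

    bounded : ∀ X {s} → s ≤ X * (length (levels (b n e) n (suc n) (g n e)) * Q n e) → Bound (X * 3) n e s
    bounded X {s} s≤ = fraction-≤ (fraction-* (fraction-fromℕ s) e-fraction) (fraction-* (fraction-fromℕ (X * 3)) (fraction-fromℕ n)) (begin
      s * u * (1 * 1)                ≡⟨ *-identityʳ (s * u) ⟩
      s * u                          ≤⟨ *-monoˡ-≤ u (≤-trans s≤ (*-monoʳ-≤ X (*-monoˡ-≤ (Q n e) one-level))) ⟩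
      X * (1 * Q n e) * u            ≡⟨ eq X (Q n e) u ⟩
      X * (Q n e * u)                ≤⟨ *-monoʳ-≤ X Qu≤3nv ⟩
      X * (3 * (n * v))              ≡⟨ eq₂ X n v ⟩
      X * 3 * n * (1 * v)            ∎)
      where
      open ≤-Reasoning
      eq : ∀ X q u → X * (1 * q) * u ≡ X * (q * u)
      eq = solve-∀
      eq₂ : ∀ X n v → X * (3 * (n * v)) ≡ X * 3 * n * (1 * v)
      eq₂ = solve-∀

    -- If R < g, every answer is within g of R. Otherwise the radius aimed at is R itself, and Q g >
    -- n means that no multiple of g is overwritten before the stream ends.
    reaches-g : ∀ {σ} (T : Text σ) p x h {R} → h ≤ n → Longest T h R →
                R ≤ answer p x (isLandmark (Q n e) (levels (b n e) n (suc n) (g n e))) T h + g n e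
    reaches-g T p x h {R} h≤n ((c , pal) , _) with g n e ≤? R
    ... | no g≰R = ≤-trans (<⇒≤ (≰⇒> g≰R)) (m≤n+m (g n e) _)
    ... | yes g≤R with palindrome-centre {T = T} {h} {c} {R} pal
    ...   | y , pal′ , R≤y , y+R≤h
      with answer-window T p x (Q n e) (levels (b n e) n (suc n) (g n e)) pal′ ≤-refl (level₀∈ {b n e} n g≤n) 0<g
             (m≤n+m 1 (n div₀ g n e)) g≤R
             (λ r r≤R → <-≤-trans (≤-<-trans (≤-trans (+-monoʳ-≤ y r≤R) (≤-trans y+R≤h h≤n)) n<Qg) (m≤n+m _ (y ∸ r)))
    ...     | r , R<r+g , r≤ℓ = ≤-trans (<⇒≤ R<r+g) (+-monoˡ-≤ (g n e) r≤ℓ)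

    approximates : ∀ {σ} (T : Text σ) p x h {R} → h ≤ n → Longest T h R →
                   let ℓ = answer p x (isLandmark (Q n e) (levels (b n e) n (suc n) (g n e))) T h in ℓ ≤ R → Approx e ℓ R
    approximates T p x h {R} h≤n long ℓ≤R =
      ℓ≤R , fraction-≤ (fraction-fromℕ R) (fraction-+ (fraction-fromℕ ℓ) e-fraction) (begin
        R * (1 * v)                  ≤⟨ *-monoˡ-≤ (1 * v) (reaches-g T p x h h≤n long) ⟩
        (ℓ + g n e) * (1 * v)        ≡⟨ eq ℓ (g n e) v ⟩
        ℓ * v + g n e * v            ≤⟨ +-monoʳ-≤ (ℓ * v) (div₀-*-≤ u v) ⟩
        ℓ * v + u                    ≡⟨ eq₂ (ℓ * v) u ⟩
        (ℓ * v + u * 1) * 1          ∎)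
      where
      open ≤-Reasoning
      ℓ = answer p x (isLandmark (Q n e) (levels (b n e) n (suc n) (g n e))) T h
      eq : ∀ ℓ g v → (ℓ + g) * (1 * v) ≡ ℓ * v + g * v
      eq = solve-∀
      eq₂ : ∀ k u → k + u ≡ (k + u * 1) * 1
      eq₂ = solve-∀

    setup-run : ∀ {w S} (32<2^w : 32 < 2 ^ w) → 16 * n < 2 ^ w → u < 2 ^ w → v < 2 ^ w → 17 ≤ S →
                ∀ m → m 2 ≡ n → m 3 ≡ u → m 4 ≡ v → RAM.Run w S 32<2^w additiveSetup m (time additiveSetup) λ m′ →
                  m′ 11 ≡ g n e × m′ 12 ≡ b n e × m′ 13 ≡ Q n e × m′ 14 ≡ L n e × (∀ i → isSetup i ≡ false → m′ i ≡ m i)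
    setup-run {w} {S} 32<2^w 16n-fits u-fits v-fits 17≤S m r2 r3 r4 =
      setup-run₄ {m} {bin quo (reg 3) (reg 4)} {reg 2 ∔ lit 1} {bin quo (reg 2) (reg 11) ∔ lit 1} {reg 2}
        (ev-bin {m} {quo} {reg 3} {reg 4} (ev-reg {m} 3 r3) (ev-reg {m} 4 r4) (≤-<-trans (div₀-≤ u v) u-fits))
        (ev-bin {m₁} {add} {reg 2} {lit 1} (ev-reg {m₁} 2 r2) (ev-lit {m₁} 1) (fits ≤-refl))
        (ev-bin {m₂} {add} {bin quo (reg 2) (reg 11)} {lit 1}
          (ev-bin {m₂} {quo} {reg 2} {reg 11} (ev-reg {m₂} 2 r2) (ev-reg {m₂} 11 refl) (fits (≤-trans q≤n (m≤m+n n 1))))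
          (ev-lit {m₂} 1) (fits (+-monoˡ-≤ 1 q≤n)))
        (ev-reg {m₃} 2 r2)
      where
      open RAM w S 32<2^w
      open SetupRun {w} {S} 32<2^w 17≤S
      m₁ m₂ m₃ : Memory
      m₁ = m [ 11 ↦ g n e ]
      m₂ = m₁ [ 12 ↦ b n e ]
      m₃ = m₂ [ 13 ↦ Q n e ]
      fits : ∀ {k} → k ≤ n + 1 → k < 2 ^ w
      fits k≤ = ≤-<-trans (≤-trans k≤ (+-monoʳ-≤ n (≤-trans n≥1 (m≤m+n n _)))) 16n-fits

  scheme : Scheme additive
  scheme = record
    { g = g ; b = b ; Q = Q ; L = L ; setup = additiveSetup ; factor = λ X → X * 3
    ; correct = λ n e inRange →
        0<g n e inRange , g≤n n e inRange , +-monoˡ-≤ 1 (n≥1 n e inRange) ,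
        +-monoʳ-≤ n (≤-trans (n≥1 n e inRange) (m≤m+n n _)) ,
        m≤n+m 1 (n div₀ g n e) ,
        +-mono-≤ (q≤n n e inRange) (≤-trans (n≥1 n e inRange) (m≤m+n n _)) , m≤m+n n _
    ; approximates = approximates
    ; bounded = bounded
    ; setup-run = setup-run
    }

-- Multiplicative error

-- The ranges from A g up to A g b of consecutive levels adjoin, so one climbs until A g b exceeds
-- R. The hypothesis `small` ensures that the list does not end earlier: every spacing that R calls
-- for is at most L.
level-fitting : ∀ {b L A R} f {g} → 2 ≤ b → 0 < g → L < g + f → (∀ {g} → A * g ≤ R → g ≤ L) → A * g ≤ R →
                ∃[ g′ ] g′ ∈ levels b L f g × 0 < g′ × A * g′ ≤ R × R < A * (g′ * b)
level-fitting {b} {L} zero {g} 2≤b 0<g L<g small Ag≤R = contradiction (small Ag≤R) (<⇒≱ (subst (L <_) (+-identityʳ g) L<g))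
level-fitting {b} {L} {A} {R} (suc f) {g} 2≤b 0<g L<g+f small Ag≤R with g <ᵇ L + 1 in eq
... | false = ⊥-elim (subst Bool.T eq (<⇒<ᵇ (subst (g <_) (+-comm 1 L) (s≤s (small Ag≤R)))))
... | true with A * (g * b) ≤? R
...   | no Agb≰R = g , here refl , 0<g , Ag≤R , ≰⇒> Agb≰R
...   | yes Agb≤R with level-fitting {b} {L} {A} {R} f {g * b} 2≤b (≤-trans 0<g (<⇒≤ g<gb)) L<gb+f small Agb≤R
  where
  g<gb : g < g * b
  g<gb = m<m*n g b {{>-nonZero 0<g}} 2≤b
  L<gb+f : L < g * b + f
  L<gb+f = <-≤-trans (subst (L <_) (+-suc g f) L<g+f) (+-monoˡ-≤ f g<gb)
...     | g′ , g′∈ , rest = g′ , there g′∈ , rest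

-- The last spacing in the list is g times b to the power length - 1, and it passed the guard, so it
-- is at most L.
power-of-levels : ∀ {b L} f g → 1 ≤ length (levels b L f g) → g * b ^ length (levels b L f g) ≤ L * b
power-of-levels {b} {L} (suc f) g 1≤len with g <ᵇ L + 1 in eq
... | true with length (levels b L f (g * b)) | power-of-levels {b} {L} f (g * b)
...   | zero  | _  = subst (λ k → g * k ≤ L * b) (sym (*-identityʳ b))
  (*-monoˡ-≤ b (≤-pred (subst (g <_) (+-comm L 1) (<ᵇ⇒< g (L + 1) (subst Bool.T (sym eq) tt)))))
...   | suc k | ih = subst (_≤ L * b) (*-assoc g b (b ^ suc k)) (ih (s≤s z≤n))

-- Powers of 1 + ε compared without logarithms

module PowerBound (u v : ℕ) (0<v : 0 < v) where

  instance
    v≢0 : NonZero v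
    v≢0 = >-nonZero 0<v

  -- s ≼ c stands for (1 + u/v)ˢ ≤ c.
  infix 4 _≼_
  _≼_ : ℕ → ℕ → Set
  s ≼ c = (v + u) ^ s ≤ c * v ^ s

  ≼-+ : ∀ {s t c d} → s ≼ c → t ≼ d → s + t ≼ c * d
  ≼-+ {s} {t} {c} {d} s≼ t≼ = begin
    (v + u) ^ (s + t)                ≡⟨ ^-distribˡ-+-* (v + u) s t ⟩
    (v + u) ^ s * (v + u) ^ t        ≤⟨ *-mono-≤ s≼ t≼ ⟩
    c * v ^ s * (d * v ^ t)          ≡⟨ [m*n]*[o*p]≡[m*o]*[n*p] c (v ^ s) d (v ^ t) ⟩
    c * d * (v ^ s * v ^ t)          ≡⟨ cong (c * d *_) (^-distribˡ-+-* v s t) ⟨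
    c * d * v ^ (s + t)              ∎
    where open ≤-Reasoning

  ≼-* : ∀ k {s c} → s ≼ c → k * s ≼ c ^ k
  ≼-* zero    s≼ = ≤-refl
  ≼-* (suc k) {s} {c} s≼ = ≼-+ {s} {k * s} {c} {c ^ k} s≼ (≼-* k s≼)

  ≼-weaken : ∀ {s t c} → s ≤ t → t ≼ c → s ≼ c
  ≼-weaken {s} {t} {c} s≤t t≼ = *-cancelʳ-≤ _ _ (v ^ (t ∸ s)) {{m^n≢0 v (t ∸ s)}} (begin
    (v + u) ^ s * v ^ (t ∸ s)              ≤⟨ *-monoʳ-≤ ((v + u) ^ s) (^-monoˡ-≤ (t ∸ s) (m≤m+n v u)) ⟩
    (v + u) ^ s * (v + u) ^ (t ∸ s)        ≡⟨ ^-distribˡ-+-* (v + u) s (t ∸ s) ⟨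
    (v + u) ^ (s + (t ∸ s))                ≡⟨ cong ((v + u) ^_) (m+[n∸m]≡n s≤t) ⟩
    (v + u) ^ t                            ≤⟨ t≼ ⟩
    c * v ^ t                              ≡⟨ cong (λ k → c * v ^ k) (m+[n∸m]≡n s≤t) ⟨
    c * v ^ (s + (t ∸ s))                  ≡⟨ cong (c *_) (^-distribˡ-+-* v s (t ∸ s)) ⟩
    c * (v ^ s * v ^ (t ∸ s))              ≡⟨ *-assoc c (v ^ s) (v ^ (t ∸ s)) ⟨
    c * v ^ s * v ^ (t ∸ s)                ∎)
    where open ≤-Reasoning

  ≼-raise : ∀ {s c d} → c ≤ d → s ≼ c → s ≼ d
  ≼-raise {s} c≤d s≼ = ≤-trans s≼ (*-monoˡ-≤ (v ^ s) c≤d)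

  -- (1 + ε)ᵐ (1 − m ε) ≤ 1, where y / v = 1 − m ε.
  power-complement : ∀ m y → y + m * u ≡ v → (v + u) ^ m * y ≤ v * v ^ m
  power-complement zero    y y≡v = ≤-reflexive (trans (+-identityʳ y) (trans (sym (+-identityʳ y)) (trans y≡v (sym (*-identityʳ v)))))
  power-complement (suc m) y y+≡v = begin
    (v + u) * (v + u) ^ m * y             ≡⟨ eq₁ (v + u) ((v + u) ^ m) y ⟩
    (v + u) ^ m * ((v + u) * y)           ≤⟨ *-monoʳ-≤ ((v + u) ^ m) (subst₂ _≤_ (sym (*-distribʳ-+ y v u)) (eq₂ v y u) (+-monoʳ-≤ (v * y) (*-monoʳ-≤ u y≤v))) ⟩
    (v + u) ^ m * (v * (y + u))           ≡⟨ eq₃ ((v + u) ^ m) v (y + u) ⟩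
    v * ((v + u) ^ m * (y + u))           ≤⟨ *-monoʳ-≤ v (power-complement m (y + u) (trans (+-assoc y u (m * u)) y+≡v)) ⟩
    v * (v * v ^ m)                       ∎
    where
    open ≤-Reasoning
    y≤v : y ≤ v
    y≤v = subst (y ≤_) y+≡v (m≤m+n y _)
    eq₁ : ∀ a b y → a * b * y ≡ b * (a * y)
    eq₁ = solve-∀
    eq₂ : ∀ v y u → v * y + u * v ≡ v * (y + u)
    eq₂ = solve-∀
    eq₃ : ∀ a v y → a * (v * y) ≡ v * (a * y)
    eq₃ = solve-∀

  -- If m ε ≤ 1/2, then the factor 1 - m ε in `power-complement` is at least 1/2.
  ≼-2 : ∀ m → 2 * (m * u) ≤ v → m ≼ 2
  ≼-2 m 2mu≤v = *-cancelʳ-≤ _ _ v (begin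
    (v + u) ^ m * v                  ≤⟨ *-monoʳ-≤ ((v + u) ^ m) v≤2y ⟩
    (v + u) ^ m * (2 * y)            ≡⟨ eq ((v + u) ^ m) y ⟩
    2 * ((v + u) ^ m * y)            ≤⟨ *-monoʳ-≤ 2 (power-complement m y (m∸n+n≡m mu≤v)) ⟩
    2 * (v * v ^ m)                  ≡⟨ eq₂ v (v ^ m) ⟩
    2 * v ^ m * v                    ∎)
    where
    open ≤-Reasoning
    mu≤v : m * u ≤ v
    mu≤v = ≤-trans (m≤m+n (m * u) _) 2mu≤v
    y : ℕ
    y = v ∸ m * u
    v≤2y : v ≤ 2 * y
    v≤2y = +-cancelʳ-≤ (2 * (m * u)) v (2 * y) (begin
      v + 2 * (m * u)          ≤⟨ +-monoʳ-≤ v 2mu≤v ⟩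
      v + v                    ≡⟨ cong (λ k → k + k) (m∸n+n≡m mu≤v) ⟨
      (y + m * u) + (y + m * u) ≡⟨ eq₃ y (m * u) ⟩
      2 * y + 2 * (m * u)      ∎)
      where
      eq₃ : ∀ y k → (y + k) + (y + k) ≡ 2 * y + 2 * k
      eq₃ = solve-∀
    eq : ∀ a y → a * (2 * y) ≡ 2 * (a * y)
    eq = solve-∀
    eq₂ : ∀ v a → 2 * (v * a) ≡ 2 * a * v
    eq₂ = solve-∀

  -- q ≤ 15 + 8 m with m = ⌊d/2⌋, and (1 + u/v)ᵐ ≤ 2 because m u/v ≤ 1/2.
  ≼-β²³ : ∀ β d → 2 ≤ β → v + u ≤ β * v → d * u ≤ v → 11 + d * 4 ≼ β ^ 23
  ≼-β²³ β d 2≤β v+u≤βv du≤v = ≼-weaken {11 + d * 4} {15 * 1 + 8 * m} {β ^ 23} q≤ (≼-raise {15 * 1 + 8 * m} {β ^ 15 * 2 ^ 8} {β ^ 23}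
    (≤-trans (*-monoʳ-≤ (β ^ 15) (^-monoˡ-≤ 8 2≤β)) (≤-reflexive (sym (^-distribˡ-+-* β 15 8))))
    (≼-+ {15 * 1} {8 * m} {β ^ 15} {2 ^ 8} (≼-* 15 {1} {β} 1≼β)
      (≼-* 8 {m} {2} (≼-2 m (≤-trans (≤-reflexive (eq₀ m u)) (≤-trans (*-monoˡ-≤ u (m/n*n≤m d 2)) du≤v))))))
    where
    m : ℕ
    m = d / 2
    1≼β : 1 ≼ β
    1≼β = subst₂ _≤_ (sym (*-identityʳ (v + u))) (cong (β *_) (sym (*-identityʳ v))) v+u≤βv
    d≤ : d ≤ 1 + 2 * m
    d≤ = begin
      d                   ≡⟨ m≡m%n+[m/n]*n d 2 ⟩
      d % 2 + m * 2       ≤⟨ +-mono-≤ (≤-pred (m%n<n d 2)) (≤-reflexive (*-comm m 2)) ⟩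
      1 + 2 * m           ∎
      where open ≤-Reasoning
    q≤ : 11 + d * 4 ≤ 15 * 1 + 8 * m
    q≤ = begin
      11 + d * 4                ≤⟨ +-monoʳ-≤ 11 (*-monoˡ-≤ 4 d≤) ⟩
      11 + (1 + 2 * m) * 4      ≡⟨ eq₁ m ⟩
      15 * 1 + 8 * m            ∎
      where
      open ≤-Reasoning
      eq₁ : ∀ m → 11 + (1 + 2 * m) * 4 ≡ 15 * 1 + 8 * m
      eq₁ = solve-∀
    eq₀ : ∀ m u → 2 * (m * u) ≡ m * 2 * u
    eq₀ = solve-∀

  ^-distribʳ-* : ∀ k a c → (a * c) ^ k ≡ a ^ k * c ^ k
  ^-distribʳ-* zero    a c = refl
  ^-distribʳ-* (suc k) a c = trans (cong (a * c *_) (^-distribʳ-* k a c)) ([m*n]*[o*p]≡[m*o]*[n*p] a c (a ^ k) (c ^ k))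

  -- With β, q and l for the ratio, the slots per level and the levels, and y / v for n ε: (1 +
  -- ε)^(l q) ≤ (β^i)^l = (β^l)^i ≤ (n ε)^(4 i). The constant X enters as a further power.
  resource-bound : ∀ {β q y l X s i} → q ≼ β ^ i → β ^ l * v ^ 4 ≤ y ^ 4 → s ≤ X * (l * q) →
                   (v + u) ^ s * v ^ (4 * (i * X)) ≤ y ^ (4 * (i * X)) * v ^ s
  resource-bound {β} {q} {y} {l} {X} {s} {i} q≼ β^l≤ s≤ = begin
    (v + u) ^ s * v ^ K                            ≤⟨ *-monoˡ-≤ (v ^ K) s≼ ⟩
    (β ^ l) ^ (i * X) * v ^ s * v ^ K              ≡⟨ eq ((β ^ l) ^ (i * X)) (v ^ s) (v ^ K) ⟩
    (β ^ l) ^ (i * X) * v ^ K * v ^ s              ≡⟨ cong (λ k → (β ^ l) ^ (i * X) * k * v ^ s) (^-*-assoc v 4 (i * X)) ⟨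
    (β ^ l) ^ (i * X) * (v ^ 4) ^ (i * X) * v ^ s  ≡⟨ cong (_* v ^ s) (^-distribʳ-* (i * X) (β ^ l) (v ^ 4)) ⟨
    (β ^ l * v ^ 4) ^ (i * X) * v ^ s              ≤⟨ *-monoˡ-≤ (v ^ s) (^-monoˡ-≤ (i * X) β^l≤) ⟩
    (y ^ 4) ^ (i * X) * v ^ s                      ≡⟨ cong (_* v ^ s) (^-*-assoc y 4 (i * X)) ⟩
    y ^ K * v ^ s                                  ∎
    where
    open ≤-Reasoning
    K : ℕ
    K = 4 * (i * X)
    eq : ∀ a b c → a * b * c ≡ a * c * b
    eq = solve-∀
    eq₁ : ∀ i X l → i * (X * l) ≡ l * (i * X)
    eq₁ = solve-∀
    exponents : (β ^ i) ^ (X * l) ≡ (β ^ l) ^ (i * X)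
    exponents = trans (^-*-assoc β i (X * l)) (trans (cong (β ^_) (eq₁ i X l)) (sym (^-*-assoc β l (i * X))))
    s≼ : s ≼ (β ^ l) ^ (i * X)
    s≼ = subst (s ≼_) exponents (≼-weaken {s} {X * l * q} {(β ^ i) ^ (X * l)}
           (≤-trans s≤ (≤-reflexive (sym (*-assoc X l q)))) (≼-* (X * l) {q} {β ^ i} q≼))

  power-≤ : ∀ {β d y l X s K q r} → 2 ≤ β → v + u ≤ β * v → d * u ≤ v → β ^ l * v ^ 4 ≤ y ^ 4 →
            s ≤ X * (l * (11 + d * 4)) → K ≡ 4 * (23 * X) → Fraction q (v + u) v → Fraction r y v → q ^ℚ s ℚ.≤ r ^ℚ K
  power-≤ {β} {d} {y} {l} {X} {s} 2≤β v+u≤βv du≤v β^l≤ s≤ refl q≡ r≡ =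
    fraction-≤ (fraction-^ s q≡) (fraction-^ (4 * (23 * X)) r≡)
      (resource-bound {β} {11 + d * 4} {y} {l} {X} {s} {23} (≼-β²³ β d 2≤β v+u≤βv du≤v) β^l≤ s≤)

multiplicativeSetup : Cmd
multiplicativeSetup =
  store (lit 11) (lit 1) ⨾
  store (lit 12) (lit 2 ∔ bin quo (reg 3) (reg 4)) ⨾
  store (lit 13) (lit 11 ∔ bin quo (reg 4) (reg 3) · lit 4) ⨾
  store (lit 14) (bin quo (reg 2) (lit 2 ∔ bin quo (reg 4) (reg 3)) ∔ lit 1)

module Multiplicative where

  open Variant multiplicative

  -- With A = 2 + ⌊1/ε⌋, a level of spacing g serves the radii from A g up to A g b,
  -- and keeps the last Q = 2 (2 A + 1) + 1 of its multiples.
  g b Q L A : ℕ → ℚᵘ → ℕ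
  g n e = 1
  b n e = 2 + ℤ.∣ ↥ e ∣ div₀ ↧ₙ e
  A n e = 2 + ↧ₙ e div₀ ℤ.∣ ↥ e ∣
  Q n e = 11 + ↧ₙ e div₀ ℤ.∣ ↥ e ∣ * 4
  L n e = n div₀ A n e + 1

  module _ (n : ℕ) .{{_ : NonZero n}} (e : ℚᵘ) (inRange : InRange n e) where

    u v d β α : ℕ
    u = ℤ.∣ ↥ e ∣
    v = ↧ₙ e
    d = v div₀ u
    β = b n e
    α = A n e

    ls : List ℕ
    ls = levels β (L n e) (suc (L n e)) 1

    e-fraction : Fraction e u v
    e-fraction = fraction-above e (fraction-/ 2 n) (proj₁ inRange)

    2v≤un : 2 * v ≤ u * n
    2v≤un = fraction-≤⁻ (fraction-/ 2 n) e-fraction (proj₁ inRange)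

    u≤nv : u ≤ n * v
    u≤nv = subst (_≤ n * v) (*-identityʳ u) (fraction-≤⁻ e-fraction (fraction-fromℕ n) (proj₂ inRange))

    0<v : 0 < v
    0<v = s≤s z≤n

    0<u : 0 < u
    0<u = n≢0⇒n>0 λ u≡0 → <⇒≱ (*-monoʳ-< 2 0<v) (≤-trans 2v≤un (≤-reflexive (cong (_* n) u≡0)))

    n≥1 : 1 ≤ n
    n≥1 = >-nonZero⁻¹ n

    open PowerBound u v 0<v

    d≤n : d ≤ n
    d≤n = div₀-bound 0<u (≤-trans (m≤m+n v _) (≤-trans 2v≤un (≤-reflexive (*-comm u n))))

    ⌊ε⌋≤n : u div₀ v ≤ n
    ⌊ε⌋≤n = div₀-bound 0<v u≤nv

    n/A≤n : n div₀ α ≤ n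
    n/A≤n = div₀-≤ n α

    v+u≤βv : v + u ≤ β * v
    v+u≤βv = begin
      v + u                         ≤⟨ +-monoʳ-≤ v (<⇒≤ (div₀-< u 0<v)) ⟩
      v + (u div₀ v + 1) * v        ≡⟨ eq (u div₀ v) v ⟩
      β * v                         ∎
      where
      open ≤-Reasoning
      eq : ∀ q v → v + (q + 1) * v ≡ (2 + q) * v
      eq = solve-∀

    βv≤2v+u : β * v ≤ 2 * v + u
    βv≤2v+u = subst (_≤ 2 * v + u) (sym (*-distribʳ-+ v 2 (u div₀ v))) (+-monoʳ-≤ (2 * v) (div₀-*-≤ u v))

    -- This is α ≥ 1 + 1/ε, the requirement behind the choice of A: a spacing of at most R / α is
    -- then at most R ε / (1 + ε), the loss that the error allows.
    v+u≤αu : v + u ≤ α * u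
    v+u≤αu = begin
      v + u                    ≤⟨ +-monoˡ-≤ u (<⇒≤ (div₀-< v 0<u)) ⟩
      (d + 1) * u + u          ≡⟨ eq d u ⟩
      α * u                    ∎
      where
      open ≤-Reasoning
      eq : ∀ d u → (d + 1) * u + u ≡ (2 + d) * u
      eq = solve-∀

    y : ℕ
    y = n * u

    2v≤y : 2 * v ≤ y
    2v≤y = subst (2 * v ≤_) (*-comm u n) 2v≤un

    u≤y : u ≤ y
    u≤y = m≤n*m u n

    -- Constants are absorbed through n ε ≥ 2: β ≤ 2 + ε ≤ 2 n ε ≤ (n ε)².
    β-bound : β * v ^ 2 ≤ y ^ 2
    β-bound = begin
      β * v ^ 2                ≡⟨ eq₁ β v ⟩
      β * v * v                ≤⟨ *-monoˡ-≤ v βv≤2v+u ⟩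
      (2 * v + u) * v          ≤⟨ *-monoˡ-≤ v (+-mono-≤ 2v≤y u≤y) ⟩
      (y + y) * v              ≡⟨ eq₂ y v ⟩
      y * (2 * v)              ≤⟨ *-monoʳ-≤ y 2v≤y ⟩
      y * y                    ≡⟨ cong (y *_) (*-identityʳ y) ⟨
      y ^ 2                    ∎
      where
      open ≤-Reasoning
      eq₁ : ∀ β v → β * (v * (v * 1)) ≡ β * v * v
      eq₁ = solve-∀
      eq₂ : ∀ y v → (y + y) * v ≡ y * (2 * v)
      eq₂ = solve-∀

    -- α ε ≥ 1 gives n / α + 1 ≤ n ε + 1 ≤ 2 n ε ≤ (n ε)². This is why the spacings stop near n / α:
    -- with n as the limit there would be about log n levels even for ε near 2 / n, where log (n ε)
    -- is constant.
    L-bound : L n e * v ^ 2 ≤ y ^ 2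
    L-bound = begin
      (q + 1) * v ^ 2          ≡⟨ eq₁ q v ⟩
      (q * v + v) * v          ≤⟨ *-monoˡ-≤ v (+-mono-≤ qv≤y (≤-trans (m≤m+n v _) 2v≤y)) ⟩
      (y + y) * v              ≡⟨ eq₂ y v ⟩
      y * (2 * v)              ≤⟨ *-monoʳ-≤ y 2v≤y ⟩
      y * y                    ≡⟨ cong (y *_) (*-identityʳ y) ⟨
      y ^ 2                    ∎
      where
      open ≤-Reasoning
      q = n div₀ α
      qv≤y : q * v ≤ y
      qv≤y = begin
        q * v                  ≤⟨ *-monoʳ-≤ q (≤-trans (m≤m+n v u) v+u≤αu) ⟩
        q * (α * u)            ≡⟨ *-assoc q α u ⟨
        q * α * u              ≤⟨ *-monoˡ-≤ u (div₀-*-≤ n α) ⟩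
        n * u                  ∎
      eq₁ : ∀ q v → (q + 1) * (v * (v * 1)) ≡ (q * v + v) * v
      eq₁ = solve-∀
      eq₂ : ∀ y v → (y + y) * v ≡ y * (2 * v)
      eq₂ = solve-∀

    1≤L : 1 ≤ L n e
    1≤L = m≤n+m 1 (n div₀ α)

    1≤len : 1 ≤ length ls
    1≤len = nonempty (level₀∈ {β} (L n e) 1≤L)
      where
      nonempty : ∀ {xs : List ℕ} {x} → x ∈ xs → 1 ≤ length xs
      nonempty {_ ∷ _} _ = s≤s z≤n

    levels-bound : β ^ length ls * v ^ 4 ≤ y ^ 4
    levels-bound = begin
      β ^ length ls * v ^ 4                ≤⟨ *-monoˡ-≤ (v ^ 4) (subst (_≤ L n e * β) (+-identityʳ (β ^ length ls)) (power-of-levels {β} {L n e} (suc (L n e)) 1 1≤len)) ⟩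
      L n e * β * v ^ 4                    ≡⟨ cong (L n e * β *_) (^-distribˡ-+-* v 2 2) ⟩
      L n e * β * (v ^ 2 * v ^ 2)          ≡⟨ [m*n]*[o*p]≡[m*o]*[n*p] (L n e) β (v ^ 2) (v ^ 2) ⟩
      L n e * v ^ 2 * (β * v ^ 2)          ≤⟨ *-mono-≤ L-bound β-bound ⟩
      y ^ 2 * y ^ 2                        ≡⟨ ^-distribˡ-+-* y 2 2 ⟨
      y ^ 4                                ∎
      where open ≤-Reasoning

    bounded : ∀ X {s} → s ≤ X * (length ls * Q n e) → Bound (4 * (23 * X)) n e s
    bounded X {s} s≤ =
      power-≤ {β} {d} {y} {length ls} {X} (m≤m+n 2 _) v+u≤βv (div₀-*-≤ v u) levels-bound s≤ refl 1+ε nε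
      where
      1+ε : Fraction (fromℕ 1 ℚ.+ e) (v + u) v
      1+ε = subst₂ (Fraction (fromℕ 1 ℚ.+ e)) (cong₂ _+_ (*-identityˡ v) (*-identityʳ u)) (*-identityˡ v) (fraction-+ (fraction-fromℕ 1) e-fraction)
      nε : Fraction (fromℕ n ℚ.* e) y v
      nε = subst (Fraction (fromℕ n ℚ.* e) y) (*-identityˡ v) (fraction-* (fraction-fromℕ n) e-fraction)

    Reported : ∀ {σ} → Text σ → (p x h : ℕ) → ℕ
    Reported T p x h = answer p x (isLandmark (Q n e) ls) T h

    -- Between the landmark z - r and the time z + r at which it is read lie 2 r ≤ 2 m positions,
    -- fewer than the Q γ that the buffer spans.
    recent : ∀ {z m r} γ → m ≤ z → r ≤ m → 2 * m < Q n e * γ → z + r < (z ∸ r) + Q n e * γ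
    recent {z} {m} {r} γ m≤z r≤m 2m<Qγ = begin-strict
      z + r                         ≡⟨ cong (_+ r) (m∸n+n≡m (≤-trans r≤m m≤z)) ⟨
      z ∸ r + r + r                 ≡⟨ eq (z ∸ r) r ⟩
      z ∸ r + 2 * r                 ≤⟨ +-monoʳ-≤ (z ∸ r) (*-monoʳ-≤ 2 r≤m) ⟩
      z ∸ r + 2 * m                 <⟨ +-monoʳ-< (z ∸ r) 2m<Qγ ⟩
      z ∸ r + Q n e * γ             ∎
      where
      open ≤-Reasoning
      eq : ∀ a r → a + r + r ≡ a + 2 * r
      eq = solve-∀

    Q≡4α+3 : Q n e ≡ 4 * α + 3
    Q≡4α+3 = eq d
      where
      eq : ∀ d → 11 + d * 4 ≡ 4 * (2 + d) + 3
      eq = solve-∀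

    B<Q : ∀ γ → 0 < γ → 2 * ((2 * α + 1) * γ) < Q n e * γ
    B<Q γ 0<γ = subst₂ _<_ (*-assoc 2 (2 * α + 1) γ) (cong (_* γ) (sym Q≡4α+3))
      (*-monoˡ-< γ {{>-nonZero 0<γ}} (subst (_< 4 * α + 3) (eq α) (+-monoʳ-< (4 * α) (n<1+n 2))))
      where
      eq : ∀ α → 4 * α + 2 ≡ 2 * (2 * α + 1)
      eq = solve-∀

    -- Three ranges of R. Below α the level of spacing 1 loses nothing. Otherwise a level γ with α γ
    -- ≤ R < α γ β is used: up to (2 α + 1) γ it aims at R and loses less than γ; beyond that it
    -- aims at (2 α + 1) γ only, which keeps the buffer short.
    reaches-fraction : ∀ {σ} (T : Text σ) p x h {R} → h ≤ n → Longest T h R → R * v ≤ (v + u) * Reported T p x h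
    reaches-fraction T p x h {zero}  h≤n _ = z≤n
    reaches-fraction T p x h {R@(suc _)} h≤n ((c , pal) , _) with palindrome-centre {T = T} {h} {c} {R} pal
    ... | z , pal′ , R≤z , z+R≤h with α ≤? R
    ...   | no α≰R with answer-window T p x (Q n e) ls pal′ ≤-refl (level₀∈ {β} (L n e) 1≤L) (s≤s z≤n) (s≤s z≤n) (s≤s z≤n)
                        (λ r r≤R → recent 1 R≤z r≤R 2R<Q)
      where
      2R<Q : 2 * R < Q n e * 1
      2R<Q = ≤-<-trans (*-monoʳ-≤ 2 (≤-trans (<⇒≤ (≰⇒> α≰R)) (≤-trans (m≤m+n α _) (≤-trans (m≤m+n (2 * α) 1) (≤-reflexive (sym (*-identityʳ (2 * α + 1)))))))) (B<Q 1 (s≤s z≤n))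
    -- With spacing 1 the loss is below 1, hence zero.
    ...     | r , R<r+1 , r≤ℓ = ≤-trans (≤-reflexive (*-comm R v))
              (*-mono-≤ (m≤m+n v u) (≤-trans (≤-pred (subst (R <_) (+-comm r 1) R<r+1)) r≤ℓ))
    reaches-fraction T p x h {R@(suc _)} h≤n ((c , pal) , _) | z , pal′ , R≤z , z+R≤h | yes α≤R
      with level-fitting {β} {L n e} {α} {R} (suc (L n e)) {1} (m≤m+n 2 _) (s≤s z≤n) (m≤n+m (suc (L n e)) 1) αγ≤R⇒γ≤L
             (≤-trans (≤-reflexive (*-identityʳ α)) α≤R)
      where
      R≤n : R ≤ n
      R≤n = ≤-trans (m≤n+m R z) (≤-trans z+R≤h h≤n)
      -- α γ ≤ R ≤ n < (n / α + 1) α. Spacings above L would only serve radii greater than n.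
      αγ≤R⇒γ≤L : ∀ {γ} → α * γ ≤ R → γ ≤ L n e
      αγ≤R⇒γ≤L {γ} αγ≤R = <⇒≤ (*-cancelʳ-< α γ (L n e) (≤-<-trans (≤-trans (≤-reflexive (*-comm γ α)) (≤-trans αγ≤R R≤n)) (div₀-< n (s≤s z≤n))))
    ... | γ , γ∈ , 0<γ , αγ≤R , R<αγβ with R ≤? (2 * α + 1) * γ
    ...   | yes R≤Bγ with answer-window T p x (Q n e) ls pal′ ≤-refl γ∈ 0<γ (s≤s z≤n) (≤-trans (m≤n*m γ α) αγ≤R)
                           (λ r r≤R → recent γ R≤z r≤R (≤-<-trans (*-monoʳ-≤ 2 R≤Bγ) (B<Q γ 0<γ)))
    ...     | r , R<r+γ , r≤ℓ = ≤-trans Rv≤ (*-monoʳ-≤ (v + u) r≤ℓ)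
      where
      open ≤-Reasoning
      eq : ∀ R v u → R * v + R * u ≡ (v + u) * R
      eq = solve-∀
      eq₂ : ∀ a u g → a * u * g ≡ a * g * u
      eq₂ = solve-∀
      -- (1 + ε) γ ≤ α ε γ ≤ ε R, so R + (1 + ε) γ ≤ (1 + ε) R ≤ (1 + ε) (r + γ), and (1 + ε) γ
      -- cancels.
      Rv≤ : R * v ≤ (v + u) * r
      Rv≤ = +-cancelʳ-≤ ((v + u) * γ) (R * v) ((v + u) * r) (begin
        R * v + (v + u) * γ         ≤⟨ +-monoʳ-≤ (R * v) (begin
          (v + u) * γ                 ≤⟨ *-monoˡ-≤ γ v+u≤αu ⟩
          α * u * γ                   ≡⟨ eq₂ α u γ ⟩
          α * γ * u                   ≤⟨ *-monoˡ-≤ u αγ≤R ⟩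
          R * u                       ∎) ⟩
        R * v + R * u               ≡⟨ eq R v u ⟩
        (v + u) * R                 ≤⟨ *-monoʳ-≤ (v + u) (<⇒≤ R<r+γ) ⟩
        (v + u) * (r + γ)           ≡⟨ *-distribˡ-+ (v + u) r γ ⟩
        (v + u) * r + (v + u) * γ   ∎)
    reaches-fraction T p x h {R@(suc _)} h≤n ((c , pal) , _) | z , pal′ , R≤z , z+R≤h | yes α≤R | γ , γ∈ , 0<γ , αγ≤R , R<αγβ | no R≰Bγ
      with answer-window T p x (Q n e) ls pal′ (<⇒≤ (≰⇒> R≰Bγ)) γ∈ 0<γ (s≤s z≤n) (m≤n*m γ (2 * α + 1) {{>-nonZero (m≤n+m 1 (2 * α))}})
             (λ r r≤ → recent γ (≤-trans (<⇒≤ (≰⇒> R≰Bγ)) R≤z) r≤ (B<Q γ 0<γ))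
    ...   | r , Bγ<r+γ , r≤ℓ = ≤-trans Rv≤ (*-monoʳ-≤ (v + u) r≤ℓ)
      where
      open ≤-Reasoning
      2αγ≤r : 2 * α * γ ≤ r
      2αγ≤r = +-cancelʳ-≤ γ (2 * α * γ) r (≤-trans (≤-reflexive (eq α γ)) (<⇒≤ Bγ<r+γ))
        where
        eq : ∀ α γ → 2 * α * γ + γ ≡ (2 * α + 1) * γ
        eq = solve-∀
      eq₁ : ∀ α γ β v → α * (γ * β) * v ≡ α * γ * (β * v)
      eq₁ = solve-∀
      eq₂ : ∀ α γ v u → α * γ * (2 * v + 2 * u) ≡ (v + u) * (2 * α * γ)
      eq₂ = solve-∀
      -- r ≥ 2 α γ, whereas R < α γ β with β ≤ 2 + ε ≤ 2 (1 + ε).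
      Rv≤ : R * v ≤ (v + u) * r
      Rv≤ = begin
        R * v                           ≤⟨ *-monoˡ-≤ v (<⇒≤ R<αγβ) ⟩
        α * (γ * β) * v                 ≡⟨ eq₁ α γ β v ⟩
        α * γ * (β * v)                 ≤⟨ *-monoʳ-≤ (α * γ) (≤-trans βv≤2v+u (+-monoʳ-≤ (2 * v) (m≤m+n u _))) ⟩
        α * γ * (2 * v + 2 * u)         ≡⟨ eq₂ α γ v u ⟩
        (v + u) * (2 * α * γ)           ≤⟨ *-monoʳ-≤ (v + u) 2αγ≤r ⟩
        (v + u) * r                     ∎

    approximates : ∀ {σ} (T : Text σ) p x h {R} → h ≤ n → Longest T h R → Reported T p x h ≤ R → Approx e (Reported T p x h) R
    approximates T p x h {R} h≤n long ℓ≤R =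
      ℓ≤R , fraction-≤ (fraction-fromℕ R) (fraction-* (fraction-+ (fraction-fromℕ 1) e-fraction) (fraction-fromℕ ℓ)) (begin
        R * (1 * v * 1)              ≡⟨ eq₁ R v ⟩
        R * v                        ≤⟨ reaches-fraction T p x h h≤n long ⟩
        (v + u) * ℓ                  ≡⟨ eq₂ v u ℓ ⟩
        (1 * v + u * 1) * ℓ * 1      ∎)
      where
      open ≤-Reasoning
      ℓ = Reported T p x h
      eq₁ : ∀ R v → R * (1 * v * 1) ≡ R * v
      eq₁ = solve-∀
      eq₂ : ∀ v u ℓ → (v + u) * ℓ ≡ (1 * v + u * 1) * ℓ * 1
      eq₂ = solve-∀

    k+n≤16n : ∀ {k j} → k ≤ 11 → j ≤ n → k + j * 4 ≤ 16 * n
    k+n≤16n {k} {j} k≤ j≤ = begin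
      k + j * 4             ≤⟨ +-mono-≤ (≤-trans k≤ (*-monoʳ-≤ 11 n≥1)) (*-monoˡ-≤ 4 j≤) ⟩
      11 * n + n * 4        ≡⟨ eq n ⟩
      15 * n                ≤⟨ *-monoˡ-≤ n (n≤1+n 15) ⟩
      16 * n                ∎
      where
      open ≤-Reasoning
      eq : ∀ n → 11 * n + n * 4 ≡ 15 * n
      eq = solve-∀

    setup-run : ∀ {w S} (32<2^w : 32 < 2 ^ w) → 16 * n < 2 ^ w → u < 2 ^ w → v < 2 ^ w → 17 ≤ S →
                ∀ m → m 2 ≡ n → m 3 ≡ u → m 4 ≡ v → RAM.Run w S 32<2^w multiplicativeSetup m (time multiplicativeSetup) λ m′ →
                  m′ 11 ≡ g n e × m′ 12 ≡ b n e × m′ 13 ≡ Q n e × m′ 14 ≡ L n e × (∀ i → isSetup i ≡ false → m′ i ≡ m i)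
    setup-run {w} {S} 32<2^w 16n-fits u-fits v-fits 17≤S m r2 r3 r4 =
      setup-run₄ {m} {lit 1} {lit 2 ∔ bin quo (reg 3) (reg 4)} {lit 11 ∔ bin quo (reg 4) (reg 3) · lit 4}
                 {bin quo (reg 2) (lit 2 ∔ bin quo (reg 4) (reg 3)) ∔ lit 1}
        (ev-lit {m} 1)
        (ev-bin {m₁} {add} {lit 2} {bin quo (reg 3) (reg 4)} (ev-lit {m₁} 2)
          (ev-bin {m₁} {quo} {reg 3} {reg 4} (ev-reg {m₁} 3 r3) (ev-reg {m₁} 4 r4) (≤-<-trans (div₀-≤ u v) u-fits))
          (fits (m≤m+n 2 9) ⌊ε⌋≤n))
        (ev-bin {m₂} {add} {lit 11} {bin quo (reg 4) (reg 3) · lit 4} (ev-lit {m₂} 11)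
          (ev-bin {m₂} {mul} {bin quo (reg 4) (reg 3)} {lit 4} (d≡ {m₂} r3 r4) (ev-lit {m₂} 4) (≤-<-trans (k+n≤16n z≤n d≤n) 16n-fits))
          (≤-<-trans (k+n≤16n ≤-refl d≤n) 16n-fits))
        (ev-bin {m₃} {add} {bin quo (reg 2) (lit 2 ∔ bin quo (reg 4) (reg 3))} {lit 1}
          (ev-bin {m₃} {quo} {reg 2} {lit 2 ∔ bin quo (reg 4) (reg 3)} (ev-reg {m₃} 2 r2)
            (ev-bin {m₃} {add} {lit 2} {bin quo (reg 4) (reg 3)} (ev-lit {m₃} 2) (d≡ {m₃} r3 r4) (fits (m≤m+n 2 9) d≤n))
            (fits z≤n n/A≤n))
          (ev-lit {m₃} 1) (subst (_< 2 ^ w) (+-comm 1 (n div₀ α)) (fits (s≤s z≤n) n/A≤n)))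
      where
      open RAM w S 32<2^w
      open SetupRun {w} {S} 32<2^w 17≤S
      m₁ m₂ m₃ : Memory
      m₁ = m [ 11 ↦ g n e ]
      m₂ = m₁ [ 12 ↦ b n e ]
      m₃ = m₂ [ 13 ↦ Q n e ]
      fits : ∀ {k j} → k ≤ 11 → j ≤ n → k + j < 2 ^ w
      fits {k} {j} k≤ j≤ = ≤-<-trans (≤-trans (+-monoʳ-≤ k (m≤m*n j 4)) (k+n≤16n k≤ j≤)) 16n-fits
      d≡ : ∀ {m} → m 3 ≡ u → m 4 ≡ v → eval w m (bin quo (reg 4) (reg 3)) ≡ d
      d≡ {m} r3 r4 = ev-bin {m} {quo} {reg 4} {reg 3} (ev-reg {m} 4 r4) (ev-reg {m} 3 r3) (≤-<-trans (div₀-≤ v u) v-fits)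

  scheme : Scheme multiplicative
  scheme = record
    { g = g ; b = b ; Q = Q ; L = L ; setup = multiplicativeSetup ; factor = λ X → 4 * (23 * X)
    ; correct = λ n e inRange →
        s≤s z≤n , 1≤L n e inRange , m≤m+n 2 _ ,
        subst (b n e ≤_) (eq n) (+-mono-≤ (*-monoʳ-≤ 2 (n≥1 n e inRange)) (⌊ε⌋≤n n e inRange)) ,
        s≤s z≤n , k+n≤16n n e inRange ≤-refl (d≤n n e inRange) ,
        +-mono-≤ (n/A≤n n e inRange) (≤-trans (n≥1 n e inRange) (m≤m+n n _))
    ; approximates = approximates
    ; bounded = bounded
    ; setup-run = setup-run
    }
    where
    eq : ∀ n → 2 * n + n ≡ 3 * n
    eq = solve-∀

theorem3p1 : BasicAlgorithmAchieves additive × BasicAlgorithmAchieves multiplicative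
theorem3p1 = Achieves.achieves Additive.scheme , Achieves.achieves Multiplicative.scheme
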